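{- Let $q$ be even, let $Q^+(5,q)$ be a hyperbolic (Klein) quadric in $\mathrm{PG}(5,q)$ with associated symplectic polarity $\zeta$, let $\Pi$ be a $3$-dimensional subspace with $\Pi\cap Q^+(5,q)=Q^-(3,q)$ an elliptic quadric, let $W(q)$ be the generalized quadrangle of points of $\Pi$ and lines of $\Pi$ meeting $Q^-(3,q)$ in exactly one point, and let $O\neq Q^-(3,q)$ be an ovoid of $W(q)$. For $x\in\Pi\setminus Q^-(3,q)$ let $\pi_x$ be the plane of $\Pi$ containing all lines of $W(q)$ through $x$ and $\mathcal{C}_x:=\pi_x^\zeta\cap Q^+(5,q)$. Then the set \[ X:=\Big(\bigcup_{x\in O\setminus Q^-(3,q)}\mathcal{C}_x\Big)\cup\big(O\cap Q^-(3,q)\big) \] is a generalized quadratic set of type (SC) of $Q^+(5,q)$ satisfying properties (1) and (2) below: (1) every plane of $Q^+(5,q)$ through a point of $A_1$ has type (S); (2) every plane $\pi$ of $Q^+(5,q)$ through a point $x\in A_2$ has type (C) and $x$ is the kernel of the oval $\pi\cap X$. Here $A_1$ is the set of points of $X$ contained in some plane of type (S), and $A_2$ is the set of kernels of the ovals $\pi\cap X$ with $\pi$ a plane of type (C).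
   Context: $\zeta$ is the symplectic polarity associated with the bilinear form of the quadratic form defining $Q^+(5,q)$. An ovoid of $W(q)$ is a set of points of $\Pi$ meeting every line of $W(q)$ in exactly one point. A generalized quadratic set of type (SC) of $Q^+(5,q)$ is a set $X$ of points of $Q^+(5,q)$ such that every plane contained in $Q^+(5,q)$ meets $X$ either in a single point (type (S) plane) or in an oval of that plane (type (C) plane), and both types occur. An oval of a projective plane of order $q$ is a set of $q+1$ points no three collinear; for $q$ even, all its tangent lines pass through one point, its kernel (nucleus). -}

module Defs where

open import Level using (0ℓ)
open import Data.Nat using (ℕ; zero; suc; _+_; _*_)
open import Data.Nat.Divisibility using (_∣_)
open import Data.Fin using (Fin; zero; suc)
open import Data.Product using (Σ; ∃; _×_; _,_)
open import Data.Sum using (_⊎_)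
open import Data.Empty using (⊥)
open import Relation.Nullary using (¬_)
open import Relation.Binary.PropositionalEquality using (_≡_)
open import Algebra.Structures using (IsCommutativeRing)
open import Function.Bundles using (_↔_)

record FiniteField (q : ℕ) : Set₁ where
  infixl 6 _+F_
  infixl 7 _*F_
  field
    F      : Set
    _+F_   : F → F → F
    _*F_   : F → F → F
    -F_    : F → F
    0F 1F  : F
    isCommutativeRing : IsCommutativeRing _≡_ _+F_ _*F_ -F_ 0F 1F
    0≢1    : ¬ (0F ≡ 1F)
    inverse : ∀ x → ¬ (x ≡ 0F) → Σ F (λ y → x *F y ≡ 1F)
    card   : F ↔ Fin q

module Geometry {q : ℕ} (K : FiniteField q) where
  open FiniteField K public

  ∑ : ∀ {n} → (Fin n → F) → F
  ∑ {zero}  f = 0F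
  ∑ {suc n} f = f zero +F ∑ (λ i → f (suc i))

  V : Set
  V = Fin 6 → F

  _≈_ : V → V → Set
  u ≈ v = ∀ i → u i ≡ v i

  0V : V
  0V _ = 0F

  _+V_ : V → V → V
  (u +V v) i = u i +F v i

  _·_ : F → V → V
  (c · v) i = c *F v i

  NonZero : V → Set
  NonZero v = ¬ (v ≈ 0V)

  lc : ∀ {k} → (Fin k → F) → (Fin k → V) → V
  lc c w j = ∑ (λ i → c i *F w i j)

  LinIndep : ∀ {k} → (Fin k → V) → Set
  LinIndep w = ∀ c → lc c w ≈ 0V → ∀ i → c i ≡ 0F

  InSpan : ∀ {k} → (Fin k → V) → V → Set
  InSpan w v = Σ (_ → F) (λ c → v ≈ lc c w)

  -- a projective subspace of projective dimension d, given by a basis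
  -- of the corresponding (d+1)-dimensional vector subspace
  record Subspace (d : ℕ) : Set where
    constructor subspace
    field
      basis : Fin (suc d) → V
      indep : LinIndep basis

  Plane = Subspace 2
  Line  = Subspace 1
  Solid = Subspace 3

  _∈S_ : ∀ {d} → V → Subspace d → Set
  v ∈S S = NonZero v × InSpan (Subspace.basis S) v

  _⊆S_ : ∀ {d e} → Subspace d → Subspace e → Set
  S ⊆S T = ∀ i → InSpan (Subspace.basis T) (Subspace.basis S i)

  SamePoint : V → V → Set
  SamePoint u v = Σ F (λ c → ¬ (c ≡ 0F) × (u ≈ (c · v)))

  -- sets of points of PG(5,q): predicates on nonzero vectors
  PointSet : Set₁
  PointSet = V → Set

  MeetsInOnePoint : ∀ {d} → PointSet → Subspace d → Set
  MeetsInOnePoint X S =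
    Σ V (λ p → p ∈S S × X p × (∀ p' → p' ∈S S → X p' → SamePoint p' p))

  triple : V → V → V → Fin 3 → V
  triple u v w zero = u
  triple u v w (suc zero) = v
  triple u v w (suc (suc zero)) = w

  Collinear : V → V → V → Set
  Collinear u v w = ¬ LinIndep (triple u v w)

  IsOvalIn : PointSet → Plane → Set
  IsOvalIn X π =
    Σ (Fin (suc q) → V) (λ p →
        (∀ i → p i ∈S π × X (p i))
      × (∀ i j → SamePoint (p i) (p j) → i ≡ j)
      × (∀ i j k → ¬ (i ≡ j) → ¬ (j ≡ k) → ¬ (i ≡ k) →
                   ¬ Collinear (p i) (p j) (p k))
      × (∀ v → v ∈S π → X v → Σ (Fin (suc q)) (λ i → SamePoint v (p i))))

  IsKernel : PointSet → Plane → V → Set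
  IsKernel X π n = n ∈S π × (∀ (L : Line) → L ⊆S π → MeetsInOnePoint X L → n ∈S L)

  module Quadric (a : Fin 6 → Fin 6 → F) where

    Qf : V → F
    Qf x = ∑ (λ i → ∑ (λ j → a i j *F x i *F x j))

    B : V → V → F
    B x y = Qf (x +V y) +F (-F (Qf x)) +F (-F (Qf y))

    NondegenerateB : Set
    NondegenerateB = ∀ x → (∀ y → B x y ≡ 0F) → x ≈ 0V

    OnQ : PointSet
    OnQ v = NonZero v × Qf v ≡ 0F

    TotallySingular : ∀ {d} → Subspace d → Set
    TotallySingular S = ∀ v → v ∈S S → Qf v ≡ 0F

    -- Q^+(5,q): nondegenerate quadric in PG(5,q) containing a plane
    -- (Witt index 3), i.e. hyperbolic
    Hyperbolic : Set
    Hyperbolic = NondegenerateB × Σ Plane TotallySingular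

    -- S ∩ Q is an elliptic quadric Q^-(3,q) of the solid S: it is
    -- nonsingular (no singular point in S) and contains no line
    EllipticIn : Solid → Set
    EllipticIn S =
        (∀ v → v ∈S S → Qf v ≡ 0F → (∀ w → InSpan (Subspace.basis S) w → B v w ≡ 0F) → ⊥)
      × (∀ (L : Line) → L ⊆S S → TotallySingular L → ⊥)

    InPolar : ∀ {d} → Subspace d → V → Set
    InPolar S y = NonZero y × (∀ i → B (Subspace.basis S i) y ≡ 0F)

    QPlane : Plane → Set
    QPlane π = TotallySingular π

    TypeS : PointSet → Plane → Set
    TypeS X π = MeetsInOnePoint X π

    TypeC : PointSet → Plane → Set
    TypeC X π = IsOvalIn X π

    GenQuadSetSC : PointSet → Set
    GenQuadSetSC X =
        (∀ v → X v → OnQ v)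
      × (∀ π → QPlane π → TypeS X π ⊎ TypeC X π)
      × Σ Plane (λ π → QPlane π × TypeS X π)
      × Σ Plane (λ π → QPlane π × TypeC X π)

    A₁ : PointSet → PointSet
    A₁ X v = X v × Σ Plane (λ π → QPlane π × TypeS X π × v ∈S π)

    A₂ : PointSet → PointSet
    A₂ X v = Σ Plane (λ π → QPlane π × TypeC X π × IsKernel X π v)

    Property1 : PointSet → Set
    Property1 X = ∀ v → A₁ X v → ∀ π → QPlane π → v ∈S π → TypeS X π

    Property2 : PointSet → Set
    Property2 X = ∀ v → A₂ X v → ∀ π → QPlane π → v ∈S π →
                  TypeC X π × IsKernel X π v

    module InSolid (Π : Solid) where

      InE : PointSet
      InE v = v ∈S Π × Qf v ≡ 0F

      WLine : Line → Set
      WLine L = L ⊆S Π × MeetsInOnePoint InE L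

      IsOvoidW : PointSet → Set
      IsOvoidW O = (∀ u v → SamePoint u v → O v → O u)
                 × (∀ v → O v → v ∈S Π)
                 × (∀ L → WLine L → MeetsInOnePoint O L)

      IsPiX : V → Plane → Set
      IsPiX x π = π ⊆S Π × (∀ L → WLine L → x ∈S L → L ⊆S π)

      Cx : V → PointSet
      Cx x y = Σ Plane (λ π → IsPiX x π × InPolar π y × OnQ y)

      Xset : PointSet → PointSet
      Xset O y = Σ V (λ x → O x × ¬ InE x × Cx x y) ⊎ (O y × InE y)

{-# OPTIONS --safe #-}
-- Every x ∈ V is proj x + res x with proj x ∈ Π and res x ∈ Π^⊥, and X consists of the points x of the
-- Klein quadric with proj x ∈ O.  Since Π^⊥ is anisotropic, proj embeds a plane π of the quadric as a plane
-- z^⊥ of Π.  If z ∈ O, then O ∩ z^⊥ = {z}; otherwise each of the q + 1 lines of W(q) through z carries one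
-- point of O, and these points form an oval with nucleus z because O has no three collinear points.
-- A point v ∈ π with proj v = z lies in Π (otherwise π ∩ Π would contain a line), so v = z is the pole of every
-- plane of the quadric through v, which gives both properties.  Planes of type (S) exist since O meets
-- Q^-(3,q) (a parity argument), planes of type (C) since Q^-(3,q) is not contained in O.

module Submission where

open import Defs
open import Data.Nat using (ℕ)
open import Data.Nat.Divisibility using (_∣_)
open import Data.Fin using (Fin)
open import Data.Product using (_×_; Σ)
open import Relation.Nullary using (¬_)

open import Data.Bool using (Bool; true; false; not; _xor_)
open import Data.Bool.Properties using (xor-∧-commutativeRing; xor-same)
open import Data.Empty using (⊥; ⊥-elim)
open import Data.Fin using (zero; suc; toℕ; punchOut; combine; finToFun; funToFin; _<?_)
open import Data.Fin.Properties using (punchOut-injective; any?; all?; <-cmp; injective⇒≤; pigeonhole; *↔×; finToFun-funToFin; funToFin-finToFin)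
  renaming (_≟_ to _≟F_)
open import Data.Maybe using (Maybe; just; nothing)
import Data.Nat as ℕ
open import Data.Nat using (zero; suc)
open import Data.Nat.Divisibility using (divides)
import Data.Nat.Properties as ℕₚ
open import Data.Product using (∃; _,_; proj₁; proj₂)
open import Data.Product.Function.NonDependent.Propositional using (_×-↔_)
open import Data.Sum using (_⊎_; inj₁; inj₂)
open import Data.Vec.Functional using (_∷_; [])
open import Function.Bundles using (_↔_; Inverse; mk↔ₛ′)
open import Function.Construct.Composition using (_↔-∘_)
open import Function.Construct.Symmetry using (↔-sym)
open import Relation.Binary.Definitions using (tri<; tri≈; tri>; DecidableEquality)
open import Relation.Binary.PropositionalEquality
open import Relation.Nullary using (Dec; yes; no)
open import Relation.Nullary.Decidable using (⌊_⌋; map′; ¬?; _×-dec_)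
open import Algebra.Bundles using (CommutativeRing)
open import Algebra.Properties.CommutativeMonoid.Sum
  (CommutativeRing.+-commutativeMonoid xor-∧-commutativeRing)
  using (sum; ∑-distrib-+; sum-permute; sum-cong-≗)
open import Algebra.Solver.Ring.AlmostCommutativeRing using (fromCommutativeRing; _-Raw-AlmostCommutative⟶_)
open ≡-Reasoning

-- Most of the counting rests on one fact: an injective self-map of a finite set is surjective. It
-- yields square roots, the absence of three collinear points of O (the core of the classical fact
-- that an ovoid of W(q), q even, is an ovoid of PG(3,q)), and the second point of O on a line of
-- the plane z^⊥. Dimension arguments come from the pigeonhole principle on coefficient vectors.
-- Points of O are identified through orthogonality: two orthogonal points of O coincide, as they
-- would otherwise span a line of W(q). O is an arbitrary predicate; its decidability is derived,
-- since v lies on O exactly when the point of O on some line of W(q) through v is v. That Π^⊥ is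
-- anisotropic comes from the singular plane in the hypothesis: a singular point of Π^⊥ would lie on
-- a plane of the quadric, and that plane would meet Π in a line, against ellipticity. The delicate
-- point is that O meets Q^-(3,q): nothing local forces it. If O missed the quadric, the nonzero
-- singular vectors of Π, (q^2 + 1)(q - 1) in number and thus an odd set, would carry a fixed-point
-- free involution.

-- Finite sets: exhaustive search, pigeonhole, parity.

module Finite {T : Set} {n : ℕ} (fin : T ↔ Fin n) where
  open Inverse fin

  from-to : ∀ x → from (to x) ≡ x
  from-to x = inverseʳ refl

  to-from : ∀ i → to (from i) ≡ i
  to-from i = inverseˡ refl

  to-injective : ∀ {x y} → to x ≡ to y → x ≡ y
  to-injective {x} {y} p = trans (sym (from-to x)) (trans (cong from p) (from-to y))

  infix 4 _≟_
  _≟_ : DecidableEquality T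
  x ≟ y = map′ to-injective (cong to) (to x ≟F to y)

  search : {P : T → Set} → (∀ x → Dec (P x)) → Dec (Σ T P)
  search {P} P? = map′ (λ (i , p) → from i , p)
                       (λ (x , p) → to x , subst P (sym (from-to x)) p)
                       (any? (λ i → P? (from i)))

  -- A missed value y could be punched out of the codomain, which would leave an injection of
  -- `Fin (suc m)` into `Fin m`.
  injective⇒surjective : (f : T → T) → (∀ {x y} → f x ≡ f y → x ≡ y) → ∀ y → Σ T λ x → f x ≡ y
  injective⇒surjective f f-inj y with search (λ x → f x ≟ y)
  ... | yes p = p
  ... | no ¬p = ⊥-elim (contra n refl)
    where
    contra : ∀ m → m ≡ n → ⊥
    contra zero refl with () ← to y
    contra (suc m) refl = ℕₚ.1+n≰n (injective⇒≤ {f = g} g-inj)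
      where
      miss : ∀ i → to y ≢ to (f (from i))
      miss i eq = ¬p (from i , sym (to-injective eq))
      g : Fin (suc m) → Fin m
      g i = punchOut (miss i)
      g-inj : ∀ {i j} → g i ≡ g j → i ≡ j
      g-inj {i} {j} eq = trans (sym (to-from i)) (trans (cong to
        (f-inj (to-injective (punchOut-injective (miss i) (miss j) eq)))) (to-from j))

  -- The sum is taken in the field with two elements, with `_xor_` as addition: this is the
  -- cardinality of P modulo 2.
  odd? : (T → Bool) → Bool
  odd? P = sum (λ i → P (from i))

  odd?-cong : ∀ {P R : T → Bool} → (∀ x → P x ≡ R x) → odd? P ≡ odd? R
  odd?-cong eq = sum-cong-≗ (λ i → eq (from i))

  odd?-xor : ∀ P R → odd? (λ x → P x xor R x) ≡ odd? P xor odd? R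
  odd?-xor P R = ∑-distrib-+ (λ i → P (from i)) (λ i → R (from i))

  moved : (T → T) → T → Bool
  moved f x = not ⌊ f x ≟ x ⌋

  -- [f i ≠ i] = [f i < i] + [i < f i], and the two sums agree after reindexing by f.
  moved-even : ∀ f → (∀ x → f (f x) ≡ x) → odd? (moved f) ≡ false
  moved-even f inv = begin
    sum (λ i → moved f (from i))      ≡⟨ sum-cong-≗ split ⟩
    sum (λ i → ⌊ g i <? i ⌋ xor ⌊ i <? g i ⌋)      ≡⟨ ∑-distrib-+ (λ i → ⌊ g i <? i ⌋) (λ i → ⌊ i <? g i ⌋) ⟩
    sum (λ i → ⌊ g i <? i ⌋) xor S      ≡⟨ cong (_xor S) (sum-permute (λ i → ⌊ g i <? i ⌋) (mk↔ₛ′ g g gg gg)) ⟩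
    sum (λ i → ⌊ g (g i) <? g i ⌋) xor S      ≡⟨ cong (_xor S) (sum-cong-≗ (λ i → cong (λ k → ⌊ k <? g i ⌋) (gg i))) ⟩
    S xor S      ≡⟨ xor-same S ⟩
    false ∎
    where
    g : Fin n → Fin n
    g i = to (f (from i))
    S = sum (λ i → ⌊ i <? g i ⌋)
    gg : ∀ i → g (g i) ≡ i
    gg i = trans (cong (λ x → to (f x)) (from-to (f (from i)))) (trans (cong to (inv (from i))) (to-from i))
    split : ∀ i → moved f (from i) ≡ ⌊ g i <? i ⌋ xor ⌊ i <? g i ⌋
    split i with f (from i) ≟ from i | g i <? i | i <? g i
    ... | yes p | yes q | _     = ⊥-elim (ℕₚ.<-irrefl (cong toℕ (trans (cong to p) (to-from i))) q)
    ... | yes p | no _  | yes q = ⊥-elim (ℕₚ.<-irrefl (cong toℕ (sym (trans (cong to p) (to-from i)))) q)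
    ... | yes p | no _  | no _  = refl
    ... | no ¬p | yes q | yes r = ⊥-elim (ℕₚ.<-asym q r)
    ... | no ¬p | yes q | no _  = refl
    ... | no ¬p | no _  | yes r = refl
    ... | no ¬p | no q  | no r with <-cmp (g i) i
    ...   | tri< lt _ _ = ⊥-elim (q lt)
    ...   | tri≈ _ eq _ = ⊥-elim (¬p (trans (sym (from-to _)) (cong from eq)))
    ...   | tri> _ _ gt = ⊥-elim (r gt)

  odd?-singleton : ∀ y → odd? (λ x → ⌊ x ≟ y ⌋) ≡ true
  odd?-singleton y = trans (sum-cong-≗ shape) (sum-single (to y))
    where
    shape : ∀ i → ⌊ from i ≟ y ⌋ ≡ ⌊ i ≟F to y ⌋
    shape i with from i ≟ y | i ≟F to y
    ... | yes _ | yes _ = refl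
    ... | no _  | no _  = refl
    ... | yes p | no ¬q = ⊥-elim (¬q (trans (sym (to-from i)) (cong to p)))
    ... | no ¬p | yes q = ⊥-elim (¬p (trans (cong from q) (from-to y)))
    sum-false : ∀ m → sum {m} (λ _ → false) ≡ false
    sum-false zero    = refl
    sum-false (suc m) = sum-false m
    sum-single : ∀ {m} (j : Fin m) → sum (λ i → ⌊ i ≟F j ⌋) ≡ true
    sum-single {suc m} zero = cong not (sum-false m)
    sum-single {suc m} (suc j) = trans (sum-cong-≗ step) (sum-single j)
      where
      step : ∀ i → ⌊ suc i ≟F suc j ⌋ ≡ ⌊ i ≟F j ⌋
      step i with i ≟F j
      ... | yes _ = refl
      ... | no _  = refl

  odd?-all : 2 ∣ n → odd? (λ _ → true) ≡ false
  odd?-all (divides k refl) = go k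
    where
    go : ∀ k → sum {k ℕ.* 2} (λ _ → true) ≡ false
    go zero = refl
    go (suc k) rewrite go k = refl

  -- Extended by the identity outside P, f becomes an involution whose moved points are exactly
  -- those of P. It may depend on the membership proof, since the involution used later is chosen
  -- from such a proof.
  even-subset : {P : T → Set} (P? : ∀ x → Dec (P x)) (f : ∀ x → P x → T) →
                (∀ x p → P (f x p)) → (∀ x p p' → f (f x p) p' ≡ x) → (∀ x p → f x p ≢ x) →
                odd? (λ x → ⌊ P? x ⌋) ≡ false
  even-subset {P} P? f closed inv free = trans (odd?-cong shape) (moved-even g gg)
    where
    g : T → T
    g x with P? x
    ... | yes p = f x p
    ... | no _  = x
    gg : ∀ x → g (g x) ≡ x
    gg x with P? x in eq
    ... | no ¬p rewrite eq = refl
    ... | yes p with P? (f x p)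
    ...   | yes p' = inv x p p'
    ...   | no ¬p' = ⊥-elim (¬p' (closed x p))
    shape : ∀ x → ⌊ P? x ⌋ ≡ moved g x
    shape x with P? x
    ... | yes p with f x p ≟ x
    ...   | yes e = ⊥-elim (free x p e)
    ...   | no _  = refl
    shape x | no ¬p with x ≟ x
    ...   | yes _ = refl
    ...   | no ne = ⊥-elim (ne refl)

  -- If every value were hit, a right inverse r of f would be injective, hence surjective; then x
  -- and y, as values of r, could be recovered from f x and f y.
  missed-value : (f : T → T) {x y : T} → x ≢ y → f x ≡ f y → ∃ λ z → ∀ x → f x ≢ z
  missed-value f {x} {y} x≢y fx≡fy with search (λ z → ¬? (search (λ x → f x ≟ z)))
  ... | yes (z , ¬hit) = z , λ x eq → ¬hit (x , eq)
  ... | no all-hit = ⊥-elim (x≢y (trans (sym (proj₂ (r-surj x))) (trans (cong r preimages) (proj₂ (r-surj y)))))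
    where
    hit : ∀ z → Σ T λ x → f x ≡ z
    hit z with search (λ x → f x ≟ z)
    ... | yes p = p
    ... | no ¬p = ⊥-elim (all-hit (z , ¬p))
    r : T → T
    r z = proj₁ (hit z)
    f-r : ∀ z → f (r z) ≡ z
    f-r z = proj₂ (hit z)
    r-surj : ∀ x → Σ T λ z → r z ≡ x
    r-surj = injective⇒surjective r (λ {z} {z'} eq → trans (sym (f-r z)) (trans (cong f eq) (f-r z')))
    preimages : proj₁ (r-surj x) ≡ proj₁ (r-surj y)
    preimages = trans (sym (f-r _)) (trans (cong f (proj₂ (r-surj x))) (trans fx≡fy (trans (sym (cong f (proj₂ (r-surj y)))) (f-r _))))

×-finite : {S T : Set} {m n : ℕ} → S ↔ Fin m → T ↔ Fin n → (S × T) ↔ Fin (m ℕ.* n)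
×-finite s t = ↔-sym *↔× ↔-∘ (s ×-↔ t)

-- The field: characteristic 2, square roots, inverses.

module OverField {q : ℕ} (2∣q : 2 ∣ q) (K : FiniteField q) where
  open Geometry K

  Fring : CommutativeRing _ _
  Fring = record { isCommutativeRing = isCommutativeRing }

  module R = CommutativeRing Fring
  open import Algebra.Properties.Ring R.ring using (-‿involutive; -0#≈0#)

  module FinF = Finite card
  open FinF using (_≟_)

  1≢0 : 1F ≢ 0F
  1≢0 eq = 0≢1 (sym eq)

  *-cancel-nonzero : ∀ {x y} → x ≢ 0F → x *F y ≡ 0F → y ≡ 0F
  *-cancel-nonzero {x} {y} x≢0 xy≡0 with inverse x x≢0
  ... | x' , xx' = begin
    y      ≡⟨ sym (R.*-identityˡ y) ⟩
    1F *F y      ≡⟨ cong (_*F y) (trans (sym xx') (R.*-comm x x')) ⟩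
    (x' *F x) *F y    ≡⟨ R.*-assoc x' x y ⟩
    x' *F (x *F y)    ≡⟨ cong (x' *F_) xy≡0 ⟩
    x' *F 0F      ≡⟨ R.zeroʳ x' ⟩
    0F      ∎

  -- If 2 were invertible, 0 would be the only fixed point of negation, and q would be odd.
  char2 : 1F +F 1F ≡ 0F
  char2 with (1F +F 1F) ≟ 0F
  ... | yes p = p
  ... | no 2≢0 = ⊥-elim (true≢false (begin
    true      ≡⟨ cong₂ _xor_ (sym (FinF.odd?-all 2∣q)) (sym (FinF.odd?-singleton 0F)) ⟩
    FinF.odd? (λ _ → true) xor FinF.odd? (λ x → ⌊ x ≟ 0F ⌋)   ≡⟨ sym (FinF.odd?-xor (λ _ → true) (λ x → ⌊ x ≟ 0F ⌋)) ⟩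
    FinF.odd? (λ x → true xor ⌊ x ≟ 0F ⌋)      ≡⟨ FinF.odd?-cong shape ⟩
    FinF.odd? (FinF.moved -F_)      ≡⟨ FinF.moved-even -F_ -‿involutive ⟩
    false      ∎))
    where
    true≢false : true ≢ false
    true≢false ()
    fixed : ∀ x → -F x ≡ x → x ≡ 0F
    fixed x eq = *-cancel-nonzero 2≢0 (begin
      (1F +F 1F) *F x      ≡⟨ R.distribʳ x 1F 1F ⟩
      1F *F x +F 1F *F x    ≡⟨ cong₂ _+F_ (R.*-identityˡ x) (R.*-identityˡ x) ⟩
      x +F x      ≡⟨ cong (_+F x) (sym eq) ⟩
      -F x +F x      ≡⟨ R.-‿inverseˡ x ⟩
      0F      ∎)
    shape : ∀ x → true xor ⌊ x ≟ 0F ⌋ ≡ FinF.moved -F_ x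
    shape x with x ≟ 0F | (-F x) ≟ x
    ... | yes _ | yes _ = refl
    ... | no _  | no _  = refl
    ... | yes p | no ¬q = ⊥-elim (¬q (trans (cong -F_ p) (trans -0#≈0# (sym p))))
    ... | no ¬p | yes r = ⊥-elim (¬p (fixed x r))

  -1≡1 : -F 1F ≡ 1F
  -1≡1 = begin
    -F 1F      ≡⟨ sym (R.+-identityʳ _) ⟩
    -F 1F +F 0F      ≡⟨ cong (-F 1F +F_) (sym char2) ⟩
    -F 1F +F (1F +F 1F)     ≡⟨ sym (R.+-assoc _ _ _) ⟩
    (-F 1F +F 1F) +F 1F     ≡⟨ cong (_+F 1F) (R.-‿inverseˡ 1F) ⟩
    0F +F 1F      ≡⟨ R.+-identityˡ 1F ⟩
    1F      ∎

  -- Polynomial identities in characteristic 2, normalised over the prime field Bool.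
  private
    bits : Bool → F
    bits false = 0F
    bits true  = 1F

    bits-hom : CommutativeRing.rawRing xor-∧-commutativeRing -Raw-AlmostCommutative⟶ fromCommutativeRing Fring
    bits-hom = record
      { ⟦_⟧ = bits
      ; +-homo = λ { false y → sym (R.+-identityˡ _) ; true false → sym (R.+-identityʳ _) ; true true → sym char2 }
      ; *-homo = λ { false y → sym (R.zeroˡ _) ; true y → sym (R.*-identityˡ _) }
      ; -‿homo = λ { false → sym -0#≈0# ; true → sym -1≡1 }
      ; 0-homo = refl
      ; 1-homo = refl
      }

    bits≟ : ∀ a b → Maybe (bits a ≡ bits b)
    bits≟ false false = just refl
    bits≟ true true   = just refl
    bits≟ _ _         = nothing

  open import Algebra.Solver.Ring (CommutativeRing.rawRing xor-∧-commutativeRing) (fromCommutativeRing Fring) bits-hom bits≟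
    using (solve; _:=_; _:+_; _:*_; :-_; con; Polynomial)

  :0 :1 : ∀ {n} → Polynomial n
  :0 = con false
  :1 = con true

  zero-combination : ∀ α β → α *F 0F +F β *F 0F ≡ 0F
  zero-combination = solve 2 (λ α β → α :* :0 :+ β :* :0 := :0) refl

  x+x : ∀ x → x +F x ≡ 0F
  x+x = solve 1 (λ x → x :+ x := :0) refl

  +≡0⇒≡ : ∀ {x y} → x +F y ≡ 0F → x ≡ y
  +≡0⇒≡ {x} {y} eq = begin
    x      ≡⟨ solve 2 (λ x y → x := (x :+ y) :+ y) refl x y ⟩
    (x +F y) +F y     ≡⟨ cong (_+F y) eq ⟩
    0F +F y      ≡⟨ R.+-identityˡ y ⟩
    y      ∎

  ≡⇒+≡0 : ∀ {x y} → x ≡ y → x +F y ≡ 0F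
  ≡⇒+≡0 {x} refl = x+x x

  square≡0 : ∀ {x} → x *F x ≡ 0F → x ≡ 0F
  square≡0 {x} eq with x ≟ 0F
  ... | yes p = p
  ... | no ¬p = *-cancel-nonzero ¬p eq

  *-nonzero : ∀ {x y} → x ≢ 0F → y ≢ 0F → x *F y ≢ 0F
  *-nonzero x≢0 y≢0 eq = y≢0 (*-cancel-nonzero x≢0 eq)

  -- Squaring is additive in characteristic 2 and has trivial kernel. Finiteness then makes it
  -- bijective, which is where `sqrt` comes from.
  square-injective : ∀ {x y} → x *F x ≡ y *F y → x ≡ y
  square-injective {x} {y} eq = +≡0⇒≡ (square≡0 (trans
    (solve 2 (λ x y → (x :+ y) :* (x :+ y) := (x :* x) :+ (y :* y)) refl x y) (≡⇒+≡0 eq)))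

  opaque
    sqrt : F → F
    sqrt y = proj₁ (FinF.injective⇒surjective (λ x → x *F x) square-injective y)

    sqrt² : ∀ y → sqrt y *F sqrt y ≡ y
    sqrt² y = proj₂ (FinF.injective⇒surjective (λ x → x *F x) square-injective y)

  infix 30 _⁻¹
  opaque
    -- Made total by the default value 0 at 0, so that it can be written without a proof of
    -- nonvanishing.
    _⁻¹ : F → F
    x ⁻¹ with x ≟ 0F
    ... | yes _  = 0F
    ... | no x≢0 = proj₁ (inverse x x≢0)

    ⁻¹-inverse : ∀ {x} → x ≢ 0F → x *F x ⁻¹ ≡ 1F
    ⁻¹-inverse {x} x≢0 with x ≟ 0F
    ... | yes p = ⊥-elim (x≢0 p)
    ... | no p  = proj₂ (inverse x p)

  ⁻¹-nonzero : ∀ {x} → x ≢ 0F → x ⁻¹ ≢ 0F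
  ⁻¹-nonzero {x} x≢0 eq = 1≢0 (trans (sym (⁻¹-inverse x≢0)) (trans (cong (x *F_) eq) (R.zeroʳ x)))

  -- Linear combinations, spans and dimension.

  ∑-cong : ∀ {n} {f g : Fin n → F} → (∀ i → f i ≡ g i) → ∑ f ≡ ∑ g
  ∑-cong {zero}  eq = refl
  ∑-cong {suc n} eq = cong₂ _+F_ (eq zero) (∑-cong (λ i → eq (suc i)))

  ∑-+ : ∀ {n} (f g : Fin n → F) → ∑ (λ i → f i +F g i) ≡ ∑ f +F ∑ g
  ∑-+ {zero}  f g = sym (R.+-identityˡ 0F)
  ∑-+ {suc n} f g = trans (cong (f zero +F g zero +F_) (∑-+ (λ i → f (suc i)) (λ i → g (suc i))))
    (solve 4 (λ a b c d → (a :+ b) :+ (c :+ d) := (a :+ c) :+ (b :+ d)) refl _ _ _ _)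

  ∑-* : ∀ {n} c (f : Fin n → F) → ∑ (λ i → c *F f i) ≡ c *F ∑ f
  ∑-* {zero}  c f = sym (R.zeroʳ c)
  ∑-* {suc n} c f = trans (cong (c *F f zero +F_) (∑-* c (λ i → f (suc i)))) (sym (R.distribˡ c _ _))

  ∑-zero : ∀ {n} {f : Fin n → F} → (∀ i → f i ≡ 0F) → ∑ f ≡ 0F
  ∑-zero {zero}  eq = refl
  ∑-zero {suc n} eq = trans (cong₂ _+F_ (eq zero) (∑-zero (λ i → eq (suc i)))) (R.+-identityˡ 0F)

  ∑-swap : ∀ {m n} (f : Fin m → Fin n → F) → ∑ (λ i → ∑ (λ j → f i j)) ≡ ∑ (λ j → ∑ (λ i → f i j))
  ∑-swap {zero} {n} f = sym (∑-zero {n} (λ _ → refl))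
  ∑-swap {suc m} f = trans (cong (∑ (f zero) +F_) (∑-swap (λ i → f (suc i))))
    (sym (∑-+ (f zero) (λ j → ∑ (λ i → f (suc i) j))))

  δ : ∀ {n} → Fin n → Fin n → F
  δ zero    zero    = 1F
  δ zero    (suc j) = 0F
  δ (suc i) zero    = 0F
  δ (suc i) (suc j) = δ i j

  ∑-δ : ∀ {n} (c : Fin n → F) j → ∑ (λ i → c i *F δ i j) ≡ c j
  ∑-δ {suc n} c zero = trans (cong₂ _+F_ (R.*-identityʳ _) (∑-zero (λ i → R.zeroʳ (c (suc i))))) (R.+-identityʳ _)
  ∑-δ {suc n} c (suc j) = trans (cong₂ _+F_ (R.zeroʳ (c zero)) (∑-δ (λ i → c (suc i)) j)) (R.+-identityˡ _)

  funToFin-cong : ∀ {m n} {f g : Fin m → Fin n} → (∀ i → f i ≡ g i) → funToFin f ≡ funToFin g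
  funToFin-cong {zero}  eq = refl
  funToFin-cong {suc m} eq = cong₂ combine (eq zero) (funToFin-cong (λ i → eq (suc i)))

  -- Numbers the coefficient vectors by `Fin (q ^ k)`, which opens them to the pigeonhole principle
  -- and to exhaustive search.
  encode : ∀ {k} → (Fin k → F) → Fin (q ℕ.^ k)
  encode c = funToFin (λ i → Inverse.to card (c i))

  decode : ∀ {k} → Fin (q ℕ.^ k) → Fin k → F
  decode n i = Inverse.from card (finToFun n i)

  decode-encode : ∀ {k} (c : Fin k → F) i → decode (encode c) i ≡ c i
  decode-encode c i = trans (cong (Inverse.from card) (finToFun-funToFin (λ i → Inverse.to card (c i)) i)) (FinF.from-to (c i))

  encode-decode : ∀ {k} (n : Fin (q ℕ.^ k)) → encode (decode {k} n) ≡ n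
  encode-decode {k} n = trans (funToFin-cong {k} (λ i → FinF.to-from (finToFun n i))) (funToFin-finToFin {k} n)

  Nontrivial : ∀ {k} → (Fin k → F) → Set
  Nontrivial c = ∃ λ i → c i ≢ 0F

  1<q : 1 ℕ.< q
  1<q = go q refl
    where
    go : ∀ m → m ≡ q → 1 ℕ.< q
    go zero refl with () ← Inverse.to card 0F
    go (suc zero) refl = ⊥-elim (0≢1 (FinF.to-injective (unique _ _)))
      where
      unique : ∀ (i j : Fin 1) → i ≡ j
      unique zero zero = refl
    go (suc (suc m)) refl = ℕ.s≤s (ℕ.s≤s ℕ.z≤n)

  opaque
    -- There are q^k coefficient vectors but only q^m possible values of the combination, so two
    -- coefficient vectors share a value. Their sum, which is their difference in characteristic 2,
    -- is the relation.
    dependent : ∀ {m k} → m ℕ.< k → (w : Fin k → Fin m → F) →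
                ∃ λ c → Nontrivial c × (∀ j → ∑ (λ i → c i *F w i j) ≡ 0F)
    dependent {m} {k} m<k w with pigeonhole (ℕₚ.^-monoʳ-< q 1<q m<k) (λ n → encode (λ j → ∑ (λ i → decode {k} n i *F w i j)))
    ... | n₁ , n₂ , n₁<n₂ , eq = (λ i → c₁ i +F c₂ i) , nontrivial , λ j → begin
        ∑ (λ i → (c₁ i +F c₂ i) *F w i j)      ≡⟨ ∑-cong (λ i → R.distribʳ (w i j) (c₁ i) (c₂ i)) ⟩
        ∑ (λ i → c₁ i *F w i j +F c₂ i *F w i j)      ≡⟨ ∑-+ (λ i → c₁ i *F w i j) (λ i → c₂ i *F w i j) ⟩
        ∑ (λ i → c₁ i *F w i j) +F ∑ (λ i → c₂ i *F w i j)    ≡⟨ ≡⇒+≡0 (same j) ⟩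
        0F      ∎
      where
      c₁ c₂ : Fin k → F
      c₁ = decode n₁
      c₂ = decode n₂
      same : ∀ j → ∑ (λ i → c₁ i *F w i j) ≡ ∑ (λ i → c₂ i *F w i j)
      same j = trans (sym (decode-encode _ j)) (trans (cong (λ n → decode n j) eq) (decode-encode _ j))
      nontrivial : Nontrivial (λ i → c₁ i +F c₂ i)
      nontrivial with any? (λ i → ¬? (c₁ i +F c₂ i ≟ 0F))
      ... | yes p = p
      ... | no ¬p = ⊥-elim (ℕₚ.<-irrefl (cong toℕ n₁≡n₂) n₁<n₂)
        where
        c₁≡c₂ : ∀ i → c₁ i ≡ c₂ i
        c₁≡c₂ i with c₁ i +F c₂ i ≟ 0F
        ... | yes z = +≡0⇒≡ z
        ... | no nz = ⊥-elim (¬p (i , nz))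
        n₁≡n₂ : n₁ ≡ n₂
        n₁≡n₂ = trans (sym (encode-decode {k} n₁)) (trans (funToFin-cong {k} (λ i → cong (Inverse.to card) (c₁≡c₂ i))) (encode-decode {k} n₂))

  ≈-refl : ∀ {u} → u ≈ u
  ≈-refl i = refl

  ≈-sym : ∀ {u v} → u ≈ v → v ≈ u
  ≈-sym p i = sym (p i)

  ≈-trans : ∀ {u v w} → u ≈ v → v ≈ w → u ≈ w
  ≈-trans p r i = trans (p i) (r i)

  +V-cong : ∀ {u u' v v'} → u ≈ u' → v ≈ v' → (u +V v) ≈ (u' +V v')
  +V-cong p r i = cong₂ _+F_ (p i) (r i)

  ·-cong : ∀ c {u v} → u ≈ v → (c · u) ≈ (c · v)
  ·-cong c p i = cong (c *F_) (p i)

  lc-cong : ∀ {k} {c d : Fin k → F} {w x : Fin k → V} → (∀ i → c i ≡ d i) → (∀ i → w i ≈ x i) → lc c w ≈ lc d x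
  lc-cong p r j = ∑-cong (λ i → cong₂ _*F_ (p i) (r i j))

  lc-lc : ∀ {k m} (c : Fin k → F) (C : Fin k → Fin m → F) (w : Fin m → V) →
          lc c (λ i → lc (C i) w) ≈ lc (λ j → ∑ (λ i → c i *F C i j)) w
  lc-lc c C w t = begin
    ∑ (λ i → c i *F ∑ (λ j → C i j *F w j t))      ≡⟨ ∑-cong (λ i → sym (∑-* (c i) (λ j → C i j *F w j t))) ⟩
    ∑ (λ i → ∑ (λ j → c i *F (C i j *F w j t)))    ≡⟨ ∑-swap (λ i j → c i *F (C i j *F w j t)) ⟩
    ∑ (λ j → ∑ (λ i → c i *F (C i j *F w j t)))    ≡⟨ ∑-cong (λ j → trans
         (∑-cong (λ i → solve 3 (λ c C w → c :* (C :* w) := w :* (c :* C)) refl (c i) (C i j) (w j t)))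
         (trans (∑-* (w j t) (λ i → c i *F C i j)) (R.*-comm _ _))) ⟩
    ∑ (λ j → ∑ (λ i → c i *F C i j) *F w j t)      ∎

  lc-0 : ∀ {k} {c : Fin k → F} (w : Fin k → V) → (∀ i → c i ≡ 0F) → lc c w ≈ 0V
  lc-0 w z j = ∑-zero (λ i → trans (cong (_*F w i j) (z i)) (R.zeroˡ _))

  lc-δ : ∀ {k} (w : Fin k → V) i → lc (δ i) w ≈ w i
  lc-δ {suc k} w zero j = trans (cong₂ _+F_ (R.*-identityˡ _) (∑-zero (λ i → R.zeroˡ (w (suc i) j)))) (R.+-identityʳ _)
  lc-δ {suc k} w (suc i) j = trans (cong₂ _+F_ (R.zeroˡ _) (lc-δ (λ i → w (suc i)) i j)) (R.+-identityˡ _)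

  span-cong : ∀ {k} {w : Fin k → V} {u v} → u ≈ v → InSpan w u → InSpan w v
  span-cong u≈v (c , e) = c , ≈-trans (≈-sym u≈v) e

  span-basis : ∀ {k} (w : Fin k → V) i → InSpan w (w i)
  span-basis w i = δ i , ≈-sym (lc-δ w i)

  span-lc : ∀ {k m} {w : Fin k → V} {u : Fin m → V} (c : Fin m → F) → (∀ i → InSpan w (u i)) → InSpan w (lc c u)
  span-lc {w = w} c s = _ , ≈-trans (lc-cong (λ _ → refl) (λ i → proj₂ (s i))) (lc-lc c (λ i → proj₁ (s i)) w)

  span-trans : ∀ {k m} {w : Fin k → V} {u : Fin m → V} {v} → (∀ i → InSpan w (u i)) → InSpan u v → InSpan w v
  span-trans s (c , e) = span-cong (≈-sym e) (span-lc c s)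

  span-+ : ∀ {k} {w : Fin k → V} {u v} → InSpan w u → InSpan w v → InSpan w (u +V v)
  span-+ {w = w} (c , e) (d , f) = (λ i → c i +F d i) , λ j → trans (cong₂ _+F_ (e j) (f j))
    (sym (trans (∑-cong (λ i → R.distribʳ (w i j) (c i) (d i))) (∑-+ (λ i → c i *F w i j) (λ i → d i *F w i j))))

  span-· : ∀ {k} {w : Fin k → V} {v} c → InSpan w v → InSpan w (c · v)
  span-· {w = w} c (d , f) = (λ i → c *F d i) , λ j → trans (cong (c *F_) (f j))
    (sym (trans (∑-cong (λ i → R.*-assoc c (d i) (w i j))) (∑-* c (λ i → d i *F w i j))))

  indep-nonzero : ∀ {k} {w : Fin k → V} → LinIndep w → ∀ c → Nontrivial c → NonZero (lc c w)
  indep-nonzero ind c (i , c≢0) z = c≢0 (ind c z i)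

  indep-basis-nonzero : ∀ {k} {w : Fin k → V} → LinIndep w → ∀ i → NonZero (w i)
  indep-basis-nonzero {w = w} ind i z = 1≢0 (trans (sym (δii i)) (ind (δ i) (≈-trans (lc-δ w i) z) i))
    where
    δii : ∀ {n} (i : Fin n) → δ i i ≡ 1F
    δii zero = refl
    δii (suc i) = δii i

  nonzero-coefficient : ∀ {k} {w : Fin k → V} {v} → NonZero v → ∀ c → v ≈ lc c w → Nontrivial c
  nonzero-coefficient {w = w} v≢0 c e with any? (λ i → ¬? (c i ≟ 0F))
  ... | yes p = p
  ... | no ¬p = ⊥-elim (v≢0 (≈-trans e (lc-0 w all0)))
    where
    all0 : ∀ i → c i ≡ 0F
    all0 i with c i ≟ 0F
    ... | yes z = z
    ... | no nz = ⊥-elim (¬p (i , nz))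

  opaque
    -- Decided by running through all q^k coefficient vectors.
    indep? : ∀ {k} (w : Fin k → V) → LinIndep w ⊎ (∃ λ c → Nontrivial c × lc c w ≈ 0V)
    indep? {k} w with any? (λ n → any? (λ i → ¬? (decode {k} n i ≟ 0F)) ×-dec all? (λ j → lc (decode {k} n) w j ≟ 0F))
    ... | yes (n , nt , z) = inj₂ (decode n , nt , z)
    ... | no ¬p = inj₁ λ c z i → by-contradiction c z i
      where
      by-contradiction : ∀ c → lc c w ≈ 0V → ∀ i → c i ≡ 0F
      by-contradiction c z i with c i ≟ 0F
      ... | yes e = e
      ... | no ne = ⊥-elim (¬p (encode c , (i , λ e → ne (trans (sym (decode-encode c i)) e)) ,
                                ≈-trans (lc-cong (decode-encode c) (λ _ → ≈-refl)) z))

  solve-head : ∀ {k} {w : Fin k → V} {d} (c : Fin (suc k) → F) → c zero ≢ 0F → lc c (d ∷ w) ≈ 0V → InSpan w d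
  solve-head {w = w} {d} c c₀≢0 z = (λ i → c zero ⁻¹ *F c (suc i)) , λ j → begin
    d j      ≡⟨ sym (R.*-identityˡ (d j)) ⟩
    1F *F d j      ≡⟨ cong (_*F d j) (sym (trans (R.*-comm _ _) (⁻¹-inverse c₀≢0))) ⟩
    (c zero ⁻¹ *F c zero) *F d j      ≡⟨ R.*-assoc _ _ _ ⟩
    c zero ⁻¹ *F (c zero *F d j)      ≡⟨ cong (c zero ⁻¹ *F_) (+≡0⇒≡ (z j)) ⟩
    c zero ⁻¹ *F ∑ (λ i → c (suc i) *F w i j)      ≡⟨ sym (∑-* (c zero ⁻¹) (λ i → c (suc i) *F w i j)) ⟩
    ∑ (λ i → c zero ⁻¹ *F (c (suc i) *F w i j))      ≡⟨ ∑-cong (λ i → sym (R.*-assoc (c zero ⁻¹) (c (suc i)) (w i j))) ⟩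
    ∑ (λ i → (c zero ⁻¹ *F c (suc i)) *F w i j)      ∎

  opaque
    head-in-span : ∀ {k} {w : Fin k → V} {d} → LinIndep w → (c : Fin (suc k) → F) → Nontrivial c → lc c (d ∷ w) ≈ 0V → InSpan w d
    head-in-span {w = w} {d} ind c (i , ci≢0) z with c zero ≟ 0F
    ... | no c₀≢0 = solve-head c c₀≢0 z
    ... | yes c₀≡0 = ⊥-elim (ci≢0 (all0 i))
      where
      tail0 : lc (λ i → c (suc i)) w ≈ 0V
      tail0 j = trans (sym (trans (cong (_+F lc (λ i → c (suc i)) w j) (trans (cong (_*F d j) c₀≡0) (R.zeroˡ (d j)))) (R.+-identityˡ _))) (z j)
      all0 : ∀ i → c i ≡ 0F
      all0 zero    = c₀≡0
      all0 (suc i) = ind (λ i → c (suc i)) tail0 i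

  opaque
    span-dependent : ∀ {n k} (P : Fin n → V) → n ℕ.< k → (w : Fin k → V) → (∀ i → InSpan P (w i)) →
                     ∃ λ c → Nontrivial c × lc c w ≈ 0V
    span-dependent P n<k w s with dependent n<k (λ i → proj₁ (s i))
    ... | c , nt , z = c , nt , ≈-trans (lc-cong (λ _ → refl) (λ i → proj₂ (s i)))
                                 (≈-trans (lc-lc c (λ i → proj₁ (s i)) P) (lc-0 P z))

  opaque
    -- Adding d to w gives n + 1 vectors in the span of n, hence a relation; the independence of w
    -- forces d to occur in it.
    indep-spans : ∀ {n} (P w : Fin n → V) → (∀ i → InSpan P (w i)) → LinIndep w → ∀ {d} → InSpan P d → InSpan w d
    indep-spans P w s ind {d} sd with span-dependent P (ℕₚ.n<1+n _) (d ∷ w) (λ { zero → sd ; (suc i) → s i })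
    ... | c , nt , z = head-in-span ind c nt z

  unit-spans : ∀ v → InSpan {6} δ v
  unit-spans v = v , λ j → sym (∑-δ v j)

  linIndep₂ : ∀ {x y} → (∀ α β → ((α · x) +V (β · y)) ≈ 0V → α ≡ 0F × β ≡ 0F) → LinIndep (x ∷ y ∷ [])
  linIndep₂ {x} {y} h c z = λ { zero → proj₁ p ; (suc zero) → proj₂ p }
    where
    p = h (c zero) (c (suc zero)) (λ j → trans (cong (c zero *F x j +F_) (sym (R.+-identityʳ _))) (z j))

  lc₂ : ∀ (c : Fin 2 → F) {w : Fin 2 → V} → lc c w ≈ ((c zero · w zero) +V (c (suc zero) · w (suc zero)))
  lc₂ c {w} j = cong (c zero *F w zero j +F_) (R.+-identityʳ _)

  opaque
    -- The kernel of a linear form on F^3 has dimension at least two. Used to cut a line out of a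
    -- projective plane: once with Π, once with the polar hyperplane of a point.
    plane-of-solutions : (f : Fin 3 → F) → ∃ λ (c : Fin 3 → F) → ∃ λ (d : Fin 3 → F) →
      ∑ (λ i → c i *F f i) ≡ 0F × ∑ (λ i → d i *F f i) ≡ 0F ×
      (∀ α β → (∀ i → α *F c i +F β *F d i ≡ 0F) → α ≡ 0F × β ≡ 0F)
    plane-of-solutions f with f zero ≟ 0F | f (suc zero) ≟ 0F
    ... | no f₀≢0 | _ = (f₁ ∷ f₀ ∷ 0F ∷ []) , (f₂ ∷ 0F ∷ f₀ ∷ []) ,
        solve 3 (λ a b c → b :* a :+ (a :* b :+ (:0 :* c :+ :0)) := :0) refl f₀ f₁ f₂ ,
        solve 3 (λ a b c → c :* a :+ (:0 :* b :+ (a :* c :+ :0)) := :0) refl f₀ f₁ f₂ ,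
        λ α β e → *-cancel-nonzero f₀≢0 (trans (solve 3 (λ α β a → a :* α := α :* a :+ β :* :0) refl α β f₀) (e (suc zero))) ,
                  *-cancel-nonzero f₀≢0 (trans (solve 3 (λ α β a → a :* β := α :* :0 :+ β :* a) refl α β f₀) (e (suc (suc zero))))
      where f₀ f₁ f₂ : F
            f₀ = f zero
            f₁ = f (suc zero)
            f₂ = f (suc (suc zero))
    ... | yes f₀≡0 | no f₁≢0 = (1F ∷ 0F ∷ 0F ∷ []) , (0F ∷ f₂ ∷ f₁ ∷ []) ,
        trans (solve 3 (λ a b c → :1 :* a :+ (:0 :* b :+ (:0 :* c :+ :0)) := a) refl f₀ f₁ f₂) f₀≡0 ,
        solve 3 (λ a b c → :0 :* a :+ (c :* b :+ (b :* c :+ :0)) := :0) refl f₀ f₁ f₂ ,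
        λ α β e → trans (solve 2 (λ α β → α := α :* :1 :+ β :* :0) refl α β) (e zero) ,
                  *-cancel-nonzero f₁≢0 (trans (solve 3 (λ α β a → a :* β := α :* :0 :+ β :* a) refl α β f₁) (e (suc (suc zero))))
      where f₀ f₁ f₂ : F
            f₀ = f zero
            f₁ = f (suc zero)
            f₂ = f (suc (suc zero))
    ... | yes f₀≡0 | yes f₁≡0 = (1F ∷ 0F ∷ 0F ∷ []) , (0F ∷ 1F ∷ 0F ∷ []) ,
        trans (solve 3 (λ a b c → :1 :* a :+ (:0 :* b :+ (:0 :* c :+ :0)) := a) refl f₀ f₁ f₂) f₀≡0 ,
        trans (solve 3 (λ a b c → :0 :* a :+ (:1 :* b :+ (:0 :* c :+ :0)) := b) refl f₀ f₁ f₂) f₁≡0 ,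
        λ α β e → trans (solve 2 (λ α β → α := α :* :1 :+ β :* :0) refl α β) (e zero) ,
                  trans (solve 2 (λ α β → β := α :* :0 :+ β :* :1) refl α β) (e (suc zero))
      where f₀ f₁ f₂ : F
            f₀ = f zero
            f₁ = f (suc zero)
            f₂ = f (suc (suc zero))

  -- Quadratic forms and their polar forms.

  record IsQuadratic (Q : V → F) (B : V → V → F) : Set where
    field
      Q-cong : ∀ {x y} → x ≈ y → Q x ≡ Q y
      B-cong : ∀ {x x' y y'} → x ≈ x' → y ≈ y' → B x y ≡ B x' y'
      Q-+    : ∀ x y → Q (x +V y) ≡ (Q x +F Q y) +F B x y
      Q-·    : ∀ c x → Q (c · x) ≡ (c *F c) *F Q x
      B-sym  : ∀ x y → B x y ≡ B y x
      B-alt  : ∀ x → B x x ≡ 0F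
      B-+ˡ   : ∀ x y z → B (x +V y) z ≡ B x z +F B y z
      B-·ˡ   : ∀ c x z → B (c · x) z ≡ c *F B x z

  module PolarForm (a : Fin 6 → Fin 6 → F) where
    open Quadric a

    private
      -- The manifestly bilinear expression for B, which is itself defined through values of the
      -- quadratic form; the laws of B are read off from it.
      polar : V → V → F
      polar x y = ∑ (λ i → ∑ (λ j → a i j *F x i *F y j +F a i j *F y i *F x j))

    Q-cong : ∀ {x y} → x ≈ y → Qf x ≡ Qf y
    Q-cong e = ∑-cong (λ i → ∑-cong (λ j → cong₂ _*F_ (cong (a i j *F_) (e i)) (e j)))

    B-cong : ∀ {x x' y y'} → x ≈ x' → y ≈ y' → B x y ≡ B x' y'
    B-cong {x} {x'} {y} {y'} e f = cong₂ _+F_ (cong₂ _+F_ (Q-cong {x +V y} {x' +V y'} (+V-cong {x} {x'} {y} {y'} e f)) (cong -F_ (Q-cong {x} {x'} e))) (cong -F_ (Q-cong {y} {y'} f))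

    private
      ∑∑-+ : ∀ {m n} (f g : Fin m → Fin n → F) →
             ∑ (λ i → ∑ (λ j → f i j +F g i j)) ≡ ∑ (λ i → ∑ (f i)) +F ∑ (λ i → ∑ (g i))
      ∑∑-+ f g = trans (∑-cong (λ i → ∑-+ (f i) (g i))) (∑-+ (λ i → ∑ (f i)) (λ i → ∑ (g i)))

      ∑∑-* : ∀ {m n} c (f : Fin m → Fin n → F) → ∑ (λ i → ∑ (λ j → c *F f i j)) ≡ c *F ∑ (λ i → ∑ (f i))
      ∑∑-* c f = trans (∑-cong (λ i → ∑-* c (f i))) (∑-* c (λ i → ∑ (f i)))

      Q-polar : ∀ x y → Qf (x +V y) ≡ (Qf x +F Qf y) +F polar x y
      Q-polar x y = trans
        (∑-cong (λ i → ∑-cong (λ j → solve 5 (λ c x y x' y' →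
           c :* (x :+ y) :* (x' :+ y') := (c :* x :* x' :+ c :* y :* y') :+ (c :* x :* y' :+ c :* y :* x')) refl (a i j) (x i) (y i) (x j) (y j))))
        (trans (∑∑-+ (λ i j → a i j *F x i *F x j +F a i j *F y i *F y j) (λ i j → a i j *F x i *F y j +F a i j *F y i *F x j))
               (cong (_+F polar x y) (∑∑-+ (λ i j → a i j *F x i *F x j) (λ i j → a i j *F y i *F y j))))

      B≡polar : ∀ x y → B x y ≡ polar x y
      B≡polar x y = trans (cong (λ z → z +F (-F (Qf x)) +F (-F (Qf y))) (Q-polar x y))
        (solve 3 (λ a b c → ((a :+ b) :+ c) :+ (:- a) :+ (:- b) := c) refl (Qf x) (Qf y) (polar x y))

    Q-+ : ∀ x y → Qf (x +V y) ≡ (Qf x +F Qf y) +F B x y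
    Q-+ x y = trans (Q-polar x y) (cong ((Qf x +F Qf y) +F_) (sym (B≡polar x y)))

    Q-· : ∀ c x → Qf (c · x) ≡ (c *F c) *F Qf x
    Q-· c x = trans
      (∑-cong (λ i → ∑-cong (λ j → solve 4 (λ a c x y → a :* (c :* x) :* (c :* y) := (c :* c) :* (a :* x :* y)) refl (a i j) c (x i) (x j))))
      (∑∑-* (c *F c) (λ i j → a i j *F x i *F x j))

    B-sym : ∀ x y → B x y ≡ B y x
    B-sym x y = trans (B≡polar x y) (trans
      (∑-cong (λ i → ∑-cong (λ j → R.+-comm (a i j *F x i *F y j) (a i j *F y i *F x j)))) (sym (B≡polar y x)))

    B-alt : ∀ x → B x x ≡ 0F
    B-alt x = trans (B≡polar x x) (∑-zero (λ i → ∑-zero (λ j → x+x (a i j *F x i *F x j))))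

    B-+ˡ : ∀ x y z → B (x +V y) z ≡ B x z +F B y z
    B-+ˡ x y z = trans (B≡polar (x +V y) z) (trans
      (trans (∑-cong (λ i → ∑-cong (λ j → solve 7 (λ c x y z x' y' z' →
         c :* (x :+ y) :* z' :+ c :* z :* (x' :+ y') := (c :* x :* z' :+ c :* z :* x') :+ (c :* y :* z' :+ c :* z :* y'))
           refl (a i j) (x i) (y i) (z i) (x j) (y j) (z j))))
         (∑∑-+ (λ i j → a i j *F x i *F z j +F a i j *F z i *F x j) (λ i j → a i j *F y i *F z j +F a i j *F z i *F y j)))
      (cong₂ _+F_ (sym (B≡polar x z)) (sym (B≡polar y z))))

    B-·ˡ : ∀ c x z → B (c · x) z ≡ c *F B x z
    B-·ˡ c x z = trans (B≡polar (c · x) z) (trans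
      (trans (∑-cong (λ i → ∑-cong (λ j → solve 6 (λ a c x z x' z' →
         a :* (c :* x) :* z' :+ a :* z :* (c :* x') := c :* (a :* x :* z' :+ a :* z :* x'))
           refl (a i j) c (x i) (z i) (x j) (z j))))
         (∑∑-* c (λ i j → a i j *F x i *F z j +F a i j *F z i *F x j)))
      (cong (c *F_) (sym (B≡polar x z))))

    isQuadratic : IsQuadratic Qf B
    isQuadratic = record
      { Q-cong = λ {x} {y} → Q-cong {x} {y} ; B-cong = λ {x} {x'} {y} {y'} → B-cong {x} {x'} {y} {y'}
      ; Q-+ = Q-+ ; Q-· = Q-· ; B-sym = B-sym ; B-alt = B-alt ; B-+ˡ = B-+ˡ ; B-·ˡ = B-·ˡ }

  module WithForm (Qf : V → F) (B : V → V → F) (isQuadratic : IsQuadratic Qf B) where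
    open IsQuadratic isQuadratic

    -- This and the following notions repeat those of the statement for an abstract pair `Qf`, `B`
    -- of which only the laws in `IsQuadratic` are known; for the form of the theorem they unfold to
    -- the originals.
    OnQ : PointSet
    OnQ v = NonZero v × Qf v ≡ 0F

    TotallySingular : ∀ {d} → Subspace d → Set
    TotallySingular S = ∀ v → v ∈S S → Qf v ≡ 0F

    NondegenerateB : Set
    NondegenerateB = ∀ x → (∀ y → B x y ≡ 0F) → x ≈ 0V

    EllipticIn : Solid → Set
    EllipticIn S =
        (∀ v → v ∈S S → Qf v ≡ 0F → (∀ w → InSpan (Subspace.basis S) w → B v w ≡ 0F) → ⊥)
      × (∀ (L : Line) → L ⊆S S → TotallySingular L → ⊥)

    InPolar : ∀ {d} → Subspace d → V → Set
    InPolar S y = NonZero y × (∀ i → B (Subspace.basis S i) y ≡ 0F)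

    B-congˡ : ∀ {x x' y} → x ≈ x' → B x y ≡ B x' y
    B-congˡ e = B-cong e ≈-refl

    B-congʳ : ∀ {x y y'} → y ≈ y' → B x y ≡ B x y'
    B-congʳ e = B-cong ≈-refl e

    B-+ʳ : ∀ x y z → B x (y +V z) ≡ B x y +F B x z
    B-+ʳ x y z = trans (B-sym x (y +V z)) (trans (B-+ˡ y z x) (cong₂ _+F_ (B-sym y x) (B-sym z x)))

    B-·ʳ : ∀ c x z → B x (c · z) ≡ c *F B x z
    B-·ʳ c x z = trans (B-sym x (c · z)) (trans (B-·ˡ c z x) (cong (c *F_) (B-sym z x)))

    B-0ˡ : ∀ {x} y → x ≈ 0V → B x y ≡ 0F
    B-0ˡ {x} y z = trans (B-congˡ {x} {0F · 0V} (λ i → trans (z i) (sym (R.zeroˡ 0F)))) (trans (B-·ˡ 0F 0V y) (R.zeroˡ _))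

    B-lcˡ : ∀ {k} (c : Fin k → F) w y → B (lc c w) y ≡ ∑ (λ i → c i *F B (w i) y)
    B-lcˡ {zero}  c w y = B-0ˡ y (λ _ → refl)
    B-lcˡ {suc k} c w y = trans (B-+ˡ (c zero · w zero) (lc (λ i → c (suc i)) (λ i → w (suc i))) y)
      (cong₂ _+F_ (B-·ˡ (c zero) (w zero) y) (B-lcˡ (λ i → c (suc i)) (λ i → w (suc i)) y))

    B-lcʳ : ∀ {k} (c : Fin k → F) w x → B x (lc c w) ≡ ∑ (λ i → c i *F B x (w i))
    B-lcʳ c w x = trans (B-sym x (lc c w)) (trans (B-lcˡ c w x) (∑-cong (λ i → cong (c i *F_) (B-sym (w i) x))))

    ⊥-span : ∀ {k} {w : Fin k → V} {x y} → (∀ i → B x (w i) ≡ 0F) → InSpan w y → B x y ≡ 0F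
    ⊥-span {w = w} {x} h (c , e) = trans (B-congʳ e) (trans (B-lcʳ c w x) (∑-zero (λ i → trans (cong (c i *F_) (h i)) (R.zeroʳ _))))

    Q-0 : ∀ {x} → x ≈ 0V → Qf x ≡ 0F
    Q-0 {x} z = trans (Q-cong {x} {0F · 0V} (λ i → trans (z i) (sym (R.zeroˡ 0F)))) (trans (Q-· 0F 0V) (trans (cong (_*F Qf 0V) (R.zeroˡ 0F)) (R.zeroˡ _)))

    Q-combo : ∀ α β x y → Qf ((α · x) +V (β · y)) ≡ ((α *F α) *F Qf x +F (β *F β) *F Qf y) +F (α *F β) *F B x y
    Q-combo α β x y = trans (Q-+ (α · x) (β · y)) (cong₂ _+F_ (cong₂ _+F_ (Q-· α x) (Q-· β y))
      (trans (B-·ˡ α x (β · y)) (trans (cong (α *F_) (B-·ʳ β x y)) (sym (R.*-assoc α β _)))))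

    B-combo : ∀ α β x y z → B ((α · x) +V (β · y)) z ≡ α *F B x z +F β *F B y z
    B-combo α β x y z = trans (B-+ˡ (α · x) (β · y) z) (cong₂ _+F_ (B-·ˡ α x z) (B-·ˡ β y z))

    opaque
      nonzero? : ∀ (v : V) → (v ≈ 0V) ⊎ NonZero v
      nonzero? v with indep? (v ∷ [])
      ... | inj₁ ind = inj₂ (indep-basis-nonzero {w = v ∷ []} ind zero)
      ... | inj₂ (c , (zero , c≢0) , z) = inj₁ λ j → *-cancel-nonzero c≢0 (trans (sym (R.+-identityʳ _)) (z j))

    SamePoint-refl : ∀ {u v} → u ≈ v → SamePoint u v
    SamePoint-refl e = 1F , 1≢0 , λ i → trans (e i) (sym (R.*-identityˡ _))

    SamePoint-sym : ∀ {u v} → SamePoint u v → SamePoint v u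
    SamePoint-sym {u} {v} (c , c≢0 , e) = c ⁻¹ , ⁻¹-nonzero c≢0 , λ i → begin
      v i      ≡⟨ sym (R.*-identityˡ (v i)) ⟩
      1F *F v i      ≡⟨ cong (_*F v i) (sym (trans (R.*-comm _ _) (⁻¹-inverse c≢0))) ⟩
      (c ⁻¹ *F c) *F v i      ≡⟨ R.*-assoc _ _ _ ⟩
      c ⁻¹ *F (c *F v i)      ≡⟨ cong (c ⁻¹ *F_) (sym (e i)) ⟩
      c ⁻¹ *F u i      ∎

    SamePoint-trans : ∀ {u v w} → SamePoint u v → SamePoint v w → SamePoint u w
    SamePoint-trans (c , c≢0 , e) (d , d≢0 , f) = c *F d , *-nonzero c≢0 d≢0 ,
      λ i → trans (e i) (trans (cong (c *F_) (f i)) (sym (R.*-assoc c d _)))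

    SamePoint-Q : ∀ {u v} → SamePoint u v → Qf v ≡ 0F → Qf u ≡ 0F
    SamePoint-Q {v = v} (c , _ , e) z = trans (Q-cong e) (trans (Q-· c v) (trans (cong ((c *F c) *F_) z) (R.zeroʳ _)))

    SamePoint-⊥ : ∀ {u v w} → SamePoint u v → B v w ≡ 0F → B u w ≡ 0F
    SamePoint-⊥ {v = v} {w} (c , _ , e) z = trans (B-congˡ e) (trans (B-·ˡ c v w) (trans (cong (c *F_) z) (R.zeroʳ _)))

    indep-distinct : ∀ {x y} → LinIndep (x ∷ y ∷ []) → ¬ SamePoint x y
    indep-distinct {x} {y} ind (c , c≢0 , e) = 1≢0 (ind (1F ∷ c ∷ []) (λ j → trans
      (cong (λ t → 1F *F t +F (c *F y j +F 0F)) (e j))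
      (solve 2 (λ c y → :1 :* (c :* y) :+ (c :* y :+ :0) := :0) refl c (y j))) zero)

    same-or-indep : ∀ {x y} → NonZero x → NonZero y → SamePoint x y ⊎ LinIndep (x ∷ y ∷ [])
    same-or-indep {x} {y} x≢0 y≢0 with indep? (x ∷ y ∷ [])
    ... | inj₁ ind = inj₂ ind
    ... | inj₂ (c , nt , z) = inj₁ (go (c zero) (c (suc zero)) (some nt) (λ j → trans (cong (c zero *F x j +F_) (sym (R.+-identityʳ _))) (z j)))
      where
      some : Nontrivial c → ¬ (c zero ≡ 0F × c (suc zero) ≡ 0F)
      some (zero , ne) (p , _)     = ne p
      some (suc zero , ne) (_ , r) = ne r
      go : ∀ α β → ¬ (α ≡ 0F × β ≡ 0F) → ((α · x) +V (β · y)) ≈ 0V → SamePoint x y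
      go α β nt z with α ≟ 0F | β ≟ 0F
      ... | yes p | yes r = ⊥-elim (nt (p , r))
      ... | no ¬p | yes refl = ⊥-elim (x≢0 (λ j → *-cancel-nonzero ¬p
              (trans (solve 3 (λ α x y → α :* x := α :* x :+ :0 :* y) refl α (x j) (y j)) (z j))))
      ... | yes refl | no ¬r = ⊥-elim (y≢0 (λ j → *-cancel-nonzero ¬r
              (trans (solve 3 (λ β x y → β :* y := :0 :* x :+ β :* y) refl β (x j) (y j)) (z j))))
      ... | no ¬p | no ¬r = SamePoint-trans (SamePoint-sym (α , ¬p , λ _ → refl))
              (SamePoint-trans (SamePoint-refl (λ j → +≡0⇒≡ (z j))) (β , ¬r , λ _ → refl))

    distinct-indep : ∀ {x y} → NonZero x → NonZero y → ¬ SamePoint x y → LinIndep (x ∷ y ∷ [])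
    distinct-indep x≢0 y≢0 ¬same with same-or-indep x≢0 y≢0
    ... | inj₁ same = ⊥-elim (¬same same)
    ... | inj₂ ind  = ind

    -- The solid Π: the alternating form is nondegenerate on it.

    module InSolid (Π : Solid) (elliptic : EllipticIn Π) where

      P : Fin 4 → V
      P = Subspace.basis Π

      record InΠ (v : V) : Set where
        constructor inΠ
        field span : InSpan P v

      Π-basis : ∀ i → InΠ (P i)
      Π-basis i = inΠ (span-basis P i)

      Π-+ : ∀ {u v} → InΠ u → InΠ v → InΠ (u +V v)
      Π-+ (inΠ s) (inΠ t) = inΠ (span-+ {w = P} s t)

      Π-· : ∀ c {v} → InΠ v → InΠ (c · v)
      Π-· c (inΠ s) = inΠ (span-· {w = P} c s)

      Π-lc : ∀ {k} {w : Fin k → V} (c : Fin k → F) → (∀ i → InΠ (w i)) → InΠ (lc c w)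
      Π-lc {w = w} c s = inΠ (span-lc {w = P} {u = w} c (λ i → InΠ.span (s i)))

      Π-cong : ∀ {u v} → u ≈ v → InΠ u → InΠ v
      Π-cong e (inΠ s) = inΠ (span-cong {w = P} e s)

      InE : PointSet
      InE v = v ∈S Π × Qf v ≡ 0F

      -- By `Q-combo` the form vanishes on the whole span, and an elliptic quadric contains no line.
      -- Ellipticity is mostly used in this shape.
      no-singular-line : ∀ {x y} → InΠ x → InΠ y → LinIndep (x ∷ y ∷ []) → Qf x ≡ 0F → Qf y ≡ 0F → B x y ≡ 0F → ⊥
      no-singular-line {x} {y} x∈Π y∈Π ind Qx Qy Bxy =
        proj₂ elliptic (subspace (x ∷ y ∷ []) ind) (λ { zero → InΠ.span x∈Π ; (suc zero) → InΠ.span y∈Π }) singular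
        where
        singular : TotallySingular (subspace (x ∷ y ∷ []) ind)
        singular v (_ , c , e) = begin
          Qf v      ≡⟨ Q-cong (≈-trans e (lc₂ c {x ∷ y ∷ []})) ⟩
          Qf ((c zero · x) +V (c (suc zero) · y))      ≡⟨ Q-combo (c zero) (c (suc zero)) x y ⟩
          ((c zero *F c zero) *F Qf x +F (c (suc zero) *F c (suc zero)) *F Qf y) +F (c zero *F c (suc zero)) *F B x y
            ≡⟨ cong₂ _+F_ (cong₂ _+F_ (cong (_ *F_) Qx) (cong (_ *F_) Qy)) (cong (_ *F_) Bxy) ⟩
          ((c zero *F c zero) *F 0F +F (c (suc zero) *F c (suc zero)) *F 0F) +F (c zero *F c (suc zero)) *F 0F
            ≡⟨ solve 2 (λ a b → ((a :* a) :* :0 :+ (b :* b) :* :0) :+ (a :* b) :* :0 := :0) refl (c zero) (c (suc zero)) ⟩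
          0F ∎

      -- A vector v of the radical has Q v ≠ 0, so every w ∈ Π has a singular translate w + t v;
      -- translating two orthogonal vectors that are independent modulo v gives a line of the quadric.
      opaque
        Π-nondegenerate : ∀ {v} → InΠ v → (∀ w → InΠ w → B v w ≡ 0F) → v ≈ 0V
        Π-nondegenerate {v} v∈Π rad with nonzero? v
        ... | inj₁ z = z
        ... | inj₂ v≢0 with Qf v ≟ 0F
        ...   | yes Qv≡0 = ⊥-elim (proj₁ elliptic v (v≢0 , InΠ.span v∈Π) Qv≡0 (λ w s → rad w (inΠ s)))
        ...   | no Qv≢0 with v∈Π
        ...     | inΠ (c , v≈cP) with nonzero-coefficient {w = P} v≢0 c v≈cP
        -- Three linear conditions on the four coefficients of y = `lc d P`: no component at j, none
        -- at k, and orthogonality to `P k`. As v has a nonzero component at j, the vectors v, `P k`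
        -- and y are independent.
        ...       | j , cj≢0 = ⊥-elim (contradiction (dependent {3} {4} ℕₚ.≤-refl (λ i → δ i j ∷ δ i k ∷ B (P k) (P i) ∷ [])))
          where
          other : Fin 4 → Fin 4
          other zero    = suc zero
          other (suc _) = zero
          k : Fin 4
          k = other j
          δ-other : ∀ j → δ (other j) j ≡ 0F
          δ-other zero    = refl
          δ-other (suc _) = refl
          δ-self : ∀ {n} (i : Fin n) → δ i i ≡ 1F
          δ-self zero    = refl
          δ-self (suc i) = δ-self i
          -- Q(w + t v) = Q(w) + t^2 Q(v), because v is orthogonal to w; this choice of t makes it
          -- vanish.
          t : V → F
          t w = sqrt (Qf w *F Qf v ⁻¹)
          σ : V → V
          σ w = w +V (t w · v)
          Q-σ : ∀ {w} → InΠ w → Qf (σ w) ≡ 0F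
          Q-σ {w} w∈Π = begin
            Qf (σ w)      ≡⟨ Q-+ w (t w · v) ⟩
            (Qf w +F Qf (t w · v)) +F B w (t w · v)      ≡⟨ cong₂ _+F_ (cong (Qf w +F_) (Q-· (t w) v))
                                                                      (trans (B-·ʳ (t w) w v) (cong (t w *F_) (trans (B-sym w v) (rad w w∈Π)))) ⟩
            (Qf w +F (t w *F t w) *F Qf v) +F t w *F 0F      ≡⟨ cong (λ s → (Qf w +F s *F Qf v) +F t w *F 0F) (sqrt² _) ⟩
            (Qf w +F (Qf w *F Qf v ⁻¹) *F Qf v) +F t w *F 0F      ≡⟨ solve 4 (λ a b b' t → (a :+ (a :* b') :* b) :+ t :* :0 := a :+ a :* (b :* b')) refl (Qf w) (Qf v) (Qf v ⁻¹) (t w) ⟩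
            Qf w +F Qf w *F (Qf v *F Qf v ⁻¹)      ≡⟨ cong (λ s → Qf w +F Qf w *F s) (⁻¹-inverse Qv≢0) ⟩
            Qf w +F Qf w *F 1F      ≡⟨ solve 1 (λ a → a :+ a :* :1 := :0) refl (Qf w) ⟩
            0F      ∎
          σ∈Π : ∀ {w} → InΠ w → InΠ (σ w)
          σ∈Π {w} s = Π-+ s (Π-· (t w) v∈Π)
          contradiction : (∃ λ d → Nontrivial d × (∀ l → ∑ (λ i → d i *F (δ i j ∷ δ i k ∷ B (P k) (P i) ∷ []) l) ≡ 0F)) → ⊥
          contradiction (d , (i₀ , di₀≢0) , eqs) = no-singular-line (σ∈Π x∈Π) (σ∈Π y∈Π) (linIndep₂ ind) (Q-σ x∈Π) (Q-σ y∈Π) B≡0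
            where
            x y : V
            x = P k
            y = lc d P
            x∈Π : InΠ x
            x∈Π = Π-basis k
            y∈Π : InΠ y
            y∈Π = inΠ (d , ≈-refl)
            dj≡0 : d j ≡ 0F
            dj≡0 = trans (sym (∑-δ d j)) (eqs zero)
            dk≡0 : d k ≡ 0F
            dk≡0 = trans (sym (∑-δ d k)) (eqs (suc zero))
            B≡0 : B (σ x) (σ y) ≡ 0F
            B≡0 = begin
              B (σ x) (σ y)      ≡⟨ B-+ˡ x (t x · v) (σ y) ⟩
              B x (σ y) +F B (t x · v) (σ y)      ≡⟨ cong₂ _+F_ (B-+ʳ x y (t y · v)) (trans (B-·ˡ (t x) v (σ y)) (cong (t x *F_) (rad (σ y) (σ∈Π y∈Π)))) ⟩
              (B x y +F B x (t y · v)) +F t x *F 0F ≡⟨ cong₂ (λ m n → (m +F n) +F t x *F 0F) (trans (B-lcʳ d P x) (eqs (suc (suc zero))))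
                                                        (trans (B-·ʳ (t y) x v) (cong (t y *F_) (trans (B-sym x v) (rad x x∈Π)))) ⟩
              (0F +F t y *F 0F) +F t x *F 0F      ≡⟨ solve 2 (λ a b → (:0 :+ a :* :0) :+ b :* :0 := :0) refl (t y) (t x) ⟩
              0F ∎
            ind : ∀ α β → ((α · σ x) +V (β · σ y)) ≈ 0V → α ≡ 0F × β ≡ 0F
            ind α β z = α≡0 , β≡0
              where
              γ : F
              γ = α *F t x +F β *F t y
              -- The coordinates of α σ(x) + β σ(y) in the basis of Π. Read at j, k and i₀, in this
              -- order, they give γ = 0, α = 0 and β = 0.
              e : Fin 4 → F
              e i = (α *F δ k i +F β *F d i) +F γ *F c i
              e≡0 : ∀ i → e i ≡ 0F
              e≡0 = Subspace.indep Π e (λ l → begin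
                ∑ (λ i → e i *F P i l)
                  ≡⟨ ∑-cong (λ i → solve 7 (λ α δ β d γ c p → ((α :* δ :+ β :* d) :+ γ :* c) :* p := (α :* (δ :* p) :+ β :* (d :* p)) :+ γ :* (c :* p))
                        refl α (δ k i) β (d i) γ (c i) (P i l)) ⟩
                ∑ (λ i → (α *F (δ k i *F P i l) +F β *F (d i *F P i l)) +F γ *F (c i *F P i l))
                  ≡⟨ trans (∑-+ (λ i → α *F (δ k i *F P i l) +F β *F (d i *F P i l)) (λ i → γ *F (c i *F P i l)))
                           (cong₂ _+F_ (trans (∑-+ (λ i → α *F (δ k i *F P i l)) (λ i → β *F (d i *F P i l)))
                             (cong₂ _+F_ (∑-* α (λ i → δ k i *F P i l)) (∑-* β (λ i → d i *F P i l)))) (∑-* γ (λ i → c i *F P i l))) ⟩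
                (α *F lc (δ k) P l +F β *F y l) +F γ *F lc c P l
                  ≡⟨ cong₂ (λ m n → (α *F m +F β *F y l) +F γ *F n) (lc-δ P k l) (sym (v≈cP l)) ⟩
                (α *F x l +F β *F y l) +F γ *F v l
                  ≡⟨ solve 7 (λ α β x y v s t → (α :* x :+ β :* y) :+ (α :* s :+ β :* t) :* v := α :* (x :+ s :* v) :+ β :* (y :+ t :* v))
                       refl α β (x l) (y l) (v l) (t x) (t y) ⟩
                α *F σ x l +F β *F σ y l
                  ≡⟨ z l ⟩
                0F ∎)
              γ≡0 : γ ≡ 0F
              γ≡0 = *-cancel-nonzero cj≢0 (begin
                c j *F γ      ≡⟨ solve 4 (λ α β γ c → c :* γ := (α :* :0 :+ β :* :0) :+ γ :* c) refl α β γ (c j) ⟩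
                (α *F 0F +F β *F 0F) +F γ *F c j      ≡⟨ cong₂ (λ m n → (α *F m +F β *F n) +F γ *F c j) (sym (δ-other j)) (sym dj≡0) ⟩
                e j      ≡⟨ e≡0 j ⟩
                0F ∎)
              α≡0 : α ≡ 0F
              α≡0 = begin
                α      ≡⟨ solve 3 (λ α β c → α := (α :* :1 :+ β :* :0) :+ :0 :* c) refl α β (c k) ⟩
                (α *F 1F +F β *F 0F) +F 0F *F c k      ≡⟨ cong₂ (λ m n → (α *F m +F β *F n) +F 0F *F c k) (sym (δ-self k)) (sym dk≡0) ⟩
                (α *F δ k k +F β *F d k) +F 0F *F c k      ≡⟨ cong (λ m → (α *F δ k k +F β *F d k) +F m *F c k) (sym γ≡0) ⟩
                e k      ≡⟨ e≡0 k ⟩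
                0F ∎
              β≡0 : β ≡ 0F
              β≡0 = *-cancel-nonzero di₀≢0 (begin
                d i₀ *F β      ≡⟨ solve 4 (λ β d δ c → d :* β := (:0 :* δ :+ β :* d) :+ :0 :* c) refl β (d i₀) (δ k i₀) (c i₀) ⟩
                (0F *F δ k i₀ +F β *F d i₀) +F 0F *F c i₀    ≡⟨ cong₂ (λ m n → (m *F δ k i₀ +F β *F d i₀) +F n *F c i₀) (sym α≡0) (sym γ≡0) ⟩
                e i₀      ≡⟨ e≡0 i₀ ⟩
                0F ∎)

      -- Nondegeneracy as extensionality: a vector of Π is determined by its pairings with Π. The
      -- equations for `proj` are proved this way.
      Π-ext : ∀ {u v} → InΠ u → InΠ v → (∀ w → InΠ w → B u w ≡ B v w) → u ≈ v
      Π-ext {u} {v} u∈Π v∈Π h j = +≡0⇒≡ (Π-nondegenerate (Π-+ u∈Π v∈Π) (λ w w∈Π → trans (B-+ˡ u v w) (≡⇒+≡0 (h w w∈Π))) j)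

      opaque
        not-radical : ∀ {v} → InΠ v → NonZero v → ∃ λ i → B v (P i) ≢ 0F
        not-radical {v} v∈Π v≢0 with any? (λ i → ¬? (B v (P i) ≟ 0F))
        ... | yes p = p
        ... | no ¬p = ⊥-elim (v≢0 (Π-nondegenerate v∈Π (λ w w∈Π → ⊥-span {w = P} all0 (InΠ.span w∈Π))))
          where
          all0 : ∀ i → B v (P i) ≡ 0F
          all0 i with B v (P i) ≟ 0F
          ... | yes e = e
          ... | no ne = ⊥-elim (¬p (i , ne))

      -- Symplectic frames and coordinates.

      -- A symplectic basis of Π whose first hyperbolic pair is prescribed.
      record Frame (e f : V) : Set where
        field
          g h : V
          e∈Π : InΠ e
          f∈Π : InΠ f
          g∈Π : InΠ g
          h∈Π : InΠ h
          ef  : B e f ≡ 1F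
          gh  : B g h ≡ 1F
          eg  : B e g ≡ 0F
          eh  : B e h ≡ 0F
          fg  : B f g ≡ 0F
          fh  : B f h ≡ 0F

      module Coordinates {e f : V} (Fr : Frame e f) where
        open Frame Fr public

        frame : Fin 4 → V
        frame = e ∷ f ∷ g ∷ h ∷ []

        opaque
          vec : F → F → F → F → V
          vec x₀ x₁ x₂ x₃ = lc (x₀ ∷ x₁ ∷ x₂ ∷ x₃ ∷ []) frame

          vec-lc : ∀ x₀ x₁ x₂ x₃ → vec x₀ x₁ x₂ x₃ ≈ lc (x₀ ∷ x₁ ∷ x₂ ∷ x₃ ∷ []) frame
          vec-lc x₀ x₁ x₂ x₃ j = refl

        frame∈Π : ∀ i → InΠ (frame i)
        frame∈Π zero                   = e∈Π
        frame∈Π (suc zero)             = f∈Π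
        frame∈Π (suc (suc zero))       = g∈Π
        frame∈Π (suc (suc (suc zero))) = h∈Π

        vec∈Π : ∀ x₀ x₁ x₂ x₃ → InΠ (vec x₀ x₁ x₂ x₃)
        vec∈Π x₀ x₁ x₂ x₃ = Π-cong (≈-sym (vec-lc x₀ x₁ x₂ x₃)) (Π-lc {w = frame} (x₀ ∷ x₁ ∷ x₂ ∷ x₃ ∷ []) frame∈Π)

        private
          against : ∀ w b₀ b₁ b₂ b₃ → B w e ≡ b₀ → B w f ≡ b₁ → B w g ≡ b₂ → B w h ≡ b₃ → ∀ x₀ x₁ x₂ x₃ →
                    B w (vec x₀ x₁ x₂ x₃) ≡ x₀ *F b₀ +F (x₁ *F b₁ +F (x₂ *F b₂ +F (x₃ *F b₃ +F 0F)))
          against w _ _ _ _ refl refl refl refl x₀ x₁ x₂ x₃ = trans (B-congʳ (vec-lc x₀ x₁ x₂ x₃)) (B-lcʳ (x₀ ∷ x₁ ∷ x₂ ∷ x₃ ∷ []) frame w)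

        B-e : ∀ x₀ x₁ x₂ x₃ → B e (vec x₀ x₁ x₂ x₃) ≡ x₁
        B-e x₀ x₁ x₂ x₃ = trans (against e 0F 1F 0F 0F (B-alt e) ef eg eh x₀ x₁ x₂ x₃)
          (solve 4 (λ a b c d → a :* :0 :+ (b :* :1 :+ (c :* :0 :+ (d :* :0 :+ :0))) := b) refl x₀ x₁ x₂ x₃)

        B-f : ∀ x₀ x₁ x₂ x₃ → B f (vec x₀ x₁ x₂ x₃) ≡ x₀
        B-f x₀ x₁ x₂ x₃ = trans (against f 1F 0F 0F 0F (trans (B-sym f e) ef) (B-alt f) fg fh x₀ x₁ x₂ x₃)
          (solve 4 (λ a b c d → a :* :1 :+ (b :* :0 :+ (c :* :0 :+ (d :* :0 :+ :0))) := a) refl x₀ x₁ x₂ x₃)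

        B-g : ∀ x₀ x₁ x₂ x₃ → B g (vec x₀ x₁ x₂ x₃) ≡ x₃
        B-g x₀ x₁ x₂ x₃ = trans (against g 0F 0F 0F 1F (trans (B-sym g e) eg) (trans (B-sym g f) fg) (B-alt g) gh x₀ x₁ x₂ x₃)
          (solve 4 (λ a b c d → a :* :0 :+ (b :* :0 :+ (c :* :0 :+ (d :* :1 :+ :0))) := d) refl x₀ x₁ x₂ x₃)

        B-h : ∀ x₀ x₁ x₂ x₃ → B h (vec x₀ x₁ x₂ x₃) ≡ x₂
        B-h x₀ x₁ x₂ x₃ = trans (against h 0F 0F 1F 0F (trans (B-sym h e) eh) (trans (B-sym h f) fh) (trans (B-sym h g) gh) (B-alt h) x₀ x₁ x₂ x₃)
          (solve 4 (λ a b c d → a :* :0 :+ (b :* :0 :+ (c :* :1 :+ (d :* :0 :+ :0))) := c) refl x₀ x₁ x₂ x₃)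

        B-vec : ∀ x₀ x₁ x₂ x₃ y₀ y₁ y₂ y₃ → B (vec x₀ x₁ x₂ x₃) (vec y₀ y₁ y₂ y₃) ≡ (x₀ *F y₁ +F x₁ *F y₀) +F (x₂ *F y₃ +F x₃ *F y₂)
        B-vec x₀ x₁ x₂ x₃ y₀ y₁ y₂ y₃ = trans (B-sym x y) (trans
          (against y y₁ y₀ y₃ y₂ (trans (B-sym y e) (B-e y₀ y₁ y₂ y₃)) (trans (B-sym y f) (B-f y₀ y₁ y₂ y₃))
                     (trans (B-sym y g) (B-g y₀ y₁ y₂ y₃)) (trans (B-sym y h) (B-h y₀ y₁ y₂ y₃)) x₀ x₁ x₂ x₃)
          (solve 4 (λ a b c d → a :+ (b :+ (c :+ (d :+ :0))) := (a :+ b) :+ (c :+ d))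
             refl (x₀ *F y₁) (x₁ *F y₀) (x₂ *F y₃) (x₃ *F y₂)))
          where
          x = vec x₀ x₁ x₂ x₃
          y = vec y₀ y₁ y₂ y₃

        vec-injective : ∀ {x₀ x₁ x₂ x₃ y₀ y₁ y₂ y₃} → vec x₀ x₁ x₂ x₃ ≈ vec y₀ y₁ y₂ y₃ → x₀ ≡ y₀ × x₁ ≡ y₁ × x₂ ≡ y₂ × x₃ ≡ y₃
        vec-injective {x₀} {x₁} {x₂} {x₃} {y₀} {y₁} {y₂} {y₃} eq =
          trans (sym (B-f x₀ x₁ x₂ x₃)) (trans (B-congʳ eq) (B-f y₀ y₁ y₂ y₃)) ,
          trans (sym (B-e x₀ x₁ x₂ x₃)) (trans (B-congʳ eq) (B-e y₀ y₁ y₂ y₃)) ,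
          trans (sym (B-h x₀ x₁ x₂ x₃)) (trans (B-congʳ eq) (B-h y₀ y₁ y₂ y₃)) ,
          trans (sym (B-g x₀ x₁ x₂ x₃)) (trans (B-congʳ eq) (B-g y₀ y₁ y₂ y₃))

        vec-zero : vec 0F 0F 0F 0F ≈ 0V
        vec-zero = ≈-trans (vec-lc 0F 0F 0F 0F) (lc-0 {c = 0F ∷ 0F ∷ 0F ∷ 0F ∷ []} frame λ { zero → refl ; (suc zero) → refl ; (suc (suc zero)) → refl ; (suc (suc (suc zero))) → refl })

        vec-≡0 : ∀ {x₀ x₁ x₂ x₃} → vec x₀ x₁ x₂ x₃ ≈ 0V → x₀ ≡ 0F × x₁ ≡ 0F × x₂ ≡ 0F × x₃ ≡ 0F
        vec-≡0 z = vec-injective (≈-trans z (≈-sym vec-zero))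

        vec-cong : ∀ {x₀ x₁ x₂ x₃ y₀ y₁ y₂ y₃} → x₀ ≡ y₀ → x₁ ≡ y₁ → x₂ ≡ y₂ → x₃ ≡ y₃ → vec x₀ x₁ x₂ x₃ ≈ vec y₀ y₁ y₂ y₃
        vec-cong refl refl refl refl = ≈-refl

        frame-indep : LinIndep frame
        frame-indep c z = λ { zero → proj₁ p ; (suc zero) → proj₁ (proj₂ p) ; (suc (suc zero)) → proj₁ (proj₂ (proj₂ p))
                            ; (suc (suc (suc zero))) → proj₂ (proj₂ (proj₂ p)) }
          where p = vec-≡0 {c zero} {c (suc zero)} {c (suc (suc zero))} {c (suc (suc (suc zero)))}
                      (≈-trans (vec-lc (c zero) (c (suc zero)) (c (suc (suc zero))) (c (suc (suc (suc zero))))) z)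

        -- The frame is dual to itself, with e paired to f and g to h: the e-coordinate of v is its
        -- pairing with f, the g-coordinate its pairing with h, and so on. That four independent
        -- vectors of Π span it is a dimension count.
        expand : ∀ {v} → InΠ v → v ≈ vec (B v f) (B v e) (B v h) (B v g)
        expand {v} v∈Π with indep-spans P frame (λ i → InΠ.span (frame∈Π i)) frame-indep (InΠ.span v∈Π)
        ... | c , eq' = ≈-trans eq (vec-cong (coord f (B-f c₀ c₁ c₂ c₃)) (coord e (B-e c₀ c₁ c₂ c₃)) (coord h (B-h c₀ c₁ c₂ c₃)) (coord g (B-g c₀ c₁ c₂ c₃)))
          where
          c₀ = c zero
          c₁ = c (suc zero)
          c₂ = c (suc (suc zero))
          c₃ = c (suc (suc (suc zero)))
          eq : v ≈ vec c₀ c₁ c₂ c₃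
          eq = ≈-trans eq' (≈-sym (vec-lc c₀ c₁ c₂ c₃))
          coord : ∀ w {b} → B w (vec c₀ c₁ c₂ c₃) ≡ b → b ≡ B v w
          coord w p = trans (sym p) (trans (B-sym w (vec c₀ c₁ c₂ c₃)) (B-congˡ (≈-sym eq)))

        e≈ : e ≈ vec 1F 0F 0F 0F
        e≈ = ≈-sym (≈-trans (vec-lc 1F 0F 0F 0F) λ j → solve 4 (λ a b c d → :1 :* a :+ (:0 :* b :+ (:0 :* c :+ (:0 :* d :+ :0))) := a) refl (e j) (f j) (g j) (h j))

        f≈ : f ≈ vec 0F 1F 0F 0F
        f≈ = ≈-sym (≈-trans (vec-lc 0F 1F 0F 0F) λ j → solve 4 (λ a b c d → :0 :* a :+ (:1 :* b :+ (:0 :* c :+ (:0 :* d :+ :0))) := b) refl (e j) (f j) (g j) (h j))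

        g≈ : g ≈ vec 0F 0F 1F 0F
        g≈ = ≈-sym (≈-trans (vec-lc 0F 0F 1F 0F) λ j → solve 4 (λ a b c d → :0 :* a :+ (:0 :* b :+ (:1 :* c :+ (:0 :* d :+ :0))) := c) refl (e j) (f j) (g j) (h j))

        h≈ : h ≈ vec 0F 0F 0F 1F
        h≈ = ≈-sym (≈-trans (vec-lc 0F 0F 0F 1F) λ j → solve 4 (λ a b c d → :0 :* a :+ (:0 :* b :+ (:0 :* c :+ (:1 :* d :+ :0))) := d) refl (e j) (f j) (g j) (h j))

        vec-combo : ∀ α β x₀ x₁ x₂ x₃ y₀ y₁ y₂ y₃ → ((α · vec x₀ x₁ x₂ x₃) +V (β · vec y₀ y₁ y₂ y₃)) ≈
                    vec (α *F x₀ +F β *F y₀) (α *F x₁ +F β *F y₁) (α *F x₂ +F β *F y₂) (α *F x₃ +F β *F y₃)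
        vec-combo α β x₀ x₁ x₂ x₃ y₀ y₁ y₂ y₃ j = begin
          α *F vec x₀ x₁ x₂ x₃ j +F β *F vec y₀ y₁ y₂ y₃ j
            ≡⟨ cong₂ (λ s t → α *F s +F β *F t) (vec-lc x₀ x₁ x₂ x₃ j) (vec-lc y₀ y₁ y₂ y₃ j) ⟩
          α *F lc (x₀ ∷ x₁ ∷ x₂ ∷ x₃ ∷ []) frame j +F β *F lc (y₀ ∷ y₁ ∷ y₂ ∷ y₃ ∷ []) frame j
            ≡⟨ step x₀ y₀ (e j) (step x₁ y₁ (f j) (step x₂ y₂ (g j) (step x₃ y₃ (h j)
                 (zero-combination α β)))) ⟩
          lc (α *F x₀ +F β *F y₀ ∷ α *F x₁ +F β *F y₁ ∷ α *F x₂ +F β *F y₂ ∷ α *F x₃ +F β *F y₃ ∷ []) frame j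
            ≡⟨ sym (vec-lc (α *F x₀ +F β *F y₀) (α *F x₁ +F β *F y₁) (α *F x₂ +F β *F y₂) (α *F x₃ +F β *F y₃) j) ⟩
          vec (α *F x₀ +F β *F y₀) (α *F x₁ +F β *F y₁) (α *F x₂ +F β *F y₂) (α *F x₃ +F β *F y₃) j ∎
          where
          step : ∀ x y w {r s t} → α *F r +F β *F s ≡ t → α *F (x *F w +F r) +F β *F (y *F w +F s) ≡ (α *F x +F β *F y) *F w +F t
          step x y w {r} {s} refl = solve 7 (λ α β x y w r s →
            α :* (x :* w :+ r) :+ β :* (y :* w :+ s) := (α :* x :+ β :* y) :* w :+ (α :* r :+ β :* s)) refl α β x y w r s

      opaque
        -- g solves two linear equations in four unknowns; h is a vector not orthogonal to g, made
        -- orthogonal to x and y and then rescaled.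
        pairFrame : ∀ {x y} → InΠ x → InΠ y → B x y ≡ 1F → Frame x y
        pairFrame {x} {y} x∈Π y∈Π xy with dependent {2} {4} (ℕ.s≤s (ℕ.s≤s (ℕ.s≤s ℕ.z≤n))) (λ i → B x (P i) ∷ B y (P i) ∷ [])
        ... | d , nt , eqs with not-radical (inΠ (d , ≈-refl)) (indep-nonzero {w = P} (Subspace.indep Π) d nt)
        ...   | i , b≢0 = record
          { g = g ; h = h ; e∈Π = x∈Π ; f∈Π = y∈Π ; g∈Π = inΠ (d , ≈-refl) ; h∈Π = Π-· (b ⁻¹) (Π-+ (Π-basis i) (Π-+ (Π-· (B w y) x∈Π) (Π-· (B w x) y∈Π)))
          ; ef = xy ; eg = xg ; fg = yg
          ; gh = trans (B-h' g) (trans (cong₂ (λ m n → b ⁻¹ *F (b +F (B w y *F m +F B w x *F n))) (trans (B-sym g x) xg) (trans (B-sym g y) yg))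
                   (trans (solve 4 (λ b' b m n → b' :* (b :+ (m :* :0 :+ n :* :0)) := b :* b') refl (b ⁻¹) b (B w y) (B w x)) (⁻¹-inverse b≢0)))
          ; eh = trans (B-h' x) (trans (cong₂ (λ m n → b ⁻¹ *F (B x w +F (B w y *F m +F B w x *F n))) (B-alt x) xy)
                   (trans (cong (λ m → b ⁻¹ *F (m +F (B w y *F 0F +F B w x *F 1F))) (B-sym x w))
                     (solve 3 (λ b' m n → b' :* (m :+ (n :* :0 :+ m :* :1)) := :0) refl (b ⁻¹) (B w x) (B w y))))
          ; fh = trans (B-h' y) (trans (cong₂ (λ m n → b ⁻¹ *F (B y w +F (B w y *F m +F B w x *F n))) (trans (B-sym y x) xy) (B-alt y))
                   (trans (cong (λ m → b ⁻¹ *F (m +F (B w y *F 1F +F B w x *F 0F))) (B-sym y w))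
                     (solve 3 (λ b' m n → b' :* (n :+ (n :* :1 :+ m :* :0)) := :0) refl (b ⁻¹) (B w x) (B w y))))
          }
          where
          g w h : V
          g = lc d P
          w = P i
          b : F
          b = B g w
          -- Gram-Schmidt for the hyperbolic pair x, y: the added terms cancel the pairings of w
          -- with x and with y, and do not affect its pairing with g.
          h = (b ⁻¹) · (w +V ((B w y · x) +V (B w x · y)))
          xg : B x g ≡ 0F
          xg = trans (B-lcʳ d P x) (eqs zero)
          yg : B y g ≡ 0F
          yg = trans (B-lcʳ d P y) (eqs (suc zero))
          B-h' : ∀ u → B u h ≡ b ⁻¹ *F (B u w +F (B w y *F B u x +F B w x *F B u y))
          B-h' u = trans (B-·ʳ (b ⁻¹) u _) (cong (b ⁻¹ *F_) (trans (B-+ʳ u w _) (cong (B u w +F_) (trans (B-+ʳ u _ _) (cong₂ _+F_ (B-·ʳ (B w y) u x) (B-·ʳ (B w x) u y))))))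

      opaque
        pointFrame : ∀ {x} → InΠ x → NonZero x → ∃ (Frame x)
        pointFrame {x} x∈Π x≢0 with not-radical x∈Π x≢0
        ... | i , b≢0 = (B x (P i) ⁻¹) · P i , pairFrame x∈Π (Π-· (B x (P i) ⁻¹) (Π-basis i))
                        (trans (B-·ʳ (B x (P i) ⁻¹) x (P i)) (trans (R.*-comm _ _) (⁻¹-inverse b≢0)))

      opaque
        baseFrame : ∃ (Frame (P zero))
        baseFrame = pointFrame (Π-basis zero) (indep-basis-nonzero {w = P} (Subspace.indep Π) zero)

      -- Orthogonal projection onto Π.

      private module F₀ = Coordinates (proj₂ baseFrame)

      opaque
        -- The coordinate formula of `expand`, applied to any v: the projection along Π^⊥, which
        -- exists because Π is nondegenerate.
        proj : V → V
        proj v = F₀.vec (B v (proj₁ baseFrame)) (B v (P zero)) (B v F₀.h) (B v F₀.g)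

        proj∈Π : ∀ v → InΠ (proj v)
        proj∈Π v = F₀.vec∈Π _ _ _ _

        -- On each frame vector w the functional B (proj v) reads off the coordinate B v w.
        proj-B : ∀ v {w} → InΠ w → B (proj v) w ≡ B v w
        proj-B v {w} w∈Π = trans (B-congʳ w≈) (trans (B-lcʳ c F₀.frame (proj v)) (trans
          (∑-cong (λ i → cong (c i *F_) (on-frame i))) (trans (sym (B-lcʳ c F₀.frame v)) (B-congʳ (≈-sym w≈)))))
          where
          c : Fin 4 → F
          c = B w (proj₁ baseFrame) ∷ B w (P zero) ∷ B w F₀.h ∷ B w F₀.g ∷ []
          w≈ : w ≈ lc c F₀.frame
          w≈ = ≈-trans (F₀.expand w∈Π) (F₀.vec-lc _ _ _ _)
          on-frame : ∀ i → B (proj v) (F₀.frame i) ≡ B v (F₀.frame i)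
          on-frame zero                   = trans (B-sym (proj v) _) (F₀.B-e _ _ _ _)
          on-frame (suc zero)             = trans (B-sym (proj v) _) (F₀.B-f _ _ _ _)
          on-frame (suc (suc zero))       = trans (B-sym (proj v) _) (F₀.B-g _ _ _ _)
          on-frame (suc (suc (suc zero))) = trans (B-sym (proj v) _) (F₀.B-h _ _ _ _)

      proj-id : ∀ {v} → InΠ v → proj v ≈ v
      proj-id {v} v∈Π = Π-ext (proj∈Π v) v∈Π (λ w w∈Π → proj-B v w∈Π)

      proj-cong : ∀ {u v} → u ≈ v → proj u ≈ proj v
      proj-cong {u} {v} e = Π-ext (proj∈Π u) (proj∈Π v) (λ w w∈Π → trans (proj-B u w∈Π) (trans (B-congˡ e) (sym (proj-B v w∈Π))))

      proj-lc : ∀ {k} (c : Fin k → F) w → proj (lc c w) ≈ lc c (λ i → proj (w i))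
      proj-lc c w = Π-ext (proj∈Π (lc c w)) (Π-lc c (λ i → proj∈Π (w i))) (λ u u∈Π →
        trans (proj-B (lc c w) u∈Π) (trans (B-lcˡ c w u) (trans (∑-cong (λ i → cong (c i *F_) (sym (proj-B (w i) u∈Π)))) (sym (B-lcˡ c _ u)))))

      proj-combo : ∀ α β x y → proj ((α · x) +V (β · y)) ≈ ((α · proj x) +V (β · proj y))
      proj-combo α β x y = Π-ext (proj∈Π _) (Π-+ (Π-· α (proj∈Π x)) (Π-· β (proj∈Π y))) (λ w w∈Π → trans (proj-B _ w∈Π)
        (trans (B-combo α β x y w) (trans (cong₂ (λ s t → α *F s +F β *F t) (sym (proj-B x w∈Π)) (sym (proj-B y w∈Π))) (sym (B-combo α β _ _ w)))))

      res : V → V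
      res v = v +V proj v

      res-⊥ : ∀ v {w} → InΠ w → B (res v) w ≡ 0F
      res-⊥ v {w} w∈Π = trans (B-+ˡ v (proj v) w) (≡⇒+≡0 (sym (proj-B v w∈Π)))

      B-split : ∀ u v → B u v ≡ B (proj u) (proj v) +F B (res u) (res v)
      B-split u v = sym (begin
        B pu pv +F B (res u) (res v)      ≡⟨ cong (B pu pv +F_) (trans (B-+ʳ (res u) v pv) (trans (cong₂ _+F_ (B-+ˡ u pu v) (res-⊥ u (proj∈Π v))) (R.+-identityʳ _))) ⟩
        B pu pv +F (B u v +F B pu v)      ≡⟨ cong (λ s → B pu pv +F (B u v +F s)) (trans (B-sym pu v) (trans (sym (proj-B v (proj∈Π u))) (B-sym pv pu))) ⟩
        B pu pv +F (B u v +F B pu pv)      ≡⟨ solve 2 (λ a b → a :+ (b :+ a) := b) refl (B pu pv) (B u v) ⟩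
        B u v      ∎)
        where
        pu = proj u
        pv = proj v

      Q-split : ∀ v → Qf v ≡ Qf (proj v) +F Qf (res v)
      Q-split v = begin
        Qf v      ≡⟨ Q-cong (λ j → solve 2 (λ a b → a := (a :+ b) :+ b) refl (v j) (proj v j)) ⟩
        Qf (res v +V proj v)      ≡⟨ Q-+ (res v) (proj v) ⟩
        (Qf (res v) +F Qf (proj v)) +F B (res v) (proj v)  ≡⟨ cong ((Qf (res v) +F Qf (proj v)) +F_) (res-⊥ v (proj∈Π v)) ⟩
        (Qf (res v) +F Qf (proj v)) +F 0F      ≡⟨ trans (R.+-identityʳ _) (R.+-comm _ _) ⟩
        Qf (proj v) +F Qf (res v)      ∎

      res-lc : ∀ {k} (c : Fin k → F) w → res (lc c w) ≈ lc c (λ i → res (w i))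
      res-lc c w j = trans (cong (lc c w j +F_) (proj-lc c w j)) (sym (trans (∑-cong (λ i → R.distribˡ (c i) (w i j) (proj (w i) j)))
        (∑-+ (λ i → c i *F w i j) (λ i → c i *F proj (w i) j))))

      res≈0⇒proj : ∀ {v} → res v ≈ 0V → v ≈ proj v
      res≈0⇒proj z j = +≡0⇒≡ (z j)

      -- The lines of W(q) are the totally isotropic lines of Π.

      WLine : Line → Set
      WLine L = L ⊆S Π × MeetsInOnePoint InE L

      IsOvoidW : PointSet → Set
      IsOvoidW O = (∀ u v → SamePoint u v → O v → O u)
                 × (∀ v → O v → v ∈S Π)
                 × (∀ L → WLine L → MeetsInOnePoint O L)

      opaque
        singular-perp-same : ∀ {x y} → InΠ x → InΠ y → NonZero x → NonZero y → Qf x ≡ 0F → Qf y ≡ 0F → B x y ≡ 0F → SamePoint x y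
        singular-perp-same x∈Π y∈Π x≢0 y≢0 Qx Qy Bxy with same-or-indep x≢0 y≢0
        ... | inj₁ same = same
        ... | inj₂ ind  = ⊥-elim (no-singular-line x∈Π y∈Π ind Qx Qy Bxy)

      opaque
        -- On an isotropic line Q(αx + βy) is the square of α√Q(x) + β√Q(y), which vanishes at α =
        -- √Q(y), β = √Q(x); both being zero would put the line on the quadric. Two singular points
        -- of the line are orthogonal, so they coincide.
        isotropic⇒WLine : ∀ {x y} → InΠ x → InΠ y → (ind : LinIndep (x ∷ y ∷ [])) → B x y ≡ 0F → WLine (subspace (x ∷ y ∷ []) ind)
        isotropic⇒WLine {x} {y} x∈Π y∈Π ind Bxy =
          (λ { zero → InΠ.span x∈Π ; (suc zero) → InΠ.span y∈Π }) ,
          p , (p≢0 , s , ≈-sym (lc₂ s {x ∷ y ∷ []})) , ((p≢0 , InΠ.span p∈Π) , Qp) ,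
          λ { v (v≢0 , c , e) ((_ , v∈Π) , Qv) → singular-perp-same (inΠ v∈Π) p∈Π v≢0 p≢0 Qv Qp
                (trans (B-congˡ (≈-trans e (lc₂ c {x ∷ y ∷ []}))) (trans (B-combo (c zero) (c (suc zero)) x y p)
                  (trans (cong₂ (λ m n → c zero *F m +F c (suc zero) *F n) (x⊥p) (y⊥p))
                    (zero-combination (c zero) (c (suc zero)))))) }
          where
          s : Fin 2 → F
          s = sqrt (Qf y) ∷ sqrt (Qf x) ∷ []
          p : V
          p = (sqrt (Qf y) · x) +V (sqrt (Qf x) · y)
          p∈Π : InΠ p
          p∈Π = Π-+ (Π-· _ x∈Π) (Π-· _ y∈Π)
          x⊥p : B x p ≡ 0F
          x⊥p = trans (B-sym x p) (trans (B-combo _ _ x y x) (trans (cong₂ (λ m n → sqrt (Qf y) *F m +F sqrt (Qf x) *F n) (B-alt x) (trans (B-sym y x) Bxy))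
                  (zero-combination (sqrt (Qf y)) (sqrt (Qf x)))))
          y⊥p : B y p ≡ 0F
          y⊥p = trans (B-sym y p) (trans (B-combo _ _ x y y) (trans (cong₂ (λ m n → sqrt (Qf y) *F m +F sqrt (Qf x) *F n) Bxy (B-alt y))
                  (zero-combination (sqrt (Qf y)) (sqrt (Qf x)))))
          Qp : Qf p ≡ 0F
          Qp = begin
            Qf p ≡⟨ Q-combo _ _ x y ⟩
            ((sqrt (Qf y) *F sqrt (Qf y)) *F Qf x +F (sqrt (Qf x) *F sqrt (Qf x)) *F Qf y) +F (sqrt (Qf y) *F sqrt (Qf x)) *F B x y
              ≡⟨ cong₂ _+F_ (cong₂ (λ m n → m *F Qf x +F n *F Qf y) (sqrt² (Qf y)) (sqrt² (Qf x))) (cong (_ *F_) Bxy) ⟩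
            (Qf y *F Qf x +F Qf x *F Qf y) +F (sqrt (Qf y) *F sqrt (Qf x)) *F 0F
              ≡⟨ solve 3 (λ a b c → (b :* a :+ a :* b) :+ c :* :0 := :0) refl (Qf x) (Qf y) (sqrt (Qf y) *F sqrt (Qf x)) ⟩
            0F ∎
          sqrt≡0 : ∀ {u} → sqrt u ≡ 0F → u ≡ 0F
          sqrt≡0 {u} e = trans (sym (sqrt² u)) (trans (cong (_*F sqrt u) e) (R.zeroˡ _))
          p≢0 : NonZero p
          p≢0 z = no-singular-line x∈Π y∈Π ind (sqrt≡0 (coef (suc zero))) (sqrt≡0 (coef zero)) Bxy
            where
            coef : ∀ i → s i ≡ 0F
            coef = ind s (≈-trans (lc₂ s {x ∷ y ∷ []}) z)

      -- A second singular point on a hyperbolic line through the singular point p is Q(w) p + B(p,w) w.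
      opaque
        WLine⇒isotropic : ∀ (L : Line) → WLine L → B (Subspace.basis L zero) (Subspace.basis L (suc zero)) ≡ 0F
        WLine⇒isotropic L (L⊆Π , p , (p≢0 , c , e) , ((_ , _) , Qp) , unique) with B x y ≟ 0F
          where
          x y : V
          x = Subspace.basis L zero
          y = Subspace.basis L (suc zero)
        ... | yes b≡0 = b≡0
        ... | no b≢0 = ⊥-elim (p≢0 (≈-trans p≈ (≈-trans (≈-sym (lc₂ c {Subspace.basis L})) (lc-0 {c = c} (Subspace.basis L) (λ { zero → c₀≡0 ; (suc zero) → c₁≡0 })))))
          where
          x y : V
          x = Subspace.basis L zero
          y = Subspace.basis L (suc zero)
          p≈ : p ≈ ((c zero · x) +V (c (suc zero) · y))
          p≈ = ≈-trans e (lc₂ c {Subspace.basis L})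
          -- Otherwise `p'` is a singular point of L with B(p, p') = B(p, w)^2 nonzero, hence
          -- different from p, the only singular point of L.
          perp : ∀ i → B p (Subspace.basis L i) ≡ 0F
          perp i with B p w ≟ 0F
            where w : V
                  w = Subspace.basis L i
          ... | yes z = z
          ... | no m≢0 = ⊥-elim (*-nonzero m≢0 m≢0 (trans (sym Bpp') (trans (B-sym p p') (SamePoint-⊥ same (B-alt p)))))
            where
            w p' : V
            w = Subspace.basis L i
            p' = (Qf w · p) +V (B p w · w)
            Bpp' : B p p' ≡ B p w *F B p w
            Bpp' = trans (B-sym p p') (trans (B-combo (Qf w) (B p w) p w p) (trans (cong₂ (λ m n → Qf w *F m +F B p w *F n) (B-alt p) (B-sym w p))
              (solve 2 (λ a b → a :* :0 :+ b :* b := b :* b) refl (Qf w) (B p w))))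
            p'∈L : InSpan (Subspace.basis L) p'
            p'∈L = span-+ {w = Subspace.basis L} (span-· {w = Subspace.basis L} _ (c , e)) (span-· {w = Subspace.basis L} _ (span-basis (Subspace.basis L) i))
            p'≢0 : NonZero p'
            p'≢0 z = *-nonzero m≢0 m≢0 (trans (sym Bpp') (trans (B-sym p p') (B-0ˡ p z)))
            Qp' : Qf p' ≡ 0F
            Qp' = trans (Q-combo (Qf w) (B p w) p w) (trans (cong (λ k → ((Qf w *F Qf w) *F k +F (B p w *F B p w) *F Qf w) +F (Qf w *F B p w) *F B p w) Qp)
              (solve 2 (λ a b → ((a :* a) :* :0 :+ (b :* b) :* a) :+ (a :* b) :* b := :0) refl (Qf w) (B p w)))
            same : SamePoint p' p
            same = unique p' (p'≢0 , p'∈L) ((p'≢0 , span-trans {w = P} {u = Subspace.basis L} L⊆Π p'∈L) , Qp')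
          -- With B(x, y) nonzero the form is nondegenerate on L, so p, being orthogonal to L, has
          -- zero coefficients.
          c₁≡0 : c (suc zero) ≡ 0F
          c₁≡0 = *-cancel-nonzero b≢0 (begin
            B x y *F c (suc zero)      ≡⟨ solve 3 (λ b c d → b :* d := c :* :0 :+ d :* b) refl (B x y) (c zero) (c (suc zero)) ⟩
            c zero *F 0F +F c (suc zero) *F B x y      ≡⟨ cong₂ (λ m n → c zero *F m +F c (suc zero) *F n) (sym (B-alt x)) (B-sym x y) ⟩
            c zero *F B x x +F c (suc zero) *F B y x      ≡⟨ sym (B-combo _ _ x y x) ⟩
            B ((c zero · x) +V (c (suc zero) · y)) x      ≡⟨ B-congˡ (≈-sym p≈) ⟩
            B p x      ≡⟨ perp zero ⟩
            0F ∎)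
          c₀≡0 : c zero ≡ 0F
          c₀≡0 = *-cancel-nonzero b≢0 (begin
            B x y *F c zero      ≡⟨ solve 3 (λ b c d → b :* c := c :* b :+ d :* :0) refl (B x y) (c zero) (c (suc zero)) ⟩
            c zero *F B x y +F c (suc zero) *F 0F      ≡⟨ cong (λ m → c zero *F B x y +F c (suc zero) *F m) (sym (B-alt y)) ⟩
            c zero *F B x y +F c (suc zero) *F B y y      ≡⟨ sym (B-combo _ _ x y y) ⟩
            B ((c zero · x) +V (c (suc zero) · y)) y      ≡⟨ B-congˡ (≈-sym p≈) ⟩
            B p y      ≡⟨ perp (suc zero) ⟩
            0F ∎)

      -- Points of O on lines of W(q).

      module Ovoid (O : PointSet) (isOvoid : IsOvoidW O) where

        O-same : ∀ {u v} → SamePoint u v → O v → O u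
        O-same = proj₁ isOvoid _ _

        O-cong : ∀ {u v} → u ≈ v → O v → O u
        O-cong e = O-same (SamePoint-refl e)

        O-nonzero : ∀ {v} → O v → NonZero v
        O-nonzero Ov = proj₁ (proj₁ (proj₂ isOvoid) _ Ov)

        O∈Π : ∀ {v} → O v → InΠ v
        O∈Π Ov = inΠ (proj₂ (proj₁ (proj₂ isOvoid) _ Ov))

        opaque
          -- If independent, x and y would span a line of W(q) carrying two points of O.
          O-perp-same : ∀ {x y} → O x → O y → B x y ≡ 0F → SamePoint x y
          O-perp-same {x} {y} Ox Oy Bxy with same-or-indep (O-nonzero Ox) (O-nonzero Oy)
          ... | inj₁ same = same
          ... | inj₂ ind with proj₂ (proj₂ isOvoid) (subspace (x ∷ y ∷ []) ind) (isotropic⇒WLine (O∈Π Ox) (O∈Π Oy) ind Bxy)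
          ...   | p , _ , _ , unique = SamePoint-trans (unique x (O-nonzero Ox , span-basis (x ∷ y ∷ []) zero) Ox)
                                        (SamePoint-sym (unique y (O-nonzero Oy , span-basis (x ∷ y ∷ []) (suc zero)) Oy))

        opaque
          meet : ∀ {x y} → InΠ x → InΠ y → LinIndep (x ∷ y ∷ []) → B x y ≡ 0F → ∃ λ α → ∃ λ β → O ((α · x) +V (β · y))
          meet {x} {y} x∈Π y∈Π ind Bxy with proj₂ (proj₂ isOvoid) (subspace (x ∷ y ∷ []) ind) (isotropic⇒WLine x∈Π y∈Π ind Bxy)
          ... | p , (_ , c , e) , Op , _ = c zero , c (suc zero) , O-cong (≈-sym (≈-trans e (lc₂ c {x ∷ y ∷ []}))) Op

        opaque
          -- The point of O on the line is not x, so its y-coefficient is nonzero and can be scaled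
          -- to 1.
          meet-affine : ∀ {x y} → InΠ x → InΠ y → LinIndep (x ∷ y ∷ []) → B x y ≡ 0F → ¬ O x → ∃ λ c → O (y +V (c · x))
          meet-affine {x} {y} x∈Π y∈Π ind Bxy ¬Ox with meet x∈Π y∈Π ind Bxy
          ... | α , β , Op with β ≟ 0F
          ...   | yes refl = ⊥-elim (¬Ox (O-same {x} {(α · x) +V (0F · y)} (SamePoint-sym (α , α≢0 , p≈)) Op))
            where
            p≈ : ((α · x) +V (0F · y)) ≈ (α · x)
            p≈ j = solve 3 (λ α x y → α :* x :+ :0 :* y := α :* x) refl α (x j) (y j)
            α≢0 : α ≢ 0F
            α≢0 refl = O-nonzero Op (λ j → solve 2 (λ x y → :0 :* x :+ :0 :* y := :0) refl (x j) (y j))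
          ...   | no β≢0 = β ⁻¹ *F α , O-same (β ⁻¹ , ⁻¹-nonzero β≢0 , λ j → begin
              y j +F (β ⁻¹ *F α) *F x j      ≡⟨ cong (_+F (β ⁻¹ *F α) *F x j) (trans (sym (R.*-identityˡ (y j))) (cong (_*F y j) (sym (⁻¹-inverse β≢0)))) ⟩
              (β *F β ⁻¹) *F y j +F (β ⁻¹ *F α) *F x j ≡⟨ solve 5 (λ α β β' x y → (β :* β') :* y :+ (β' :* α) :* x := β' :* (α :* x :+ β :* y)) refl α β (β ⁻¹) (x j) (y j) ⟩
              β ⁻¹ *F (α *F x j +F β *F y j)      ∎) Op

        opaque
          -- The line ⟨v, g⟩ belongs to W(q) and comes with its point αv + βg of O. If β = 0 that
          -- point is v; if β is nonzero, v on O would be a second point of O on the line.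
          O? : ∀ {v} → InΠ v → NonZero v → Dec (O v)
          O? {v} v∈Π v≢0 = decide (meet (Frame.e∈Π Fr) (Frame.g∈Π Fr) ind (Frame.eg Fr))
            where
            open Σ (pointFrame v∈Π v≢0) renaming (proj₁ to f; proj₂ to Fr)
            open Coordinates Fr
            αv+βg : ∀ α β → ((α · v) +V (β · g)) ≈ vec α 0F β 0F
            αv+βg α β = ≈-trans (+V-cong (·-cong α e≈) (·-cong β g≈)) (≈-trans (vec-combo α β 1F 0F 0F 0F 0F 0F 1F 0F)
              (vec-cong (solve 2 (λ α β → α :* :1 :+ β :* :0 := α) refl α β) (zero-combination α β)
                        (solve 2 (λ α β → α :* :0 :+ β :* :1 := β) refl α β) (zero-combination α β)))
            ind : LinIndep (v ∷ g ∷ [])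
            ind = linIndep₂ λ α β z → let w = vec-≡0 {α} {0F} {β} {0F} (≈-trans (≈-sym (αv+βg α β)) z) in proj₁ w , proj₁ (proj₂ (proj₂ w))
            decide : (∃ λ α → ∃ λ β → O ((α · v) +V (β · g))) → Dec (O v)
            decide (α , β , Op) with β ≟ 0F
            ... | yes refl = yes (O-same {v} {(α · v) +V (0F · g)} (SamePoint-sym (α , α≢0 , λ j → solve 3 (λ α x y → α :* x :+ :0 :* y := α :* x) refl α (v j) (g j))) Op)
              where
              α≢0 : α ≢ 0F
              α≢0 refl = O-nonzero Op (λ j → solve 2 (λ x y → :0 :* x :+ :0 :* y := :0) refl (v j) (g j))
            ... | no β≢0 = no λ Ov → β≢0 (β≡0 (O-perp-same Op Ov (trans (B-combo α β v g v)
                    (trans (cong₂ (λ m n → α *F m +F β *F n) (B-alt v) (trans (B-sym g v) eg)) (zero-combination α β)))))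
              where
              β≡0 : SamePoint ((α · v) +V (β · g)) v → β ≡ 0F
              β≡0 (k , _ , same) = begin
                β      ≡⟨ solve 2 (λ α β → β := α :* :0 :+ β :* :1) refl α β ⟩
                α *F 0F +F β *F 1F      ≡⟨ cong₂ (λ m n → α *F m +F β *F n) (sym eh) (sym gh) ⟩
                α *F B v h +F β *F B g h      ≡⟨ sym (B-combo α β v g h) ⟩
                B ((α · v) +V (β · g)) h      ≡⟨ B-congˡ same ⟩
                B (k · v) h      ≡⟨ trans (B-·ˡ k v h) (cong (k *F_) eh) ⟩
                k *F 0F      ≡⟨ R.zeroʳ k ⟩
                0F      ∎

        -- No three points of O are collinear.

        module FinF² = Finite (×-finite card card)

        -- Suppose e, f and a e + f lie on O.  For all s, t the isotropic line through (t,0,1,0) and (s,1,0,t)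
        -- has a point (s + t c, 1, c, t) on O, and for t ≠ 0 the map (t,s) ↦ (s + t c, c/t) is injective;
        -- it does not take the first coordinates 0 and a, which belong to the points f and a e + f.
        module ThreeOnALine {e f : V} (Fr : Frame e f) (Oe : O e) (Of : O f) (a : F) (a≢0 : a ≢ 0F)
                            (Oa : O (Coordinates.vec Fr a 1F 0F 0F)) where
          open Coordinates Fr

          private
            Of' : O (vec 0F 1F 0F 0F)
            Of' = O-cong (≈-sym f≈) Of

            choose : ∀ t s → ∃ λ c → O (vec (s +F t *F c) 1F c t)
            choose t s = build (meet-affine (vec∈Π t 0F 1F 0F) (vec∈Π s 1F 0F t) ind perp off)
              where
              x y : V
              x = vec t 0F 1F 0F
              y = vec s 1F 0F t
              perp : B x y ≡ 0F
              perp = trans (B-vec t 0F 1F 0F s 1F 0F t) (solve 2 (λ s t → (t :* :1 :+ :0 :* s) :+ (:1 :* t :+ :0 :* :0) := :0) refl s t)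
              combo : ∀ α β → ((α · x) +V (β · y)) ≈ vec (α *F t +F β *F s) (α *F 0F +F β *F 1F) (α *F 1F +F β *F 0F) (α *F 0F +F β *F t)
              combo α β = vec-combo α β t 0F 1F 0F s 1F 0F t
              ind : LinIndep (x ∷ y ∷ [])
              ind = linIndep₂ λ α β z →
                let w = vec-≡0 (≈-trans (≈-sym (combo α β)) z)
                in trans (solve 2 (λ α β → α := α :* :1 :+ β :* :0) refl α β) (proj₁ (proj₂ (proj₂ w))) ,
                   trans (solve 2 (λ α β → β := α :* :0 :+ β :* :1) refl α β) (proj₁ (proj₂ w))
              -- x is orthogonal to the point e of O, so on O it would be a multiple of e; but its
              -- g-coordinate is 1.
              off : ¬ O x
              off Ox with O-perp-same Ox Oe (trans (B-sym x e) (B-e t 0F 1F 0F))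
              ... | k , _ , same = 1≢0 (trans (sym (B-h t 0F 1F 0F)) (trans (B-congʳ same) (trans (B-·ʳ k h e) (trans (cong (k *F_) (trans (B-sym h e) eh)) (R.zeroʳ k)))))
              build : (∃ λ c → O (y +V (c · x))) → ∃ λ c → O (vec (s +F t *F c) 1F c t)
              build (c , Op) = c , O-cong (≈-sym (≈-trans (λ j → solve 3 (λ c x y → y :+ c :* x := c :* x :+ :1 :* y) refl c (x j) (y j)) (≈-trans (combo c 1F)
                (vec-cong (solve 3 (λ c s t → c :* t :+ :1 :* s := s :+ t :* c) refl c s t) (solve 1 (λ c → c :* :0 :+ :1 :* :1 := :1) refl c)
                          (solve 1 (λ c → c :* :1 :+ :1 :* :0 := c) refl c) (solve 2 (λ c t → c :* :0 :+ :1 :* t := t) refl c t))))) Op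

            -- With second coordinates 1 and equal first coordinates, the condition on x₂, x₃, y₂,
            -- y₃ is exactly orthogonality; orthogonal points of O coincide, and the coordinate 1
            -- fixes the scalar.
            affine-same : ∀ {x₀ x₂ x₃ y₀ y₂ y₃} → O (vec x₀ 1F x₂ x₃) → O (vec y₀ 1F y₂ y₃) →
                          x₀ ≡ y₀ → x₂ *F y₃ ≡ x₃ *F y₂ → x₂ ≡ y₂ × x₃ ≡ y₃
            affine-same {x₀} {x₂} {x₃} {y₀} {y₂} {y₃} Ox Oy refl eq = go (O-perp-same Ox Oy (begin
              B (vec x₀ 1F x₂ x₃) (vec x₀ 1F y₂ y₃)      ≡⟨ B-vec x₀ 1F x₂ x₃ x₀ 1F y₂ y₃ ⟩
              (x₀ *F 1F +F 1F *F x₀) +F (x₂ *F y₃ +F x₃ *F y₂)     ≡⟨ cong₂ _+F_ (solve 1 (λ a → a :* :1 :+ :1 :* a := :0) refl x₀) (≡⇒+≡0 eq) ⟩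
              0F +F 0F      ≡⟨ R.+-identityˡ 0F ⟩
              0F      ∎))
              where
              go : SamePoint (vec x₀ 1F x₂ x₃) (vec x₀ 1F y₂ y₃) → x₂ ≡ y₂ × x₃ ≡ y₃
              go (k , _ , same) = trans (proj₁ (proj₂ (proj₂ w))) (one y₂) , trans (proj₂ (proj₂ (proj₂ w))) (one y₃)
                where
                w = vec-injective (≈-trans same (≈-trans (λ j → solve 2 (λ k x → k :* x := k :* x :+ :0 :* x) refl k (vec x₀ 1F y₂ y₃ j))
                      (vec-combo k 0F x₀ 1F y₂ y₃ x₀ 1F y₂ y₃)))
                k≡1 : k ≡ 1F
                k≡1 = sym (trans (proj₁ (proj₂ w)) (solve 1 (λ k → k :* :1 :+ :0 :* :1 := k) refl k))
                one : ∀ x → k *F x +F 0F *F x ≡ x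
                one x = trans (cong (λ k → k *F x +F 0F *F x) k≡1) (solve 1 (λ x → :1 :* x :+ :0 :* x := x) refl x)

            c : F → F → F
            c t s = proj₁ (choose t s)

            φ : F × F → F × F
            φ (t , s) with t ≟ 0F
            -- For nonzero t the first coordinate is never 0, because f is on O. The pairs (0, s)
            -- are therefore free to serve as the images for t = 0, which makes φ an injective
            -- self-map.
            ... | yes _ = 0F , s
            ... | no _  = s +F t *F c t s , c t s *F t ⁻¹

            first≢ : ∀ b → O (vec b 1F 0F 0F) → ∀ t s → t ≢ 0F → s +F t *F c t s ≢ b
            first≢ b Ob t s t≢0 eq = t≢0 (proj₂ (affine-same (proj₂ (choose t s)) Ob eq (solve 2 (λ c t → c :* :0 := t :* :0) refl (c t s) t)))

            φ-injective : ∀ {x y} → φ x ≡ φ y → x ≡ y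
            φ-injective {t , s} {t' , s'} eq with t ≟ 0F | t' ≟ 0F
            ... | yes refl | yes refl = cong (0F ,_) (cong proj₂ eq)
            ... | yes refl | no t'≢0  = ⊥-elim (first≢ 0F Of' t' s' t'≢0 (sym (cong proj₁ eq)))
            ... | no t≢0   | yes refl = ⊥-elim (first≢ 0F Of' t s t≢0 (cong proj₁ eq))
            ... | no t≢0   | no t'≢0  = cong₂ _,_ (proj₂ same) s≡s'
              where
              ratio : c t s *F t' ≡ t *F c t' s'
              ratio = begin
                c t s *F t'      ≡⟨ trans (sym (R.*-identityʳ _)) (cong (c t s *F t' *F_) (sym (⁻¹-inverse t≢0))) ⟩
                (c t s *F t') *F (t *F t ⁻¹)      ≡⟨ solve 4 (λ c t t⁻ u → (c :* u) :* (t :* t⁻) := (t :* u) :* (c :* t⁻)) refl (c t s) t (t ⁻¹) t' ⟩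
                (t *F t') *F (c t s *F t ⁻¹)      ≡⟨ cong ((t *F t') *F_) (cong proj₂ eq) ⟩
                (t *F t') *F (c t' s' *F t' ⁻¹)      ≡⟨ solve 4 (λ c t u u⁻ → (t :* u) :* (c :* u⁻) := (t :* c) :* (u :* u⁻)) refl (c t' s') t t' (t' ⁻¹) ⟩
                (t *F c t' s') *F (t' *F t' ⁻¹)      ≡⟨ trans (cong (t *F c t' s' *F_) (⁻¹-inverse t'≢0)) (R.*-identityʳ _) ⟩
                t *F c t' s'      ∎
              same : c t s ≡ c t' s' × t ≡ t'
              same = affine-same (proj₂ (choose t s)) (proj₂ (choose t' s')) (cong proj₁ eq) ratio
              s≡s' : s ≡ s'
              s≡s' = begin
                s      ≡⟨ solve 2 (λ s m → s := (s :+ m) :+ m) refl s (t *F c t s) ⟩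
                (s +F t *F c t s) +F t *F c t s      ≡⟨ cong₂ _+F_ (cong proj₁ eq) (cong₂ _*F_ (proj₂ same) (proj₁ same)) ⟩
                (s' +F t' *F c t' s') +F t' *F c t' s'      ≡⟨ solve 2 (λ s m → (s :+ m) :+ m := s) refl s' (t' *F c t' s') ⟩
                s'      ∎

            missed : ∀ x → φ x ≢ (a , 0F)
            missed (t , s) eq with t ≟ 0F
            ... | yes _  = a≢0 (sym (cong proj₁ eq))
            ... | no t≢0 = first≢ a Oa t s t≢0 (cong proj₁ eq)

          impossible : ⊥
          impossible with FinF².injective⇒surjective φ φ-injective (a , 0F)
          ... | x , eq = missed x eq

        opaque
          -- Distinct points of O are not orthogonal, so they can be scaled to a hyperbolic pair and
          -- completed to a frame.
          no-three-collinear : ∀ {x y α β} → O x → O y → ¬ SamePoint x y → α ≢ 0F → β ≢ 0F → ¬ O ((α · x) +V (β · y))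
          no-three-collinear {x} {y} {α} {β} Ox Oy distinct α≢0 β≢0 Oz with B x y ≟ 0F
          ... | yes b≡0 = distinct (O-perp-same Ox Oy b≡0)
          ... | no b≢0 = ThreeOnALine.impossible Fr Ox (O-same {y'} {y} (b⁻ , ⁻¹-nonzero b≢0 , λ _ → refl) Oy) a
                           (*-nonzero α≢0 (⁻¹-nonzero βb≢0)) (O-same {vec a 1F 0F 0F} ((β *F b) ⁻¹ , ⁻¹-nonzero βb≢0 , same) Oz)
            where
            b b⁻ a : F
            b = B x y
            b⁻ = b ⁻¹
            βb≢0 : β *F b ≢ 0F
            βb≢0 = *-nonzero β≢0 b≢0
            -- In terms of x and y' = y/b the third point is αx + βb y'; division by βb brings it to
            -- the form a x + y'.
            a = α *F (β *F b) ⁻¹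
            y' : V
            y' = b⁻ · y
            Fr : Frame x y'
            Fr = pairFrame (O∈Π Ox) (Π-· b⁻ (O∈Π Oy)) (trans (B-·ʳ b⁻ x y) (trans (R.*-comm _ _) (⁻¹-inverse b≢0)))
            open Coordinates Fr
            same : ∀ j → vec a 1F 0F 0F j ≡ (β *F b) ⁻¹ *F (α *F x j +F β *F y j)
            same j = begin
              vec a 1F 0F 0F j
                ≡⟨ vec-cong (solve 1 (λ a → a := a :* :1 :+ :1 :* :0) refl a) (solve 1 (λ a → :1 := a :* :0 :+ :1 :* :1) refl a)
                            (solve 1 (λ a → :0 := a :* :0 :+ :1 :* :0) refl a) (solve 1 (λ a → :0 := a :* :0 :+ :1 :* :0) refl a) j ⟩
              vec (a *F 1F +F 1F *F 0F) (a *F 0F +F 1F *F 1F) (a *F 0F +F 1F *F 0F) (a *F 0F +F 1F *F 0F) j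
                ≡⟨ sym (vec-combo a 1F 1F 0F 0F 0F 0F 1F 0F 0F j) ⟩
              a *F vec 1F 0F 0F 0F j +F 1F *F vec 0F 1F 0F 0F j
                ≡⟨ cong₂ (λ m n → a *F m +F 1F *F n) (sym (e≈ j)) (sym (f≈ j)) ⟩
              a *F x j +F 1F *F (b⁻ *F y j)
                ≡⟨ cong (λ m → a *F x j +F m *F (b⁻ *F y j)) (sym (⁻¹-inverse βb≢0)) ⟩
              a *F x j +F ((β *F b) *F (β *F b) ⁻¹) *F (b⁻ *F y j)
                ≡⟨ solve 7 (λ α β b b⁻ i x y → (α :* i) :* x :+ ((β :* b) :* i) :* (b⁻ :* y) := i :* (α :* x :+ (b :* b⁻) :* (β :* y)))
                     refl α β b b⁻ ((β *F b) ⁻¹) (x j) (y j) ⟩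
              (β *F b) ⁻¹ *F (α *F x j +F (b *F b⁻) *F (β *F y j))
                ≡⟨ cong (λ m → (β *F b) ⁻¹ *F (α *F x j +F m)) (trans (cong (_*F (β *F y j)) (⁻¹-inverse b≢0)) (R.*-identityˡ _)) ⟩
              (β *F b) ⁻¹ *F (α *F x j +F β *F y j) ∎

        O-distinct-indep : ∀ {x y z} → O x → O y → O z → ¬ SamePoint x y → ¬ SamePoint y z → ¬ SamePoint x z → LinIndep (triple x y z)
        O-distinct-indep {x} {y} {z} Ox Oy Oz x≁y y≁z x≁z c eq = all0
          where
          a b d : F
          a = c zero
          b = c (suc zero)
          d = c (suc (suc zero))
          xy : LinIndep (x ∷ y ∷ [])
          xy = distinct-indep (O-nonzero Ox) (O-nonzero Oy) x≁y
          yz : LinIndep (y ∷ z ∷ [])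
          yz = distinct-indep (O-nonzero Oy) (O-nonzero Oz) y≁z
          xz : LinIndep (x ∷ z ∷ [])
          xz = distinct-indep (O-nonzero Ox) (O-nonzero Oz) x≁z
          d≡0 : d ≡ 0F
          d≡0 with d ≟ 0F | a ≟ 0F | b ≟ 0F
          ... | yes p  | _      | _      = p
          ... | no _   | yes p  | _      = yz (b ∷ d ∷ []) (λ j → trans (trans (solve 3 (λ x m n → m :+ n := :0 :* x :+ (m :+ n)) refl (x j) (b *F y j) (d *F z j +F 0F))
                                             (cong (λ t → t *F x j +F (b *F y j +F (d *F z j +F 0F))) (sym p))) (eq j)) (suc zero)
          ... | no _   | no _   | yes p  = xz (a ∷ d ∷ []) (λ j → trans (trans (solve 3 (λ y m n → m :+ n := m :+ (:0 :* y :+ n)) refl (y j) (a *F x j) (d *F z j +F 0F))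
                                             (cong (λ t → a *F x j +F (t *F y j +F (d *F z j +F 0F))) (sym p))) (eq j)) (suc zero)
          ... | no d≢0 | no a≢0 | no b≢0 = ⊥-elim (no-three-collinear Ox Oy x≁y a≢0 b≢0 (O-same {(a · x) +V (b · y)} {z} (d , d≢0 , λ j →
                  +≡0⇒≡ (trans (solve 3 (λ m n k → (m :+ n) :+ k := m :+ (n :+ (k :+ :0))) refl (a *F x j) (b *F y j) (d *F z j)) (eq j))) Oz))
          rest : ∀ i → (a ∷ b ∷ []) i ≡ 0F
          rest = xy (a ∷ b ∷ []) (λ j → trans (trans (solve 3 (λ m n z → m :+ (n :+ :0) := m :+ (n :+ (:0 :* z :+ :0))) refl (a *F x j) (b *F y j) (z j))
                   (cong (λ t → a *F x j +F (b *F y j +F (t *F z j +F 0F))) (sym d≡0))) (eq j))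
          all0 : ∀ i → c i ≡ 0F
          all0 zero             = rest zero
          all0 (suc zero)       = rest (suc zero)
          all0 (suc (suc zero)) = d≡0

        opaque
          nucleus-line-point : ∀ {z o y} → InΠ z → InΠ y → B z o ≡ 0F → B z y ≡ 0F → LinIndep (triple z o y) → ¬ O z → O o →
                               ∀ t → ∃ λ c → O ((y +V (t · o)) +V (c · z))
          nucleus-line-point {z} {o} {y} z∈Π y∈Π z⊥o z⊥y ind ¬Oz Oo t = meet-affine z∈Π (Π-+ y∈Π (Π-· t (O∈Π Oo))) (linIndep₂ λ α β eq →
              let w = ind (α ∷ β *F t ∷ β ∷ []) (λ j → trans
                        (solve 6 (λ α β t z o y → α :* z :+ ((β :* t) :* o :+ (β :* y :+ :0)) := α :* z :+ β :* (y :+ t :* o)) refl α β t (z j) (o j) (y j)) (eq j))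
              in w zero , w (suc (suc zero)))
            (trans (B-+ʳ z y (t · o)) (trans (cong₂ _+F_ z⊥y (trans (B-·ʳ t z o) (cong (t *F_) z⊥o))) (solve 1 (λ t → :0 :+ t :* :0 := :0) refl t))) ¬Oz

        -- In the plane z^⊥ the lines through the nucleus z and the points y + t o of a line through o meet O
        -- in points y + t o + c(t) z; t ↦ c(t) is injective since O has no three collinear points, hence 0 is a value.
        opaque
          second-point : ∀ {z o y} → InΠ z → InΠ y → B z o ≡ 0F → B z y ≡ 0F → LinIndep (triple z o y) → ¬ O z → O o →
                         ∃ λ t → O (y +V (t · o))
          second-point {z} {o} {y} z∈Π y∈Π z⊥o z⊥y ind ¬Oz Oo = finish (FinF.injective⇒surjective c c-injective 0F)
            where
            ind₃ : ∀ α β γ → ((α · z) +V ((β · o) +V (γ · y))) ≈ 0V → α ≡ 0F × β ≡ 0F × γ ≡ 0F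
            ind₃ α β γ eq = p zero , p (suc zero) , p (suc (suc zero))
              where
              p : ∀ i → (α ∷ β ∷ γ ∷ []) i ≡ 0F
              p = ind (α ∷ β ∷ γ ∷ []) (λ j → trans (solve 3 (λ m n k → m :+ (n :+ (k :+ :0)) := m :+ (n :+ k)) refl (α *F z j) (β *F o j) (γ *F y j)) (eq j))
            u : F → V
            u t = y +V (t · o)
            point : ∀ t → ∃ λ c → O (u t +V (c · z))
            point = nucleus-line-point z∈Π y∈Π z⊥o z⊥y ind ¬Oz Oo
            c : F → F
            c t = proj₁ (point t)
            c-injective : ∀ {t t'} → c t ≡ c t' → t ≡ t'
            c-injective {t} {t'} c≡ with t +F t' ≟ 0F
            ... | yes p = +≡0⇒≡ p
            ... | no d≢0 = ⊥-elim (no-three-collinear (proj₂ (point t)) (proj₂ (point t')) distinct d⁻≢0 d⁻≢0 (O-cong third Oo))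
              where
              d⁻ : F
              d⁻ = (t +F t') ⁻¹
              d⁻≢0 : d⁻ ≢ 0F
              d⁻≢0 = ⁻¹-nonzero d≢0
              distinct : ¬ SamePoint (u t +V (c t · z)) (u t' +V (c t' · z))
              distinct (k , _ , same) = d≢0 (trans (cong (λ m → t +F m) (trans (sym (R.*-identityˡ t')) (cong (_*F t') (sym k≡1)))) (proj₁ (proj₂ w)))
                where
                w : c t +F k *F c t' ≡ 0F × t +F k *F t' ≡ 0F × 1F +F k ≡ 0F
                w = ind₃ (c t +F k *F c t') (t +F k *F t') (1F +F k) (λ j → trans
                  (solve 8 (λ c c' t t' k z o y → (c :+ k :* c') :* z :+ ((t :+ k :* t') :* o :+ (:1 :+ k) :* y) := ((y :+ t :* o) :+ c :* z) :+ k :* ((y :+ t' :* o) :+ c' :* z))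
                     refl (c t) (c t') t t' k (z j) (o j) (y j)) (≡⇒+≡0 (same j)))
                k≡1 : k ≡ 1F
                k≡1 = sym (+≡0⇒≡ (proj₂ (proj₂ w)))
              -- For equal values of c the sum of the two points is (t + t') o, so o would be a
              -- third point of O on their line.
              third : ((d⁻ · (u t +V (c t · z))) +V (d⁻ · (u t' +V (c t' · z)))) ≈ o
              third j = begin
                d⁻ *F ((y j +F t *F o j) +F c t *F z j) +F d⁻ *F ((y j +F t' *F o j) +F c t' *F z j)
                  ≡⟨ cong (λ m → d⁻ *F ((y j +F t *F o j) +F m *F z j) +F d⁻ *F ((y j +F t' *F o j) +F c t' *F z j)) c≡ ⟩
                d⁻ *F ((y j +F t *F o j) +F c t' *F z j) +F d⁻ *F ((y j +F t' *F o j) +F c t' *F z j)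
                  ≡⟨ solve 7 (λ d y t t' o c z → d :* ((y :+ t :* o) :+ c :* z) :+ d :* ((y :+ t' :* o) :+ c :* z) := ((t :+ t') :* d) :* o) refl d⁻ (y j) t t' (o j) (c t') (z j) ⟩
                ((t +F t') *F d⁻) *F o j
                  ≡⟨ trans (cong (_*F o j) (⁻¹-inverse d≢0)) (R.*-identityˡ _) ⟩
                o j ∎
            finish : (∃ λ t → c t ≡ 0F) → ∃ λ t → O (u t)
            finish (t , c≡0) = t , O-cong (λ j → trans (solve 2 (λ m z → m := m :+ :0 :* z) refl (u t j) (z j)) (cong (λ k → u t j +F k *F z j) (sym c≡0))) (proj₂ (point t))

        -- The ovoid meets the elliptic quadric: a parity argument.

        F⁴ : Set
        F⁴ = F × F × F × F

        module FinF⁴ = Finite (×-finite card (×-finite card (×-finite card card)))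

        module _ {e f : V} (Fr : Frame e f) where
          open Coordinates Fr

          opaque
            -- The lines of W(q) through e are exactly those joining e to a point of ⟨g, h⟩.
            frame-line-indep : ∀ β γ → ¬ (β ≡ 0F × γ ≡ 0F) → LinIndep (e ∷ vec 0F 0F β γ ∷ [])
            frame-line-indep β γ nt = linIndep₂ λ λ₁ λ₂ z → let
                w = vec-≡0 {λ₁ *F 1F +F λ₂ *F 0F} {λ₁ *F 0F +F λ₂ *F 0F} {λ₁ *F 0F +F λ₂ *F β} {λ₁ *F 0F +F λ₂ *F γ}
                      (≈-trans (≈-sym (≈-trans (+V-cong (·-cong λ₁ e≈) ≈-refl) (vec-combo λ₁ λ₂ 1F 0F 0F 0F 0F 0F β γ))) z)
              in trans (solve 2 (λ a b → a := a :* :1 :+ b :* :0) refl λ₁ λ₂) (proj₁ w) ,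
                 scalar-zero λ₂ (trans (solve 3 (λ a b c → b :* c := a :* :0 :+ b :* c) refl λ₁ λ₂ β) (proj₁ (proj₂ (proj₂ w))))
                                (trans (solve 3 (λ a b c → b :* c := a :* :0 :+ b :* c) refl λ₁ λ₂ γ) (proj₂ (proj₂ (proj₂ w))))
              where
              scalar-zero : ∀ k → k *F β ≡ 0F → k *F γ ≡ 0F → k ≡ 0F
              scalar-zero k p r with k ≟ 0F
              ... | yes z = z
              ... | no nz = ⊥-elim (nt (*-cancel-nonzero nz p , *-cancel-nonzero nz r))

        opaque
          singular-on-line : ∀ {x y} → InΠ x → InΠ y → LinIndep (x ∷ y ∷ []) → B x y ≡ 0F → ∃ λ α → ∃ λ β → OnQ ((α · x) +V (β · y))
          singular-on-line {x} {y} x∈Π y∈Π ind Bxy = go (proj₂ (isotropic⇒WLine x∈Π y∈Π ind Bxy))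
            where
            go : MeetsInOnePoint InE (subspace (x ∷ y ∷ []) ind) → ∃ λ α → ∃ λ β → OnQ ((α · x) +V (β · y))
            go (p , (p≢0 , c , e) , (_ , Qp) , _) = c zero , c (suc zero) ,
              (λ z → p≢0 (≈-trans p≈ z)) , trans (Q-cong (≈-sym p≈)) Qp
              where
              p≈ : p ≈ ((c zero · x) +V (c (suc zero) · y))
              p≈ = ≈-trans e (lc₂ c {x ∷ y ∷ []})

          singular-frame : ∃ λ e → ∃ λ f → Frame e f × Qf e ≡ 0F × Qf f ≡ 0F
          singular-frame = from-point (singular-on-line e∈Π (vec∈Π 0F 0F 1F 0F) (frame-line-indep F₀ 1F 0F (λ (p , _) → 1≢0 p))
                                        (B-e 0F 0F 1F 0F))
            where
            F₀ : Frame (P zero) (proj₁ baseFrame)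
            F₀ = proj₂ baseFrame
            open Coordinates F₀
            from-point : (∃ λ α → ∃ λ β → OnQ ((α · P zero) +V (β · vec 0F 0F 1F 0F))) → ∃ λ e → ∃ λ f → Frame e f × Qf e ≡ 0F × Qf f ≡ 0F
            from-point (α , β , p≢0 , Qp) = p , f' , pairFrame p∈Π (Π-+ (Frame.f∈Π (proj₂ Fr)) (Π-· (Qf f₁) p∈Π)) Bpf' , Qp , Qf'
              where
              p f₁ f' : V
              p = (α · P zero) +V (β · vec 0F 0F 1F 0F)
              p∈Π : InΠ p
              p∈Π = Π-+ (Π-· α e∈Π) (Π-· β (vec∈Π 0F 0F 1F 0F))
              Fr : ∃ (Frame p)
              Fr = pointFrame p∈Π p≢0
              f₁ = proj₁ Fr
              -- The added multiple of the singular vector p keeps the pairing with p equal to 1 and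
              -- cancels Q(f₁).
              f' = f₁ +V (Qf f₁ · p)
              Bpf' : B p f' ≡ 1F
              Bpf' = trans (B-+ʳ p f₁ (Qf f₁ · p)) (trans (cong₂ _+F_ (Frame.ef (proj₂ Fr)) (trans (B-·ʳ (Qf f₁) p p) (cong (Qf f₁ *F_) (B-alt p))))
                       (solve 1 (λ a → :1 :+ a :* :0 := :1) refl (Qf f₁)))
              Qf' : Qf f' ≡ 0F
              Qf' = begin
                Qf f'      ≡⟨ Q-+ f₁ (Qf f₁ · p) ⟩
                (Qf f₁ +F Qf (Qf f₁ · p)) +F B f₁ (Qf f₁ · p)      ≡⟨ cong₂ (λ m n → (Qf f₁ +F m) +F n) (trans (Q-· (Qf f₁) p) (cong ((Qf f₁ *F Qf f₁) *F_) Qp))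
                                                                                    (trans (B-·ʳ (Qf f₁) f₁ p) (cong (Qf f₁ *F_) (trans (B-sym f₁ p) (Frame.ef (proj₂ Fr))))) ⟩
                (Qf f₁ +F (Qf f₁ *F Qf f₁) *F 0F) +F Qf f₁ *F 1F      ≡⟨ solve 1 (λ a → (a :+ (a :* a) :* :0) :+ a :* :1 := :0) refl (Qf f₁) ⟩
                0F      ∎

        -- With Q = x₀x₁ + ε x₂² + x₂x₃ + d x₃², the matrix A below satisfies B(x, A x) = Q(x), and det (A + s) is
        -- k² + ε d k + h for k = s² + s and h = d p; p is chosen so that this never vanishes.
        -- For e on Q the line ⟨e, A e⟩ is isotropic.  If O had no point on Q, it would contain (A + s) e for a unique s,
        -- and e ↦ (A + s)(A + s + 1)⁻¹ e would be a fixed-point free involution (with s ↦ s + 1) of the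
        -- nonzero singular vectors, whose number is odd.
        module Parity {e f : V} (Fr : Frame e f) (Qe : Qf e ≡ 0F) (Qf≡0 : Qf f ≡ 0F) (disjoint : ∀ v → O v → Qf v ≢ 0F) where
          open Coordinates Fr

          private
            ε d : F
            ε = Qf g
            d = Qf h

            -- h is orthogonal to e, so a singular h would put the line ⟨e, h⟩ on the elliptic
            -- quadric.
            d≢0 : d ≢ 0F
            d≢0 d≡0 = no-singular-line e∈Π (vec∈Π 0F 0F 0F 1F) (frame-line-indep Fr 0F 1F (λ (_ , p) → 1≢0 p)) Qe
                        (trans (Q-cong (≈-sym h≈)) d≡0) (B-e 0F 0F 0F 1F)

            W : F⁴ → V
            W (x₀ , x₁ , x₂ , x₃) = vec x₀ x₁ x₂ x₃

            Q-W : ∀ x₀ x₁ x₂ x₃ → Qf (vec x₀ x₁ x₂ x₃) ≡ x₀ *F x₁ +F ((x₂ *F x₂) *F ε +F ((x₃ *F x₃) *F d +F x₂ *F x₃))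
            Q-W x₀ x₁ x₂ x₃ = begin
              Qf (vec x₀ x₁ x₂ x₃)      ≡⟨ Q-cong split ⟩
              Qf (u +V v)      ≡⟨ Q-+ u v ⟩
              (Qf u +F Qf v) +F B u v      ≡⟨ cong₂ _+F_ (cong₂ _+F_ (Q-combo x₀ x₁ e f) (Q-combo x₂ x₃ g h)) Buv ⟩
              ((((x₀ *F x₀) *F Qf e +F (x₁ *F x₁) *F Qf f) +F (x₀ *F x₁) *F B e f) +F (((x₂ *F x₂) *F ε +F (x₃ *F x₃) *F d) +F (x₂ *F x₃) *F B g h)) +F 0F
                ≡⟨ cong₂ (λ m n → (m +F (((x₂ *F x₂) *F ε +F (x₃ *F x₃) *F d) +F (x₂ *F x₃) *F n)) +F 0F)
                     (cong₂ _+F_ (cong₂ (λ m n → (x₀ *F x₀) *F m +F (x₁ *F x₁) *F n) Qe Qf≡0) (cong ((x₀ *F x₁) *F_) ef)) gh ⟩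
              ((((x₀ *F x₀) *F 0F +F (x₁ *F x₁) *F 0F) +F (x₀ *F x₁) *F 1F) +F (((x₂ *F x₂) *F ε +F (x₃ *F x₃) *F d) +F (x₂ *F x₃) *F 1F)) +F 0F
                ≡⟨ solve 6 (λ a b c m n k → (((a :* :0 :+ b :* :0) :+ c :* :1) :+ ((m :+ n) :+ k :* :1)) :+ :0 := c :+ (m :+ (n :+ k))) refl
                     (x₀ *F x₀) (x₁ *F x₁) (x₀ *F x₁) ((x₂ *F x₂) *F ε) ((x₃ *F x₃) *F d) (x₂ *F x₃) ⟩
              x₀ *F x₁ +F ((x₂ *F x₂) *F ε +F ((x₃ *F x₃) *F d +F x₂ *F x₃)) ∎
              where
              u v : V
              u = (x₀ · e) +V (x₁ · f)
              v = (x₂ · g) +V (x₃ · h)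
              split : vec x₀ x₁ x₂ x₃ ≈ (u +V v)
              split = ≈-trans (vec-lc x₀ x₁ x₂ x₃) (λ j → solve 4 (λ a b c d → a :+ (b :+ (c :+ (d :+ :0))) := (a :+ b) :+ (c :+ d)) refl _ _ _ _)
              Buv : B u v ≡ 0F
              Buv = trans (B-combo x₀ x₁ e f v) (trans (cong₂ (λ m n → x₀ *F m +F x₁ *F n)
                (trans (B-sym e v) (trans (B-combo x₂ x₃ g h e) (cong₂ (λ m n → x₂ *F m +F x₃ *F n) (trans (B-sym g e) eg) (trans (B-sym h e) eh))))
                (trans (B-sym f v) (trans (B-combo x₂ x₃ g h f) (cong₂ (λ m n → x₂ *F m +F x₃ *F n) (trans (B-sym g f) fg) (trans (B-sym h f) fh)))))
                (solve 4 (λ a b c d → a :* (c :* :0 :+ d :* :0) :+ b :* (c :* :0 :+ d :* :0) := :0) refl x₀ x₁ x₂ x₃))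

            infixl 6 _⊕_
            _⊕_ : F⁴ → F⁴ → F⁴
            (x₀ , x₁ , x₂ , x₃) ⊕ (y₀ , y₁ , y₂ , y₃) = x₀ +F y₀ , x₁ +F y₁ , x₂ +F y₂ , x₃ +F y₃

            0⁴ : F⁴
            0⁴ = 0F , 0F , 0F , 0F

            tuple : ∀ {x₀ x₁ x₂ x₃ y₀ y₁ y₂ y₃ : F} → x₀ ≡ y₀ → x₁ ≡ y₁ → x₂ ≡ y₂ → x₃ ≡ y₃ → (x₀ , x₁ , x₂ , x₃) ≡ (y₀ , y₁ , y₂ , y₃)
            tuple refl refl refl refl = refl

            W-⊕ : ∀ x y → W (x ⊕ y) ≈ (W x +V W y)
            W-⊕ (x₀ , x₁ , x₂ , x₃) (y₀ , y₁ , y₂ , y₃) = ≈-trans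
              (vec-cong (one x₀ y₀) (one x₁ y₁) (one x₂ y₂) (one x₃ y₃))
              (≈-trans (≈-sym (vec-combo 1F 1F x₀ x₁ x₂ x₃ y₀ y₁ y₂ y₃)) (λ j → sym (one _ _)))
              where
              one : ∀ x y → x +F y ≡ 1F *F x +F 1F *F y
              one = solve 2 (λ x y → x :+ y := :1 :* x :+ :1 :* y) refl

            W-zero : ∀ x → W x ≈ 0V → x ≡ 0⁴
            W-zero (x₀ , x₁ , x₂ , x₃) z with vec-≡0 z
            ... | p₀ , p₁ , p₂ , p₃ = tuple p₀ p₁ p₂ p₃

            charpoly : F → F
            charpoly s = (s *F s +F s) *F (s *F s +F s) +F (ε *F d) *F (s *F s +F s)

            -- `charpoly` vanishes at both 0 and 1, so it is not injective and omits some value.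
            missing : ∃ λ h → ∀ s → charpoly s ≢ h
            missing = FinF.missed-value charpoly 0≢1 (solve 1 (λ c →
              (:0 :* :0 :+ :0) :* (:0 :* :0 :+ :0) :+ c :* (:0 :* :0 :+ :0) := (:1 :* :1 :+ :1) :* (:1 :* :1 :+ :1) :+ c :* (:1 :* :1 :+ :1)) refl (ε *F d))

            opaque
              p : F
              p = d ⁻¹ *F proj₁ missing

              charpoly-nonzero : ∀ s → charpoly s +F d *F p ≢ 0F
              charpoly-nonzero s eq = proj₂ missing s (trans (+≡0⇒≡ eq) (trans (sym (R.*-assoc _ _ _)) (trans (cong (_*F proj₁ missing) (⁻¹-inverse d≢0)) (R.*-identityˡ _))))

            A : F → F⁴ → F⁴
            A s (x₀ , x₁ , x₂ , x₃) = (s +F 1F) *F x₀ +F x₂ , s *F x₁ +F (p *F x₂ +F x₃) , x₀ +F ((s +F 1F) *F x₂ +F d *F x₃) , p *F x₀ +F (x₁ +F (ε *F x₂ +F s *F x₃))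

            A-⊕ : ∀ s x y → A s (x ⊕ y) ≡ A s x ⊕ A s y
            A-⊕ s (x₀ , x₁ , x₂ , x₃) (y₀ , y₁ , y₂ , y₃) = tuple
              (solve 5 (λ s x₀ x₂ y₀ y₂ → s :* (x₀ :+ y₀) :+ (x₂ :+ y₂) := (s :* x₀ :+ x₂) :+ (s :* y₀ :+ y₂)) refl (s +F 1F) x₀ x₂ y₀ y₂)
              (solve 8 (λ s p x₁ x₂ x₃ y₁ y₂ y₃ → s :* (x₁ :+ y₁) :+ (p :* (x₂ :+ y₂) :+ (x₃ :+ y₃)) := (s :* x₁ :+ (p :* x₂ :+ x₃)) :+ (s :* y₁ :+ (p :* y₂ :+ y₃))) refl s p x₁ x₂ x₃ y₁ y₂ y₃)
              (solve 8 (λ s d x₀ x₂ x₃ y₀ y₂ y₃ → (x₀ :+ y₀) :+ (s :* (x₂ :+ y₂) :+ d :* (x₃ :+ y₃)) := (x₀ :+ (s :* x₂ :+ d :* x₃)) :+ (y₀ :+ (s :* y₂ :+ d :* y₃))) refl (s +F 1F) d x₀ x₂ x₃ y₀ y₂ y₃)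
              (trans (cong₂ (λ m n → m +F ((x₁ +F y₁) +F n)) (R.distribˡ p x₀ y₀) (cong₂ _+F_ (R.distribˡ ε x₂ y₂) (R.distribˡ s x₃ y₃)))
                (solve 8 (λ a a' b b' c c' m m' → (a :+ a') :+ ((b :+ b') :+ ((c :+ c') :+ (m :+ m'))) := (a :+ (b :+ (c :+ m))) :+ (a' :+ (b' :+ (c' :+ m')))) refl
                  (p *F x₀) (p *F y₀) x₁ y₁ (ε *F x₂) (ε *F y₂) (s *F x₃) (s *F y₃)))

            A-suc : ∀ s x → A (s +F 1F) x ≡ A s x ⊕ x
            A-suc s (x₀ , x₁ , x₂ , x₃) = tuple
              (solve 3 (λ s x y → ((s :+ :1) :+ :1) :* x :+ y := ((s :+ :1) :* x :+ y) :+ x) refl s x₀ x₂)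
              (solve 3 (λ s x y → (s :+ :1) :* x :+ y := (s :* x :+ y) :+ x) refl s x₁ (p *F x₂ +F x₃))
              (solve 4 (λ s x y m → x :+ (((s :+ :1) :+ :1) :* y :+ m) := (x :+ ((s :+ :1) :* y :+ m)) :+ y) refl s x₀ x₂ (d *F x₃))
              (solve 5 (λ s x m n k → m :+ (n :+ (k :+ (s :+ :1) :* x)) := (m :+ (n :+ (k :+ s :* x))) :+ x) refl s x₃ (p *F x₀) x₁ (ε *F x₂))

            ⊕-self : ∀ x → x ⊕ x ≡ 0⁴
            ⊕-self (x₀ , x₁ , x₂ , x₃) = tuple (x+x x₀) (x+x x₁) (x+x x₂) (x+x x₃)

            ⊕-zero : ∀ x y → x ⊕ y ≡ 0⁴ → x ≡ y
            ⊕-zero (x₀ , x₁ , x₂ , x₃) (y₀ , y₁ , y₂ , y₃) eq =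
              tuple (+≡0⇒≡ (cong proj₁ eq)) (+≡0⇒≡ (cong (λ x → proj₁ (proj₂ x)) eq)) (+≡0⇒≡ (cong (λ x → proj₁ (proj₂ (proj₂ x))) eq)) (+≡0⇒≡ (cong (λ x → proj₂ (proj₂ (proj₂ x))) eq))

            -- The first two equations eliminate x₂ and x₃. Then (s + 1)^2 times the third plus d s
            -- times the fourth reads (`charpoly s` + d p) x₀ = 0, and p was chosen to make that
            -- factor nonzero. With x₀ = 0 the third equation gives s x₁ = 0 and the fourth gives x₁
            -- = 0.
            A-kernel : ∀ s x → A s x ≡ 0⁴ → x ≡ 0⁴
            A-kernel s (x₀ , x₁ , x₂ , x₃) eq = go x₂ x₃
              (sym (+≡0⇒≡ (cong proj₁ eq)))
              (sym (+≡0⇒≡ (trans (solve 3 (λ a b c → (a :+ b) :+ c := a :+ (b :+ c)) refl (s *F x₁) (p *F x₂) x₃) (cong (λ x → proj₁ (proj₂ x)) eq))))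
              (cong (λ x → proj₁ (proj₂ (proj₂ x))) eq) (cong (λ x → proj₂ (proj₂ (proj₂ x))) eq)
              where
              go : ∀ x₂ x₃ → x₂ ≡ (s +F 1F) *F x₀ → x₃ ≡ s *F x₁ +F p *F x₂ →
                   x₀ +F ((s +F 1F) *F x₂ +F d *F x₃) ≡ 0F → p *F x₀ +F (x₁ +F (ε *F x₂ +F s *F x₃)) ≡ 0F → (x₀ , x₁ , x₂ , x₃) ≡ 0⁴
              go _ _ refl refl third fourth = tuple x₀≡0 x₁≡0
                  (trans (cong ((s +F 1F) *F_) x₀≡0) (R.zeroʳ _))
                  (trans (cong₂ (λ m n → s *F m +F p *F ((s +F 1F) *F n)) x₁≡0 x₀≡0) (solve 2 (λ s p → s :* :0 :+ p :* ((s :+ :1) :* :0) := :0) refl s p))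
                where
                x₀≡0 : x₀ ≡ 0F
                x₀≡0 = *-cancel-nonzero (charpoly-nonzero s) (trans (solve 6 (λ s p ε d x₀ x₁ →
                  ((((s :* s :+ s) :* (s :* s :+ s)) :+ (ε :* d) :* (s :* s :+ s)) :+ d :* p) :* x₀ :=
                  ((s :+ :1) :* (s :+ :1)) :* (x₀ :+ ((s :+ :1) :* ((s :+ :1) :* x₀) :+ d :* (s :* x₁ :+ p :* ((s :+ :1) :* x₀)))) :+
                  (d :* s) :* (p :* x₀ :+ (x₁ :+ (ε :* ((s :+ :1) :* x₀) :+ s :* (s :* x₁ :+ p :* ((s :+ :1) :* x₀)))))) refl s p ε d x₀ x₁)
                  (trans (cong₂ (λ m n → ((s +F 1F) *F (s +F 1F)) *F m +F (d *F s) *F n) third fourth)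
                    (zero-combination ((s +F 1F) *F (s +F 1F)) (d *F s))))
                x₁≡0 : x₁ ≡ 0F
                x₁≡0 = begin
                  x₁
                    ≡⟨ solve 5 (λ s p ε d x₁ → x₁ :=
                         (p :* :0 :+ (x₁ :+ (ε :* ((s :+ :1) :* :0) :+ s :* (s :* x₁ :+ p :* ((s :+ :1) :* :0))))) :+ s :* (s :* x₁)) refl s p ε d x₁ ⟩
                  (p *F 0F +F (x₁ +F (ε *F ((s +F 1F) *F 0F) +F s *F (s *F x₁ +F p *F ((s +F 1F) *F 0F))))) +F s *F (s *F x₁)
                    ≡⟨ cong₂ _+F_ (trans (cong (λ m → p *F m +F (x₁ +F (ε *F ((s +F 1F) *F m) +F s *F (s *F x₁ +F p *F ((s +F 1F) *F m))))) (sym x₀≡0)) fourth)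
                         (cong (s *F_) sx₁≡0) ⟩
                  0F +F s *F 0F
                    ≡⟨ solve 1 (λ s → :0 :+ s :* :0 := :0) refl s ⟩
                  0F ∎
                  where
                  sx₁≡0 : s *F x₁ ≡ 0F
                  sx₁≡0 = *-cancel-nonzero d≢0 (begin
                    d *F (s *F x₁)
                      ≡⟨ solve 4 (λ s p d x₁ → d :* (s :* x₁) := :0 :+ ((s :+ :1) :* ((s :+ :1) :* :0) :+ d :* (s :* x₁ :+ p :* ((s :+ :1) :* :0)))) refl s p d x₁ ⟩
                    0F +F ((s +F 1F) *F ((s +F 1F) *F 0F) +F d *F (s *F x₁ +F p *F ((s +F 1F) *F 0F)))
                      ≡⟨ cong (λ m → m +F ((s +F 1F) *F ((s +F 1F) *F m) +F d *F (s *F x₁ +F p *F ((s +F 1F) *F m)))) (sym x₀≡0) ⟩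
                    _ ≡⟨ third ⟩
                    0F ∎)

            A-injective : ∀ s {x y} → A s x ≡ A s y → x ≡ y
            A-injective s {x} {y} eq = ⊕-zero x y (A-kernel s (x ⊕ y) (trans (A-⊕ s x y) (trans (cong (_⊕ A s y) eq) (⊕-self (A s y)))))

            opaque
              A⁻¹ : ∀ s y → ∃ λ x → A s x ≡ y
              A⁻¹ s = FinF⁴.injective⇒surjective (A s) (A-injective s)

            W-A : ∀ s x → W (A s x) ≈ (W (A 0F x) +V (s · W x))
            W-A s (x₀ , x₁ , x₂ , x₃) = ≈-trans (vec-cong
              (solve 3 (λ s x y → (s :+ :1) :* x :+ y := :1 :* ((:0 :+ :1) :* x :+ y) :+ s :* x) refl s x₀ x₂)
              (solve 3 (λ s x m → s :* x :+ m := :1 :* (:0 :* x :+ m) :+ s :* x) refl s x₁ (p *F x₂ +F x₃))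
              (solve 4 (λ s x y m → x :+ ((s :+ :1) :* y :+ m) := :1 :* (x :+ ((:0 :+ :1) :* y :+ m)) :+ s :* y) refl s x₀ x₂ (d *F x₃))
              (solve 5 (λ s x m n k → m :+ (n :+ (k :+ s :* x)) := :1 :* (m :+ (n :+ (k :+ :0 :* x))) :+ s :* x) refl s x₃ (p *F x₀) x₁ (ε *F x₂)))
              (≈-trans (≈-sym (vec-combo 1F s _ _ _ _ x₀ x₁ x₂ x₃)) (λ j → cong (_+F s *F vec x₀ x₁ x₂ x₃ j) (R.*-identityˡ _)))

            B-A₀ : ∀ x → B (W x) (W (A 0F x)) ≡ Qf (W x)
            B-A₀ (x₀ , x₁ , x₂ , x₃) = trans (B-vec x₀ x₁ x₂ x₃ _ _ _ _) (trans
              (solve 7 (λ x₀ x₁ x₂ x₃ p ε d →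
                (x₀ :* (:0 :* x₁ :+ (p :* x₂ :+ x₃)) :+ x₁ :* ((:0 :+ :1) :* x₀ :+ x₂)) :+
                (x₂ :* (p :* x₀ :+ (x₁ :+ (ε :* x₂ :+ :0 :* x₃))) :+ x₃ :* (x₀ :+ ((:0 :+ :1) :* x₂ :+ d :* x₃))) :=
                x₀ :* x₁ :+ ((x₂ :* x₂) :* ε :+ ((x₃ :* x₃) :* d :+ x₂ :* x₃))) refl x₀ x₁ x₂ x₃ p ε d)
              (sym (Q-W x₀ x₁ x₂ x₃)))

            B-A : ∀ s x → B (W (A s x)) (W x) ≡ Qf (W x)
            B-A s x = trans (B-congˡ (W-A s x)) (trans (B-+ˡ (W (A 0F x)) (s · W x) (W x))
              (trans (cong₂ _+F_ (trans (B-sym _ _) (B-A₀ x)) (trans (B-·ˡ s (W x) (W x)) (trans (cong (s *F_) (B-alt (W x))) (R.zeroʳ s)))) (R.+-identityʳ _)))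

            Singular : F⁴ → Set
            Singular x = x ≢ 0⁴ × Qf (W x) ≡ 0F

            W-nonzero : ∀ {x} → x ≢ 0⁴ → NonZero (W x)
            W-nonzero {x} x≢0 z = x≢0 (W-zero x z)

            W∈Π : ∀ x → InΠ (W x)
            W∈Π (x₀ , x₁ , x₂ , x₃) = vec∈Π x₀ x₁ x₂ x₃

            A-indep : ∀ {x} → x ≢ 0⁴ → ∀ α β → ((α · W x) +V (β · W (A 0F x))) ≈ 0V → α ≡ 0F × β ≡ 0F
            A-indep {x} x≢0 α β z with β ≟ 0F
            ... | no β≢0 = ⊥-elim (x≢0 (A-kernel s x (W-zero (A s x) (λ j → trans (W-A s x j) (*-cancel-nonzero β≢0 (begin
                    β *F (W (A 0F x) j +F (α *F β ⁻¹) *F W x j)      ≡⟨ solve 5 (λ α β b x y → β :* (y :+ (α :* b) :* x) := (β :* b) :* (α :* x) :+ β :* y) refl α β (β ⁻¹) (W x j) (W (A 0F x) j) ⟩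
                    (β *F β ⁻¹) *F (α *F W x j) +F β *F W (A 0F x) j      ≡⟨ cong (λ m → m *F (α *F W x j) +F β *F W (A 0F x) j) (⁻¹-inverse β≢0) ⟩
                    1F *F (α *F W x j) +F β *F W (A 0F x) j      ≡⟨ cong (_+F β *F W (A 0F x) j) (R.*-identityˡ _) ⟩
                    α *F W x j +F β *F W (A 0F x) j      ≡⟨ z j ⟩
                    0F ∎))))))
              where
              s : F
              s = α *F β ⁻¹
            ... | yes β≡0 = α≡0 , β≡0
              where
              α≡0 : α ≡ 0F
              α≡0 with α ≟ 0F
              ... | yes p = p
              ... | no α≢0 = ⊥-elim (W-nonzero x≢0 (λ j → *-cancel-nonzero α≢0 (trans (solve 3 (λ α x y → α :* x := α :* x :+ :0 :* y) refl α (W x j) (W (A 0F x) j))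
                               (trans (cong (λ m → α *F W x j +F m *F W (A 0F x) j) (sym β≡0)) (z j)))))

            opaque
              slope : ∀ {x} → Singular x → ∃ λ s → O (W (A s x))
              slope {x} (x≢0 , Qx) = build (meet-affine (W∈Π x) (W∈Π (A 0F x)) (linIndep₂ (A-indep x≢0)) (trans (B-A₀ x) Qx) (λ Ox → disjoint (W x) Ox Qx))
                where
                build : (∃ λ s → O (W (A 0F x) +V (s · W x))) → ∃ λ s → O (W (A s x))
                build (s , Op) = s , O-cong (W-A s x) Op

            opaque
              slope-unique : ∀ {x s s'} → Singular x → O (W (A s x)) → O (W (A s' x)) → s ≡ s'
              slope-unique {x} {s} {s'} (x≢0 , Qx) Os Os' = go (O-perp-same Os Os' perp)
                where
                perp : B (W (A s x)) (W (A s' x)) ≡ 0F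
                perp = begin
                  B (W (A s x)) (W (A s' x))      ≡⟨ B-congʳ (≈-trans (W-A s' x) (λ j → trans (solve 4 (λ a s s' x → a :+ s' :* x := (a :+ s :* x) :+ (s :+ s') :* x) refl (W (A 0F x) j) s s' (W x j))
                                                                               (cong (_+F (s +F s') *F W x j) (sym (W-A s x j))))) ⟩
                  B (W (A s x)) (W (A s x) +V ((s +F s') · W x))      ≡⟨ B-+ʳ (W (A s x)) (W (A s x)) ((s +F s') · W x) ⟩
                  B (W (A s x)) (W (A s x)) +F B (W (A s x)) ((s +F s') · W x)  ≡⟨ cong₂ _+F_ (B-alt (W (A s x))) (trans (B-·ʳ (s +F s') (W (A s x)) (W x)) (cong ((s +F s') *F_) (trans (B-A s x) Qx))) ⟩
                  0F +F (s +F s') *F 0F      ≡⟨ solve 1 (λ m → :0 :+ m :* :0 := :0) refl (s +F s') ⟩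
                  0F ∎
                go : SamePoint (W (A s x)) (W (A s' x)) → s ≡ s'
                go (k , _ , same) = +≡0⇒≡ (trans (cong (λ m → s +F m) (trans (sym (R.*-identityˡ s')) (cong (_*F s') (sym k≡1)))) (proj₁ w))
                  where
                  w : s +F k *F s' ≡ 0F × 1F +F k ≡ 0F
                  w = A-indep x≢0 (s +F k *F s') (1F +F k) (λ j → trans
                    (solve 5 (λ s s' k x y → (s :+ k :* s') :* x :+ (:1 :+ k) :* y := (y :+ s :* x) :+ k :* (y :+ s' :* x)) refl s s' k (W x j) (W (A 0F x) j))
                    (trans (cong₂ (λ m n → m +F k *F n) (sym (W-A s x j)) (sym (W-A s' x j))) (≡⇒+≡0 (same j))))
                  k≡1 : k ≡ 1F
                  k≡1 = sym (+≡0⇒≡ (proj₂ w))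

            -- The graph of the involution: y = (A + s)(A + s + 1)⁻¹ x, where s is the slope of x.
            -- As a relation it can be shown symmetric and single-valued independently of the choice
            -- of s and u.
            Step : F⁴ → F⁴ → Set
            Step x y = ∃ λ s → ∃ λ u → O (W (A s x)) × A (s +F 1F) u ≡ x × A s u ≡ y

            suc-suc : ∀ s → (s +F 1F) +F 1F ≡ s
            suc-suc = solve 1 (λ s → (s :+ :1) :+ :1 := s) refl

            -- A + s and A + s + 1 commute, so (A + s) x = (A + s + 1) y: the same point of O lies
            -- on the line of y, with slope s + 1.
            Step-sym : ∀ {x y} → Step x y → Step y x
            Step-sym (s , u , Op , refl , refl) = s +F 1F , u , subst (λ z → O (W z)) commute Op , cong (λ s → A s u) (suc-suc s) , refl
              where
              commute : A s (A (s +F 1F) u) ≡ A (s +F 1F) (A s u)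
              commute = trans (cong (A s) (A-suc s u)) (trans (A-⊕ s (A s u) u) (sym (A-suc s (A s u))))

            Step-unique : ∀ {x y y'} → Singular x → Step x y → Step x y' → y ≡ y'
            Step-unique sing (s , u , Op , eq , refl) (s' , u' , Op' , eq' , refl) with slope-unique sing Op Op'
            ... | refl = cong (A s) (A-injective (s +F 1F) (trans eq (sym eq')))

            -- x and its image differ by u, so a fixed x forces u = 0 and then x = 0.
            Step-moves : ∀ {x} → Singular x → ¬ Step x x
            Step-moves (x≢0 , _) (s , u , _ , eq , eq') = x≢0 (trans (sym eq') (trans (cong (A s) u≡0) (trans (cong (A s) (sym (⊕-self u))) (trans (A-⊕ s u u) (⊕-self (A s u))))))
              where
              u≡0 : u ≡ 0⁴
              u≡0 = trans (sym (cancel (A s u) u)) (trans (cong (A s u ⊕_) (trans (sym (A-suc s u)) (trans eq (sym eq')))) (⊕-self (A s u)))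
                where
                cancel : ∀ x y → x ⊕ (x ⊕ y) ≡ y
                cancel (x₀ , x₁ , x₂ , x₃) (y₀ , y₁ , y₂ , y₃) = tuple (c x₀ y₀) (c x₁ y₁) (c x₂ y₂) (c x₃ y₃)
                  where
                  c : ∀ x y → x +F (x +F y) ≡ y
                  c = solve 2 (λ x y → x :+ (x :+ y) := y) refl

            -- x = y + u and B(y, u) = Q(u), hence Q(x) = Q(y) + Q(u) + Q(u) = Q(y).
            Step-singular : ∀ {x y} → Singular x → Step x y → Singular y
            Step-singular sing@(x≢0 , Qx) step@(s , u , _ , refl , refl) = nonzero , (begin
                Qf (W (A s u))      ≡⟨ solve 2 (λ a b → a := (a :+ b) :+ b) refl (Qf (W (A s u))) (Qf (W u)) ⟩
                (Qf (W (A s u)) +F Qf (W u)) +F Qf (W u)      ≡⟨ cong ((Qf (W (A s u)) +F Qf (W u)) +F_) (sym (B-A s u)) ⟩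
                (Qf (W (A s u)) +F Qf (W u)) +F B (W (A s u)) (W u)      ≡⟨ sym (Q-+ (W (A s u)) (W u)) ⟩
                Qf (W (A s u) +V W u)      ≡⟨ Q-cong (≈-sym (W-⊕ (A s u) u)) ⟩
                Qf (W (A s u ⊕ u))      ≡⟨ cong (λ x → Qf (W x)) (sym (A-suc s u)) ⟩
                Qf (W (A (s +F 1F) u))      ≡⟨ Qx ⟩
                0F ∎)
              where
              nonzero : A s u ≢ 0⁴
              nonzero z = x≢0 (trans (cong (A (s +F 1F)) (A-kernel s u z)) (trans (cong (A (s +F 1F)) (sym (⊕-self 0⁴))) (trans (A-⊕ (s +F 1F) 0⁴ 0⁴) (⊕-self _))))

            opaque
              step : ∀ x → Singular x → ∃ (Step x)
              step x sing = go (slope sing)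
                where
                go : (∃ λ s → O (W (A s x))) → ∃ (Step x)
                go (s , Op) = A s (proj₁ (A⁻¹ (s +F 1F) x)) , s , proj₁ (A⁻¹ (s +F 1F) x) , Op , proj₂ (A⁻¹ (s +F 1F) x) , refl

            zero? : ∀ x → Dec (Qf (W x) ≡ 0F)
            zero? x = Qf (W x) ≟ 0F

            singular? : ∀ x → Dec (Singular x)
            singular? x = ¬? (x FinF⁴.≟ 0⁴) ×-dec zero? x

            singular-even : FinF⁴.odd? (λ x → ⌊ singular? x ⌋) ≡ false
            singular-even = FinF⁴.even-subset singular? (λ x sing → proj₁ (step x sing))
              (λ x sing → Step-singular sing (proj₂ (step x sing)))
              (λ x sing sing' → Step-unique sing' (proj₂ (step _ sing')) (Step-sym (proj₂ (step x sing))))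
              (λ x sing eq → Step-moves sing (subst (Step x) eq (proj₂ (step x sing))))

            -- A fixed-point free involution preserving Q, which makes the number of zeros of Q, the
            -- zero vector included, even. When x₀ = x₁, adding 1 to x₂ changes Q by ε + x₃; adding
            -- the square root of this to x₀ and x₁ restores the value.
            swap : F⁴ → F⁴
            swap (x₀ , x₁ , x₂ , x₃) with x₀ ≟ x₁
            ... | no _  = x₁ , x₀ , x₂ , x₃
            ... | yes _ = x₀ +F sqrt (ε +F x₃) , x₁ +F sqrt (ε +F x₃) , x₂ +F 1F , x₃

            Q-swap : ∀ x → Qf (W (swap x)) ≡ Qf (W x)
            Q-swap (x₀ , x₁ , x₂ , x₃) with x₀ ≟ x₁
            ... | no _ = trans (Q-W x₁ x₀ x₂ x₃) (trans (cong (_+F ((x₂ *F x₂) *F ε +F ((x₃ *F x₃) *F d +F x₂ *F x₃))) (R.*-comm x₁ x₀)) (sym (Q-W x₀ x₁ x₂ x₃)))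
            ... | yes refl = trans (Q-W (x₀ +F k) (x₀ +F k) (x₂ +F 1F) x₃) (trans
                (solve 6 (λ x₀ x₂ x₃ ε m k → (x₀ :+ k) :* (x₀ :+ k) :+ (((x₂ :+ :1) :* (x₂ :+ :1)) :* ε :+ (m :+ (x₂ :+ :1) :* x₃)) :=
                           (x₀ :* x₀ :+ ((x₂ :* x₂) :* ε :+ (m :+ x₂ :* x₃))) :+ (k :* k :+ (ε :+ x₃))) refl x₀ x₂ x₃ ε ((x₃ *F x₃) *F d) k)
                (trans (cong ((x₀ *F x₀ +F ((x₂ *F x₂) *F ε +F ((x₃ *F x₃) *F d +F x₂ *F x₃))) +F_) (≡⇒+≡0 (sqrt² (ε +F x₃))))
                  (trans (R.+-identityʳ _) (sym (Q-W x₀ x₀ x₂ x₃)))))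
              where
              k : F
              k = sqrt (ε +F x₃)

            swap-involutive : ∀ x → swap (swap x) ≡ x
            swap-involutive (x₀ , x₁ , x₂ , x₃) with x₀ ≟ x₁
            swap-involutive (x₀ , x₁ , x₂ , x₃) | no x₀≢x₁ with x₁ ≟ x₀
            ... | no _  = refl
            ... | yes p = ⊥-elim (x₀≢x₁ (sym p))
            swap-involutive (x₀ , x₁ , x₂ , x₃) | yes refl with (x₀ +F sqrt (ε +F x₃)) ≟ (x₀ +F sqrt (ε +F x₃))
            ... | no ne = ⊥-elim (ne refl)
            ... | yes _ = tuple (cancel x₀ _) (cancel x₀ _) (suc-suc x₂) refl
              where
              cancel : ∀ x k → (x +F k) +F k ≡ x
              cancel = solve 2 (λ x k → (x :+ k) :+ k := x) refl

            swap-moves : ∀ x → swap x ≢ x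
            swap-moves (x₀ , x₁ , x₂ , x₃) eq with x₀ ≟ x₁
            ... | no x₀≢x₁ = x₀≢x₁ (sym (cong proj₁ eq))
            ... | yes _    = 1≢0 (trans (solve 1 (λ x → :1 := (x :+ :1) :+ x) refl x₂) (≡⇒+≡0 (cong (λ x → proj₁ (proj₂ (proj₂ x))) eq)))

            zero-even : FinF⁴.odd? (λ x → ⌊ zero? x ⌋) ≡ false
            zero-even = FinF⁴.even-subset zero? (λ x _ → swap x) (λ x Qx → trans (Q-swap x) Qx) (λ x _ _ → swap-involutive x) (λ x _ → swap-moves x)

            zero-or-singular : ∀ x → ⌊ zero? x ⌋ ≡ ⌊ singular? x ⌋ xor ⌊ x FinF⁴.≟ 0⁴ ⌋
            zero-or-singular x with x FinF⁴.≟ 0⁴ | zero? x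
            ... | yes _    | yes _ = refl
            ... | yes refl | no ne = ⊥-elim (ne (Q-0 vec-zero))
            ... | no _     | yes _ = refl
            ... | no _     | no _  = refl

          contradiction : ⊥
          contradiction = false≢true (begin
            false      ≡⟨ sym zero-even ⟩
            FinF⁴.odd? (λ x → ⌊ zero? x ⌋)      ≡⟨ FinF⁴.odd?-cong zero-or-singular ⟩
            FinF⁴.odd? (λ x → ⌊ singular? x ⌋ xor ⌊ x FinF⁴.≟ 0⁴ ⌋)      ≡⟨ FinF⁴.odd?-xor (λ x → ⌊ singular? x ⌋) (λ x → ⌊ x FinF⁴.≟ 0⁴ ⌋) ⟩
            FinF⁴.odd? (λ x → ⌊ singular? x ⌋) xor FinF⁴.odd? (λ x → ⌊ x FinF⁴.≟ 0⁴ ⌋)      ≡⟨ cong₂ _xor_ singular-even (FinF⁴.odd?-singleton 0⁴) ⟩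
            true      ∎)
            where
            false≢true : false ≢ true
            false≢true ()

        -- The Klein quadric: Π^⊥ and planes of the quadric.

        module Klein (nondegenerate : NondegenerateB) (singular-plane : Σ Plane TotallySingular) where

          opaque
            search-Π : {R : V → Set} → (∀ {u v} → u ≈ v → R u → R v) → (∀ v → InΠ v → Dec (R v)) → Dec (∃ λ v → InΠ v × R v)
            search-Π {R} respects R? = map′
              (λ { ((x₀ , x₁ , x₂ , x₃) , r) → vec x₀ x₁ x₂ x₃ , vec∈Π x₀ x₁ x₂ x₃ , r })
              (λ { (v , v∈Π , r) → _ , respects (expand v∈Π) r })
              (FinF⁴.search (λ { (x₀ , x₁ , x₂ , x₃) → R? (vec x₀ x₁ x₂ x₃) (vec∈Π x₀ x₁ x₂ x₃) }))
              where open Coordinates (proj₂ baseFrame)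

            -- O and Q are decidable on the finitely many vectors of Π, so refuting disjointness
            -- produces an actual common point.
            O-meets-Q : ∃ λ v → InΠ v × O v × Qf v ≡ 0F
            O-meets-Q = decide (search-Π (λ e (Ou , Qu) → O-cong (≈-sym e) Ou , trans (Q-cong (≈-sym e)) Qu) on?)
              where
              on? : ∀ v → InΠ v → Dec (O v × Qf v ≡ 0F)
              on? v v∈Π with nonzero? v
              ... | inj₁ z   = no λ (Ov , _) → O-nonzero Ov z
              ... | inj₂ v≢0 = O? v∈Π v≢0 ×-dec (Qf v ≟ 0F)
              decide : Dec (∃ λ v → InΠ v × O v × Qf v ≡ 0F) → ∃ λ v → InΠ v × O v × Qf v ≡ 0F
              decide (yes p) = p
              decide (no ¬p) with singular-frame
              ... | e , f , Fr , Qe , Qf≡0 = ⊥-elim (Parity.contradiction Fr Qe Qf≡0 (λ v Ov Qv → ¬p (v , O∈Π Ov , Ov , Qv)))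

            Q-minus-O : ¬ (∀ v → NonZero v → (O v → InE v) × (InE v → O v)) → ∃ λ v → InΠ v × NonZero v × Qf v ≡ 0F × ¬ O v
            Q-minus-O O≢E = decide (search-Π respects off?)
              where
              Off : V → Set
              Off v = NonZero v × Qf v ≡ 0F × ¬ O v
              respects : ∀ {u v} → u ≈ v → Off u → Off v
              respects e (u≢0 , Qu , ¬Ou) = (λ z → u≢0 (≈-trans e z)) , trans (Q-cong (≈-sym e)) Qu , λ Ov → ¬Ou (O-cong e Ov)
              off? : ∀ v → InΠ v → Dec (Off v)
              off? v v∈Π with nonzero? v
              ... | inj₁ z   = no λ (v≢0 , _) → v≢0 z
              ... | inj₂ v≢0 = map′ (v≢0 ,_) proj₂ ((Qf v ≟ 0F) ×-dec ¬? (O? v∈Π v≢0))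
              decide : Dec (∃ λ v → InΠ v × Off v) → ∃ λ v → InΠ v × Off v
              decide (yes p) = p
              decide (no none) = ⊥-elim (O≢E (λ v v≢0 → O⇒E v , E⇒O v))
                where
                E⇒O : ∀ v → InE v → O v
                E⇒O v ((v≢0 , v∈Π) , Qv) with O? (inΠ v∈Π) v≢0
                ... | yes Ov = Ov
                ... | no ¬Ov = ⊥-elim (none (v , inΠ v∈Π , v≢0 , Qv , ¬Ov))
                -- It remains to see that an ovoid containing Q^-(3,q) equals it. If v on O were not
                -- singular, the singular point p of a line of W(q) through v would not be on O,
                -- since it would then coincide with v.
                O⇒E : ∀ v → O v → InE v
                O⇒E v Ov with Qf v ≟ 0F
                ... | yes Qv = (O-nonzero Ov , InΠ.span (O∈Π Ov)) , Qv
                ... | no Qv≢0 with pointFrame (O∈Π Ov) (O-nonzero Ov)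
                ...   | f , Fr = ⊥-elim (absurd (singular-on-line e∈Π (vec∈Π 0F 0F 1F 0F) (frame-line-indep Fr 1F 0F (λ (p , _) → 1≢0 p)) (B-e 0F 0F 1F 0F)))
                  where
                  open Coordinates Fr
                  absurd : (∃ λ α → ∃ λ β → OnQ ((α · v) +V (β · vec 0F 0F 1F 0F))) → ⊥
                  absurd (α , β , p≢0 , Qp) = none (p , Π-+ (Π-· α e∈Π) (Π-· β (vec∈Π 0F 0F 1F 0F)) , p≢0 , Qp , λ Op →
                      Qv≢0 (SamePoint-Q (O-perp-same Ov Op v⊥p) Qp))
                    where
                    p : V
                    p = (α · v) +V (β · vec 0F 0F 1F 0F)
                    v⊥p : B v p ≡ 0F
                    v⊥p = trans (B-sym v p) (trans (B-combo α β v (vec 0F 0F 1F 0F) v) (trans (cong₂ (λ m n → α *F m +F β *F n) (B-alt v) (trans (B-sym _ v) (B-e 0F 0F 1F 0F)))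
                            (zero-combination α β)))

          singular-Q : ∀ {n} {S : Subspace n} → TotallySingular S → ∀ {v} → InSpan (Subspace.basis S) v → Qf v ≡ 0F
          singular-Q ts {v} s with nonzero? v
          ... | inj₁ z   = Q-0 z
          ... | inj₂ v≢0 = ts v (v≢0 , s)

          singular-B : ∀ {n} {S : Subspace n} → TotallySingular S → ∀ {u v} → InSpan (Subspace.basis S) u → InSpan (Subspace.basis S) v → B u v ≡ 0F
          singular-B {S = S} ts {u} {v} s t = begin
            B u v      ≡⟨ solve 3 (λ a b c → c := (a :+ b) :+ ((a :+ b) :+ c)) refl (Qf u) (Qf v) (B u v) ⟩
            (Qf u +F Qf v) +F ((Qf u +F Qf v) +F B u v)  ≡⟨ cong ((Qf u +F Qf v) +F_) (sym (Q-+ u v)) ⟩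
            (Qf u +F Qf v) +F Qf (u +V v)      ≡⟨ cong₂ _+F_ (cong₂ _+F_ (singular-Q {S = S} ts s) (singular-Q {S = S} ts t)) (singular-Q {S = S} ts (span-+ {w = Subspace.basis S} s t)) ⟩
            (0F +F 0F) +F 0F      ≡⟨ solve 0 ((:0 :+ :0) :+ :0 := :0) refl ⟩
            0F      ∎

          _⊥Π : V → Set
          v ⊥Π = ∀ w → InΠ w → B v w ≡ 0F

          -- Π^⊥ is a nondegenerate 2-dimensional space: completing l to a hyperbolic pair l, n of Π^⊥ and adding a
          -- frame of Π gives a basis of V, to all of which m + B(m,n) l is orthogonal.
          opaque
            perp-line : ∀ {l m} → l ⊥Π → m ⊥Π → NonZero l → B l m ≡ 0F → ∃ λ c → m ≈ (c · l)
            perp-line {l} {m} l⊥ m⊥ l≢0 lm = c , λ j → +≡0⇒≡ (nondegenerate d (λ y → ⊥-span {w = basis} d⊥ (indep-spans δ basis (λ i → unit-spans (basis i)) basis-indep (unit-spans y))) j)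
              where
              open Coordinates (proj₂ baseFrame)
              partner : ∃ λ i → B l (δ i) ≢ 0F
              partner with any? {n = 6} (λ i → ¬? (B l (δ i) ≟ 0F))
              ... | yes p = p
              ... | no ¬p = ⊥-elim (l≢0 (nondegenerate l (λ y → ⊥-span {w = δ} all0 (unit-spans y))))
                where
                all0 : ∀ i → B l (δ {6} i) ≡ 0F
                all0 i with B l (δ i) ≟ 0F
                ... | yes z = z
                ... | no nz = ⊥-elim (¬p (i , nz))
              n d : V
              -- Removing the Π-component does not change the pairing with l, because l is
              -- orthogonal to Π.
              n = res (δ (proj₁ partner))
              b c : F
              b = B l n
              b≢0 : b ≢ 0F
              b≢0 z = proj₂ partner (trans (sym (trans (B-+ʳ l _ _) (trans (cong (B l (δ (proj₁ partner)) +F_) (l⊥ _ (proj∈Π _))) (R.+-identityʳ _)))) z)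
              c = B m n *F b ⁻¹
              d = m +V (c · l)
              basis : Fin 6 → V
              basis = P zero ∷ proj₁ baseFrame ∷ g ∷ h ∷ l ∷ n ∷ []
              d⊥Π : d ⊥Π
              d⊥Π w w∈Π = trans (B-+ˡ m (c · l) w) (trans (cong₂ _+F_ (m⊥ w w∈Π) (trans (B-·ˡ c l w) (cong (c *F_) (l⊥ w w∈Π)))) (solve 1 (λ c → :0 :+ c :* :0 := :0) refl c))
              d⊥ : ∀ i → B d (basis i) ≡ 0F
              d⊥ zero                               = d⊥Π _ e∈Π
              d⊥ (suc zero)                         = d⊥Π _ f∈Π
              d⊥ (suc (suc zero))                   = d⊥Π _ g∈Π
              d⊥ (suc (suc (suc zero)))             = d⊥Π _ h∈Π
              d⊥ (suc (suc (suc (suc zero))))       = trans (B-+ˡ m (c · l) l) (trans (cong₂ _+F_ (trans (B-sym m l) lm) (trans (B-·ˡ c l l) (cong (c *F_) (B-alt l)))) (solve 1 (λ c → :0 :+ c :* :0 := :0) refl c))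
              d⊥ (suc (suc (suc (suc (suc zero))))) = trans (B-+ˡ m (c · l) n) (trans (cong (B m n +F_) (trans (B-·ˡ c l n) (trans (solve 3 (λ a b i → (a :* i) :* b := a :* (b :* i)) refl (B m n) b (b ⁻¹))
                                                        (trans (cong (B m n *F_) (⁻¹-inverse b≢0)) (R.*-identityʳ _))))) (x+x (B m n)))
              basis-indep : LinIndep basis
              basis-indep c z = all0
                where
                c₀ c₁ c₂ c₃ c₄ c₅ : F
                c₀ = c zero
                c₁ = c (suc zero)
                c₂ = c (suc (suc zero))
                c₃ = c (suc (suc (suc zero)))
                c₄ = c (suc (suc (suc (suc zero))))
                c₅ = c (suc (suc (suc (suc (suc zero)))))
                k : V
                k = (c₄ · l) +V (c₅ · n)
                split : (vec c₀ c₁ c₂ c₃ +V k) ≈ 0V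
                split j = trans (cong (_+F k j) (vec-lc c₀ c₁ c₂ c₃ j)) (trans (solve 6 (λ a b c d e f → (a :+ (b :+ (c :+ (d :+ :0)))) :+ (e :+ f) := a :+ (b :+ (c :+ (d :+ (e :+ (f :+ :0)))))) refl
                            (c₀ *F P zero j) (c₁ *F proj₁ baseFrame j) (c₂ *F g j) (c₃ *F h j) (c₄ *F l j) (c₅ *F n j)) (z j))
                k⊥ : k ⊥Π
                k⊥ w w∈Π = trans (B-combo c₄ c₅ l n w) (trans (cong₂ (λ s t → c₄ *F s +F c₅ *F t) (l⊥ w w∈Π) (res-⊥ _ w∈Π)) (zero-combination c₄ c₅))
                vec≈0 : vec c₀ c₁ c₂ c₃ ≈ 0V
                vec≈0 = Π-nondegenerate (vec∈Π c₀ c₁ c₂ c₃) (λ w w∈Π → begin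
                  B (vec c₀ c₁ c₂ c₃) w      ≡⟨ sym (trans (cong (B (vec c₀ c₁ c₂ c₃) w +F_) (k⊥ w w∈Π)) (R.+-identityʳ _)) ⟩
                  B (vec c₀ c₁ c₂ c₃) w +F B k w      ≡⟨ sym (B-+ˡ (vec c₀ c₁ c₂ c₃) k w) ⟩
                  B (vec c₀ c₁ c₂ c₃ +V k) w      ≡⟨ B-0ˡ w split ⟩
                  0F      ∎)
                k≈0 : k ≈ 0V
                k≈0 j = trans (sym (R.+-identityˡ (k j))) (trans (cong (_+F k j) (sym (vec≈0 j))) (split j))
                c₄≡0 : c₄ ≡ 0F
                c₄≡0 = *-cancel-nonzero b≢0 (trans (solve 3 (λ a b c → b :* a := a :* b :+ c :* :0) refl c₄ b c₅)
                         (trans (cong (λ m → c₄ *F b +F c₅ *F m) (sym (B-alt n))) (trans (sym (B-combo c₄ c₅ l n n)) (B-0ˡ n k≈0))))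
                c₅≡0 : c₅ ≡ 0F
                c₅≡0 = *-cancel-nonzero b≢0 (trans (solve 3 (λ a b c → b :* c := a :* :0 :+ c :* b) refl c₄ b c₅)
                         (trans (cong₂ (λ m n → c₄ *F m +F c₅ *F n) (sym (B-alt l)) (B-sym l n)) (trans (sym (B-combo c₄ c₅ l n l)) (B-0ˡ l k≈0))))
                p : c₀ ≡ 0F × c₁ ≡ 0F × c₂ ≡ 0F × c₃ ≡ 0F
                p = vec-≡0 vec≈0
                all0 : ∀ i → c i ≡ 0F
                all0 zero                               = proj₁ p
                all0 (suc zero)                         = proj₁ (proj₂ p)
                all0 (suc (suc zero))                   = proj₁ (proj₂ (proj₂ p))
                all0 (suc (suc (suc zero)))             = proj₂ (proj₂ (proj₂ p))
                all0 (suc (suc (suc (suc zero))))       = c₄≡0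
                all0 (suc (suc (suc (suc (suc zero))))) = c₅≡0

          -- Otherwise the Π^⊥-components of π would all lie on the line of res v, so π ∩ Π would contain a line.
          opaque
            radical-in-Π : ∀ (π : Plane) → TotallySingular π → ∀ {v} → InSpan (Subspace.basis π) v →
                           (∀ i → B (proj v) (Subspace.basis π i) ≡ 0F) → res v ≈ 0V
            radical-in-Π π ts {v} v∈π perp = go (nonzero? (res v))
              where
              b : Fin 3 → V
              b = Subspace.basis π
              res-perp : ∀ i → B (res v) (res (b i)) ≡ 0F
              res-perp i = begin
                B (res v) (res (b i))      ≡⟨ sym (trans (cong (_+F B (res v) (res (b i))) proj-perp) (R.+-identityˡ _)) ⟩
                B (proj v) (proj (b i)) +F B (res v) (res (b i))      ≡⟨ sym (B-split v (b i)) ⟩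
                B v (b i)      ≡⟨ singular-B {S = π} ts v∈π (span-basis b i) ⟩
                0F      ∎
                where
                proj-perp : B (proj v) (proj (b i)) ≡ 0F
                proj-perp = trans (B-sym _ _) (trans (proj-B (b i) (proj∈Π v)) (trans (B-sym _ _) (perp i)))
              go : (res v ≈ 0V) ⊎ NonZero (res v) → res v ≈ 0V
              go (inj₁ z) = z
              go (inj₂ l≢0) = ⊥-elim (no-singular-line u∈Π u'∈Π (linIndep₂ ind) (singular-Q {S = π} ts (c , ≈-refl)) (singular-Q {S = π} ts (c' , ≈-refl))
                                (singular-B {S = π} ts (c , ≈-refl) (c' , ≈-refl)))
                where
                f : Fin 3 → F
                f i = proj₁ (perp-line (λ w → res-⊥ v) (λ w → res-⊥ (b i)) l≢0 (res-perp i))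
                res-b : ∀ i → res (b i) ≈ (f i · res v)
                res-b i = proj₂ (perp-line (λ w → res-⊥ v) (λ w → res-⊥ (b i)) l≢0 (res-perp i))
                -- A combination of the basis of π with coefficients c has residue (∑ c i f i)
                -- `res v`; those with residue zero contain a two-dimensional space, a line of the
                -- quadric inside Π.
                sol : ∃ λ (c : Fin 3 → F) → ∃ λ (d : Fin 3 → F) → ∑ (λ i → c i *F f i) ≡ 0F × ∑ (λ i → d i *F f i) ≡ 0F ×
                      (∀ α β → (∀ i → α *F c i +F β *F d i ≡ 0F) → α ≡ 0F × β ≡ 0F)
                sol = plane-of-solutions f
                c c' : Fin 3 → F
                c = proj₁ sol
                c' = proj₁ (proj₂ sol)
                in-Π : ∀ c → ∑ (λ i → c i *F f i) ≡ 0F → InΠ (lc c b)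
                in-Π c eq = Π-cong (≈-sym (res≈0⇒proj (≈-trans (res-lc c b) λ j → begin
                  ∑ (λ i → c i *F res (b i) j)      ≡⟨ ∑-cong (λ i → trans (cong (c i *F_) (res-b i j)) (solve 3 (λ c f r → c :* (f :* r) := r :* (c :* f)) refl (c i) (f i) (res v j))) ⟩
                  ∑ (λ i → res v j *F (c i *F f i))      ≡⟨ ∑-* (res v j) (λ i → c i *F f i) ⟩
                  res v j *F ∑ (λ i → c i *F f i)      ≡⟨ trans (cong (res v j *F_) eq) (R.zeroʳ _) ⟩
                  0F      ∎))) (proj∈Π (lc c b))
                u∈Π : InΠ (lc c b)
                u∈Π = in-Π c (proj₁ (proj₂ (proj₂ sol)))
                u'∈Π : InΠ (lc c' b)
                u'∈Π = in-Π c' (proj₁ (proj₂ (proj₂ (proj₂ sol))))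
                ind : ∀ α β → ((α · lc c b) +V (β · lc c' b)) ≈ 0V → α ≡ 0F × β ≡ 0F
                ind α β z = proj₂ (proj₂ (proj₂ (proj₂ sol))) α β (Subspace.indep π (λ i → α *F c i +F β *F c' i) (λ j → begin
                  ∑ (λ i → (α *F c i +F β *F c' i) *F b i j)
                    ≡⟨ ∑-cong (λ i → solve 5 (λ α β c d b → (α :* c :+ β :* d) :* b := α :* (c :* b) :+ β :* (d :* b)) refl α β (c i) (c' i) (b i j)) ⟩
                  ∑ (λ i → α *F (c i *F b i j) +F β *F (c' i *F b i j))
                    ≡⟨ trans (∑-+ (λ i → α *F (c i *F b i j)) (λ i → β *F (c' i *F b i j))) (cong₂ _+F_ (∑-* α (λ i → c i *F b i j)) (∑-* β (λ i → c' i *F b i j))) ⟩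
                  α *F lc c b j +F β *F lc c' b j
                    ≡⟨ z j ⟩
                  0F ∎))

            -- If e is not in the given singular plane π₀, join it to a line of π₀ contained in e^⊥.
            plane-through : ∀ {e} → OnQ e → Σ Plane λ π → TotallySingular π × InSpan (Subspace.basis π) e
            plane-through {e} (e≢0 , Qe) = go (indep? (e ∷ b))
              where
              π₀ : Plane
              π₀ = proj₁ singular-plane
              ts : TotallySingular π₀
              ts = proj₂ singular-plane
              b : Fin 3 → V
              b = Subspace.basis π₀
              go : LinIndep (e ∷ b) ⊎ (∃ λ c → Nontrivial c × lc c (e ∷ b) ≈ 0V) → Σ Plane λ π → TotallySingular π × InSpan (Subspace.basis π) e
              go (inj₂ (c , nt , z)) = π₀ , ts , head-in-span {w = b} (Subspace.indep π₀) c nt z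
              go (inj₁ ind) = subspace (triple e m m') ind' , singular , span-basis (triple e m m') zero
                where
                sol : ∃ λ (c : Fin 3 → F) → ∃ λ (d : Fin 3 → F) → ∑ (λ i → c i *F B e (b i)) ≡ 0F × ∑ (λ i → d i *F B e (b i)) ≡ 0F ×
                      (∀ α β → (∀ i → α *F c i +F β *F d i ≡ 0F) → α ≡ 0F × β ≡ 0F)
                sol = plane-of-solutions (λ i → B e (b i))
                c c' : Fin 3 → F
                c = proj₁ sol
                c' = proj₁ (proj₂ sol)
                m m' : V
                m = lc c b
                m' = lc c' b
                combined : ∀ β γ j → β *F m j +F γ *F m' j ≡ lc (λ i → β *F c i +F γ *F c' i) b j
                combined β γ j = sym (trans
                  (∑-cong (λ i → solve 5 (λ α β c d b → (α :* c :+ β :* d) :* b := α :* (c :* b) :+ β :* (d :* b)) refl β γ (c i) (c' i) (b i j)))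
                  (trans (∑-+ (λ i → β *F (c i *F b i j)) (λ i → γ *F (c' i *F b i j))) (cong₂ _+F_ (∑-* β (λ i → c i *F b i j)) (∑-* γ (λ i → c' i *F b i j)))))
                ind' : LinIndep (triple e m m')
                ind' x z = all0
                  where
                  x₀ x₁ x₂ : F
                  x₀ = x zero
                  x₁ = x (suc zero)
                  x₂ = x (suc (suc zero))
                  rel : ∀ i → (x₀ ∷ (λ i → x₁ *F c i +F x₂ *F c' i)) i ≡ 0F
                  rel = ind (x₀ ∷ (λ i → x₁ *F c i +F x₂ *F c' i)) (λ j → trans (cong (x₀ *F e j +F_) (sym (combined x₁ x₂ j)))
                          (trans (cong (λ t → x₀ *F e j +F (x₁ *F m j +F t)) (sym (R.+-identityʳ _))) (z j)))
                  rest : x₁ ≡ 0F × x₂ ≡ 0F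
                  rest = proj₂ (proj₂ (proj₂ (proj₂ sol))) x₁ x₂ (λ i → rel (suc i))
                  all0 : ∀ i → x i ≡ 0F
                  all0 zero             = rel zero
                  all0 (suc zero)       = proj₁ rest
                  all0 (suc (suc zero)) = proj₂ rest
                singular : TotallySingular (subspace (triple e m m') ind')
                singular v (_ , x , v≈) = begin
                  Qf v      ≡⟨ Q-cong (≈-trans v≈ (λ j → cong (x zero *F e j +F_) (trans (cong (x (suc zero) *F m j +F_) (R.+-identityʳ _)) (trans (combined _ _ j) (sym (R.*-identityˡ _)))))) ⟩
                  Qf ((x zero · e) +V (1F · y))      ≡⟨ Q-combo (x zero) 1F e y ⟩
                  ((x zero *F x zero) *F Qf e +F (1F *F 1F) *F Qf y) +F (x zero *F 1F) *F B e y
                    ≡⟨ cong₂ _+F_ (cong₂ (λ s t → (x zero *F x zero) *F s +F (1F *F 1F) *F t) Qe (singular-Q {S = π₀} ts {y} ((λ i → x (suc zero) *F c i +F x (suc (suc zero)) *F c' i) , ≈-refl))) (cong ((x zero *F 1F) *F_) ey) ⟩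
                  ((x zero *F x zero) *F 0F +F (1F *F 1F) *F 0F) +F (x zero *F 1F) *F 0F
                    ≡⟨ solve 1 (λ a → ((a :* a) :* :0 :+ (:1 :* :1) :* :0) :+ (a :* :1) :* :0 := :0) refl (x zero) ⟩
                  0F ∎
                  where
                  y : V
                  y = lc (λ i → x (suc zero) *F c i +F x (suc (suc zero)) *F c' i) b
                  ey : B e y ≡ 0F
                  ey = trans (B-congʳ (λ j → sym (combined (x (suc zero)) (x (suc (suc zero))) j))) (trans (B-sym _ _) (trans (B-combo _ _ m m' e)
                         (trans (cong₂ (λ s t → x (suc zero) *F s +F x (suc (suc zero)) *F t)
                           (trans (B-sym m e) (trans (B-lcʳ c b e) (proj₁ (proj₂ (proj₂ sol))))) (trans (B-sym m' e) (trans (B-lcʳ c' b e) (proj₁ (proj₂ (proj₂ (proj₂ sol)))))))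
                           (zero-combination (x (suc zero)) (x (suc (suc zero)))))))

          ⊥Π⇒proj : ∀ {l} → l ⊥Π → proj l ≈ 0V
          ⊥Π⇒proj {l} l⊥ = Π-nondegenerate (proj∈Π l) (λ w w∈Π → trans (proj-B l w∈Π) (l⊥ w w∈Π))

          proj⇒⊥Π : ∀ {l} → proj l ≈ 0V → l ⊥Π
          proj⇒⊥Π {l} z w w∈Π = trans (sym (proj-B l w∈Π)) (B-0ˡ w z)

          opaque
            -- On a plane of the quadric through a singular l in Π^⊥ the condition of `radical-in-Π`
            -- is void, as `proj l` is zero. So l also lies in Π, and l = `proj l` = 0.
            perp-anisotropic : ∀ {l} → l ⊥Π → Qf l ≡ 0F → l ≈ 0V
            perp-anisotropic {l} l⊥ Ql with nonzero? l
            ... | inj₁ z = z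
            ... | inj₂ l≢0 with plane-through (l≢0 , Ql)
            ...   | π , ts , l∈π = ≈-trans (res≈0⇒proj (radical-in-Π π ts l∈π (λ i → B-0ˡ (Subspace.basis π i) (⊥Π⇒proj l⊥)))) (⊥Π⇒proj l⊥)

          singular-proj-nonzero : ∀ {v} → OnQ v → NonZero (proj v)
          singular-proj-nonzero (v≢0 , Qv) z = v≢0 (perp-anisotropic (proj⇒⊥Π z) Qv)

          -- The set X is the preimage of O under `proj`.

          IsPiX : V → Plane → Set
          IsPiX x π = π ⊆S Π × (∀ L → WLine L → x ∈S L → L ⊆S π)

          Cx : V → PointSet
          Cx x y = Σ Plane (λ π → IsPiX x π × InPolar π y × OnQ y)

          Xset : PointSet
          Xset y = Σ V (λ x → O x × ¬ InE x × Cx x y) ⊎ (O y × InE y)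

          module PerpPlane {e f : V} (Fr : Frame e f) where
            open Coordinates Fr

            -- Spans the plane e^⊥ of Π, which is the plane π_e of the statement.
            perp-basis : Fin 3 → V
            perp-basis = e ∷ g ∷ h ∷ []

            perp-basis-indep : LinIndep perp-basis
            perp-basis-indep c z = λ { zero → proj₁ p ; (suc zero) → proj₁ (proj₂ (proj₂ p)) ; (suc (suc zero)) → proj₂ (proj₂ (proj₂ p)) }
              where
              c₀ c₂ c₃ : F
              c₀ = c zero
              c₂ = c (suc zero)
              c₃ = c (suc (suc zero))
              p : c₀ ≡ 0F × 0F ≡ 0F × c₂ ≡ 0F × c₃ ≡ 0F
              p = vec-≡0 (≈-trans (vec-lc c₀ 0F c₂ c₃) (λ j → trans (solve 4 (λ a b f d → a :+ (:0 :* f :+ (b :+ (d :+ :0))) := a :+ (b :+ (d :+ :0))) refl (c₀ *F e j) (c₂ *F g j) (f j) (c₃ *F h j)) (z j)))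

            perp-span : ∀ {v} → InΠ v → B e v ≡ 0F → InSpan perp-basis v
            perp-span {v} v∈Π e⊥v = (B v f ∷ B v h ∷ B v g ∷ []) , λ j → trans (expand v∈Π j) (trans (vec-cong refl (trans (B-sym v e) e⊥v) refl refl j)
              (trans (vec-lc (B v f) 0F (B v h) (B v g) j) (solve 4 (λ a b f d → a :+ (:0 :* f :+ (b :+ (d :+ :0))) := a :+ (b :+ (d :+ :0))) refl (B v f *F e j) (B v h *F g j) (f j) (B v g *F h j))))

            perp-expand : ∀ {v} → InΠ v → B e v ≡ 0F → v ≈ vec (B v f) 0F (B v h) (B v g)
            perp-expand {v} v∈Π e⊥v = ≈-trans (expand v∈Π) (vec-cong refl (trans (B-sym v e) e⊥v) refl refl)

            multiple : ∀ {v} → InΠ v → B e v ≡ 0F → B g v ≡ 0F → B h v ≡ 0F → NonZero v → SamePoint v e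
            multiple {v} v∈Π ev gv hv v≢0 = B v f , (λ z → v≢0 (λ j → trans (v≈ j) (trans (cong (_*F e j) z) (R.zeroˡ _)))) , v≈
              where
              v≈ : v ≈ (B v f · e)
              v≈ j = trans (expand v∈Π j) (trans (vec-cong refl (trans (B-sym v e) ev) (trans (B-sym v h) hv) (trans (B-sym v g) gv) j)
                (trans (vec-lc (B v f) 0F 0F 0F j) (solve 5 (λ a e f g h → a :* e :+ (:0 :* f :+ (:0 :* g :+ (:0 :* h :+ :0))) := a :* e) refl (B v f) (e j) (f j) (g j) (h j))))

          opaque
            -- For y = proj y + res y on the quadric, y ∈ C_x amounts to proj y being the point x, because π_x^⊥ = ⟨x, Π^⊥⟩.
            X⇒O-proj : ∀ {y} → Xset y → OnQ y × O (proj y)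
            X⇒O-proj {y} (inj₂ (Oy , (y≢0 , y∈Π) , Qy)) = (y≢0 , Qy) , O-cong (proj-id (inΠ y∈Π)) Oy
            X⇒O-proj {y} (inj₁ (x , Ox , _ , π , (π⊆Π , W-lines) , (_ , π⊥y) , onQ)) =
                onQ , O-same (PerpPlane.multiple Fr (proj∈Π y) (proj-perp e∈Π x∈π) (proj-perp g∈Π g∈π) (proj-perp h∈Π h∈π) (singular-proj-nonzero onQ)) Ox
              where
              Fr : Frame x (proj₁ (pointFrame (O∈Π Ox) (O-nonzero Ox)))
              Fr = proj₂ (pointFrame (O∈Π Ox) (O-nonzero Ox))
              open Coordinates Fr
              b : Fin 3 → V
              b = Subspace.basis π
              proj-perp : ∀ {w} → InΠ w → InSpan b w → B w (proj y) ≡ 0F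
              proj-perp {w} w∈Π s = trans (B-sym w (proj y)) (trans (proj-B y w∈Π) (⊥-span {w = b} (λ i → trans (B-sym y (b i)) (π⊥y i)) s))
              -- The two lines of W(q) joining x to g and to h suffice: they force x, g and h into
              -- π.
              line⊆π : ∀ β γ (nt : ¬ (β ≡ 0F × γ ≡ 0F)) → subspace (x ∷ vec 0F 0F β γ ∷ []) (frame-line-indep Fr β γ nt) ⊆S π
              line⊆π β γ nt = W-lines (subspace (x ∷ vec 0F 0F β γ ∷ []) (frame-line-indep Fr β γ nt)) (isotropic⇒WLine e∈Π (vec∈Π 0F 0F β γ) (frame-line-indep Fr β γ nt) (B-e 0F 0F β γ))
                                (O-nonzero Ox , span-basis (x ∷ vec 0F 0F β γ ∷ []) zero)
              x∈π : InSpan b x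
              x∈π = line⊆π 1F 0F (λ (p , _) → 1≢0 p) zero
              g∈π : InSpan b g
              g∈π = span-cong {w = b} (≈-sym g≈) (line⊆π 1F 0F (λ (p , _) → 1≢0 p) (suc zero))
              h∈π : InSpan b h
              h∈π = span-cong {w = b} (≈-sym h≈) (line⊆π 0F 1F (λ (_ , p) → 1≢0 p) (suc zero))

            -- If `proj y` is singular, then so is `res y`; anisotropy makes it zero, and y is
            -- itself a point of O on the quadric. Otherwise y belongs to C_x for x = `proj y`.
            O-proj⇒X : ∀ {y} → OnQ y → O (proj y) → Xset y
            O-proj⇒X {y} (y≢0 , Qy) Op with Qf (proj y) ≟ 0F
            ... | yes Qp = inj₂ (O-cong y≈ Op , (y≢0 , InΠ.span (Π-cong (≈-sym y≈) (proj∈Π y))) , Qy)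
              where
              y≈ : y ≈ proj y
              y≈ = res≈0⇒proj (perp-anisotropic (λ w → res-⊥ y) (trans (solve 2 (λ a b → b := a :+ (a :+ b)) refl (Qf (proj y)) (Qf (res y)))
                     (trans (cong (Qf (proj y) +F_) (trans (sym (Q-split y)) Qy)) (trans (R.+-identityʳ _) Qp))))
            ... | no Qp≢0 = inj₁ (proj y , Op , (λ (_ , Qp) → Qp≢0 Qp) , π , (π⊆Π , W-lines) , (y≢0 , π⊥y) , y≢0 , Qy)
              where
              Fr : Frame (proj y) (proj₁ (pointFrame (O∈Π Op) (O-nonzero Op)))
              Fr = proj₂ (pointFrame (O∈Π Op) (O-nonzero Op))
              open Coordinates Fr
              open PerpPlane Fr
              π : Plane
              π = subspace perp-basis perp-basis-indep
              perp-basis∈Π : ∀ i → InΠ (perp-basis i)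
              perp-basis∈Π zero             = e∈Π
              perp-basis∈Π (suc zero)       = g∈Π
              perp-basis∈Π (suc (suc zero)) = h∈Π
              π⊆Π : π ⊆S Π
              π⊆Π i = InΠ.span (perp-basis∈Π i)
              W-lines : ∀ L → WLine L → proj y ∈S L → L ⊆S π
              W-lines L WL@(L⊆Π , _) (_ , y∈L) i = perp-span (inΠ (L⊆Π i)) (trans (B-sym (proj y) (Subspace.basis L i)) (⊥-span {w = Subspace.basis L} (isotropic i) y∈L))
                where
                L₀₁ : B (Subspace.basis L zero) (Subspace.basis L (suc zero)) ≡ 0F
                L₀₁ = WLine⇒isotropic L WL
                isotropic : ∀ i j → B (Subspace.basis L i) (Subspace.basis L j) ≡ 0F
                isotropic zero       zero       = B-alt _
                isotropic zero       (suc zero) = L₀₁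
                isotropic (suc zero) zero       = trans (B-sym _ _) L₀₁
                isotropic (suc zero) (suc zero) = B-alt _
              e⊥ : ∀ i → B (proj y) (perp-basis i) ≡ 0F
              e⊥ zero             = B-alt (proj y)
              e⊥ (suc zero)       = eg
              e⊥ (suc (suc zero)) = eh
              π⊥y : ∀ i → B (perp-basis i) y ≡ 0F
              π⊥y i = trans (B-sym (perp-basis i) y) (trans (sym (proj-B y (perp-basis∈Π i))) (e⊥ i))

          -- Planes of the quadric and their poles in Π.

          -- As z lies in Π, orthogonality to π amounts to orthogonality to the projection of π; for
          -- a plane of the quadric, z is thus the pole of the projected plane in Π.
          record Pole (π : Plane) (z : V) : Set where
            field
              z∈Π  : InΠ z
              z≢0  : NonZero z
              perp : ∀ i → B z (Subspace.basis π i) ≡ 0F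

          opaque
            -- Three linear equations in the four coordinates of Π.
            pole-exists : ∀ π → ∃ (Pole π)
            pole-exists π with dependent {3} {4} ℕₚ.≤-refl (λ i j → B (P i) (Subspace.basis π j))
            ... | c , nt , eqs = lc c P , record
              { z∈Π = inΠ (c , ≈-refl) ; z≢0 = indep-nonzero {w = P} (Subspace.indep Π) c nt
              ; perp = λ j → trans (B-lcˡ c P (Subspace.basis π j)) (eqs j) }

          module SingularPlane (π : Plane) (ts : TotallySingular π) where

            b : Fin 3 → V
            b = Subspace.basis π

            onQ : ∀ {v} → NonZero v → InSpan b v → OnQ v
            onQ v≢0 s = v≢0 , singular-Q {S = π} ts s

            proj-0 : proj 0V ≈ 0V
            proj-0 = ⊥Π⇒proj (λ w _ → B-0ˡ w (λ _ → refl))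

            X-in-π : ∀ {v} → InSpan b v → O (proj v) → Xset v
            X-in-π {v} s Op = O-proj⇒X (onQ (λ z → O-nonzero Op (≈-trans (proj-cong z) proj-0)) s) Op

            X⇒O : ∀ {v} → Xset v → O (proj v)
            X⇒O x = proj₂ (X⇒O-proj x)

            proj-injective : ∀ {v} → InSpan b v → proj v ≈ 0V → v ≈ 0V
            proj-injective s z = perp-anisotropic (proj⇒⊥Π z) (singular-Q {S = π} ts s)

            proj-b-indep : LinIndep (λ i → proj (b i))
            proj-b-indep c z = Subspace.indep π c (proj-injective (c , ≈-refl) (≈-trans (proj-lc c b) z))

            proj-same : ∀ {u v} → InSpan b u → InSpan b v → SamePoint (proj u) (proj v) → SamePoint u v
            proj-same {u} {v} s t (k , k≢0 , same) = k , k≢0 , λ j → trans (+≡0⇒≡ (trans (cong (_+F k *F v j) (sym (R.*-identityˡ _)))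
              (proj-injective (span-+ {w = b} (span-· {w = b} 1F s) (span-· {w = b} k t)) (≈-trans (proj-combo 1F k u v)
                (λ j → trans (cong (_+F k *F proj v j) (R.*-identityˡ _)) (≡⇒+≡0 (same j)))) j))) refl

            module AtPole {z : V} (pole : Pole π z) where
              open Pole pole

              frame-z : ∃ (Frame z)
              frame-z = pointFrame z∈Π z≢0

              open Coordinates (proj₂ frame-z)
              open PerpPlane (proj₂ frame-z)

              z⊥ : ∀ {v} → InSpan b v → B z (proj v) ≡ 0F
              z⊥ {v} s = trans (B-sym z (proj v)) (trans (proj-B v z∈Π) (trans (B-sym v z) (⊥-span {w = b} perp s)))

              opaque
                -- `proj` maps π onto z^⊥: the three projected basis vectors are independent, and
                -- with y they make four vectors in a space spanned by three.
                lift : ∀ {y} → InΠ y → B z y ≡ 0F → ∃ λ v → InSpan b v × proj v ≈ y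
                lift {y} y∈Π z⊥y = build (span-dependent perp-basis ℕₚ.≤-refl (y ∷ (λ i → proj (b i)))
                                     (λ { zero → perp-span y∈Π z⊥y ; (suc i) → perp-span (proj∈Π (b i)) (z⊥ (span-basis b i)) }))
                  where
                  build : (∃ λ c → Nontrivial c × lc c (y ∷ (λ i → proj (b i))) ≈ 0V) → ∃ λ v → InSpan b v × proj v ≈ y
                  build (c , nt , eq) = finish (head-in-span {w = λ i → proj (b i)} proj-b-indep c nt eq)
                    where
                    finish : InSpan (λ i → proj (b i)) y → ∃ λ v → InSpan b v × proj v ≈ y
                    finish (c , y≈) = lc c b , (c , ≈-refl) , ≈-trans (proj-lc c b) (≈-sym y≈)

                typeS : O z → MeetsInOnePoint Xset π
                typeS Oz = go (lift z∈Π (B-alt z))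
                  where
                  go : (∃ λ v → InSpan b v × proj v ≈ z) → MeetsInOnePoint Xset π
                  go (v , s , v≈) = v , (proj₁ (proj₁ (X⇒O-proj Xv)) , s) , Xv , λ u (_ , t) Xu →
                      proj-same t s (SamePoint-trans (O-perp-same (X⇒O Xu) Oz (trans (B-sym _ z) (z⊥ t))) (SamePoint-refl (≈-sym v≈)))
                    where
                    Xv : Xset v
                    Xv = X-in-π s (O-cong v≈ Oz)

              module OffPole (¬Oz : ¬ O z) where

                opaque
                  direction-point : ∀ β γ → ¬ (β ≡ 0F × γ ≡ 0F) → ∃ λ c → O (vec c 0F β γ)
                  direction-point β γ nt = build (meet-affine z∈Π (vec∈Π 0F 0F β γ) (frame-line-indep (proj₂ frame-z) β γ nt) (B-e 0F 0F β γ) ¬Oz)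
                    where
                    build : (∃ λ c → O (vec 0F 0F β γ +V (c · z))) → ∃ λ c → O (vec c 0F β γ)
                    build (c , Op) = c , O-cong (≈-sym (λ j → begin
                      vec 0F 0F β γ j +F c *F z j      ≡⟨ cong (λ m → vec 0F 0F β γ j +F c *F m) (e≈ j) ⟩
                      vec 0F 0F β γ j +F c *F vec 1F 0F 0F 0F j      ≡⟨ solve 3 (λ c x y → y :+ c :* x := c :* x :+ :1 :* y) refl c (vec 1F 0F 0F 0F j) (vec 0F 0F β γ j) ⟩
                      c *F vec 1F 0F 0F 0F j +F 1F *F vec 0F 0F β γ j  ≡⟨ vec-combo c 1F 1F 0F 0F 0F 0F 0F β γ j ⟩
                      _      ≡⟨ vec-cong (solve 1 (λ c → c :* :1 :+ :1 :* :0 := c) refl c) (solve 1 (λ c → c :* :0 :+ :1 :* :0 := :0) refl c)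
                                                                            (solve 2 (λ c b → c :* :0 :+ :1 :* b := b) refl c β) (solve 2 (λ c b → c :* :0 :+ :1 :* b := b) refl c γ) j ⟩
                      vec c 0F β γ j      ∎)) Op

                -- Normalised homogeneous coordinates (1 : 0) and (b : 1) of the q + 1 lines of W(q)
                -- through z.
                β γ : Fin (suc q) → F
                β zero    = 1F
                β (suc i) = Inverse.from card i
                γ zero    = 0F
                γ (suc i) = 1F

                nontrivial : ∀ i → ¬ (β i ≡ 0F × γ i ≡ 0F)
                nontrivial zero (p , _)    = 1≢0 p
                nontrivial (suc i) (_ , p) = 1≢0 p

                c : Fin (suc q) → F
                c i = proj₁ (direction-point (β i) (γ i) (nontrivial i))

                o : Fin (suc q) → V
                o i = vec (c i) 0F (β i) (γ i)

                Oo : ∀ i → O (o i)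
                Oo i = proj₂ (direction-point (β i) (γ i) (nontrivial i))

                o-injective : ∀ i j → SamePoint (o i) (o j) → i ≡ j
                o-injective i j (k , k≢0 , same) = go i j
                    (trans (sym (B-h (c i) 0F (β i) (γ i))) (trans (B-congʳ same) (trans (B-·ʳ k h (o j)) (cong (k *F_) (B-h (c j) 0F (β j) (γ j))))))
                    (trans (sym (B-g (c i) 0F (β i) (γ i))) (trans (B-congʳ same) (trans (B-·ʳ k g (o j)) (cong (k *F_) (B-g (c j) 0F (β j) (γ j))))))
                  where
                  go : ∀ i j → β i ≡ k *F β j → γ i ≡ k *F γ j → i ≡ j
                  go zero    zero    _  _  = refl
                  go zero    (suc j) _  eq = ⊥-elim (k≢0 (trans (sym (R.*-identityʳ k)) (sym eq)))
                  go (suc i) zero    _  eq = ⊥-elim (1≢0 (trans eq (R.zeroʳ k)))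
                  go (suc i) (suc j) eq eq' = cong suc (trans (sym (FinF.to-from i)) (trans (cong (Inverse.to card)
                    (trans eq (trans (cong (_*F β (suc j)) (sym (trans eq' (R.*-identityʳ k)))) (R.*-identityˡ _)))) (FinF.to-from j)))

                z⊥o : ∀ i → B z (o i) ≡ 0F
                z⊥o i = B-e (c i) 0F (β i) (γ i)

                lifted : ∀ i → ∃ λ v → InSpan b v × proj v ≈ o i
                lifted i = lift (vec∈Π _ _ _ _) (z⊥o i)

                p : Fin (suc q) → V
                p i = proj₁ (lifted i)

                p∈π : ∀ i → InSpan b (p i)
                p∈π i = proj₁ (proj₂ (lifted i))

                proj-p : ∀ i → proj (p i) ≈ o i
                proj-p i = proj₂ (proj₂ (lifted i))

                Xp : ∀ i → Xset (p i)
                Xp i = X-in-π (p∈π i) (O-cong (proj-p i) (Oo i))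

                p-injective : ∀ i j → SamePoint (p i) (p j) → i ≡ j
                p-injective i j (k , k≢0 , same) = o-injective i j (k , k≢0 , λ l → trans (sym (proj-p i l)) (trans (proj-cong same l) (trans (proj-· l) (cong (k *F_) (proj-p j l)))))
                  where
                  proj-· : proj (k · p j) ≈ (k · proj (p j))
                  proj-· l = trans (proj-cong {k · p j} {(k · p j) +V (0F · p j)} (λ m → solve 2 (λ k x → k :* x := k :* x :+ :0 :* x) refl k (p j m)) l)
                              (trans (proj-combo k 0F (p j) (p j) l) (solve 2 (λ k x → k :* x :+ :0 :* x := k :* x) refl k (proj (p j) l)))

                no-collinear : ∀ i j k → ¬ (i ≡ j) → ¬ (j ≡ k) → ¬ (i ≡ k) → ¬ Collinear (p i) (p j) (p k)
                no-collinear i j k i≢j j≢k i≢k collinear = collinear λ x eq →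
                  O-distinct-indep (Oo i) (Oo j) (Oo k) (λ s → i≢j (o-injective i j s)) (λ s → j≢k (o-injective j k s)) (λ s → i≢k (o-injective i k s)) x
                    (≈-trans (lc-cong {c = x} {d = x} {w = triple (o i) (o j) (o k)} {x = λ l → proj (triple (p i) (p j) (p k) l)} (λ _ → refl)
                        (λ { zero → ≈-sym (proj-p i) ; (suc zero) → ≈-sym (proj-p j) ; (suc (suc zero)) → ≈-sym (proj-p k) }))
                      (≈-trans (≈-sym (proj-lc x (triple (p i) (p j) (p k)))) (≈-trans (proj-cong eq) proj-0)))

                covers : ∀ v → v ∈S π → Xset v → Σ (Fin (suc q)) (λ i → SamePoint v (p i))
                covers v (_ , s) Xv = go (γ' ≟ 0F)
                  where
                  α' β' γ' : F
                  α' = B (proj v) (proj₁ frame-z)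
                  β' = B (proj v) h
                  γ' = B (proj v) g
                  v≈ : proj v ≈ vec α' 0F β' γ'
                  v≈ = perp-expand (proj∈Π v) (z⊥ s)
                  -- Proportional (g, h)-components make `proj v` orthogonal to `o i`, hence the
                  -- same point of O.
                  at : ∀ i → β' *F γ i +F γ' *F β i ≡ 0F → Σ (Fin (suc q)) (λ i → SamePoint v (p i))
                  at i eq = i , proj-same s (p∈π i) (SamePoint-trans (O-perp-same (X⇒O Xv) (Oo i) (trans (B-congˡ v≈) (trans (B-vec α' 0F β' γ' (c i) 0F (β i) (γ i))
                      (trans (cong (α' *F 0F +F 0F *F c i +F_) eq) (solve 2 (λ a b → (a :* :0 :+ :0 :* b) :+ :0 := :0) refl α' (c i)))))) (SamePoint-refl (≈-sym (proj-p i))))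
                  go : Dec (γ' ≡ 0F) → Σ (Fin (suc q)) (λ i → SamePoint v (p i))
                  go (yes γ≡0) = at zero (trans (cong (λ m → β' *F 0F +F m *F 1F) γ≡0) (solve 1 (λ b → b :* :0 :+ :0 :* :1 := :0) refl β'))
                  go (no γ≢0) = at (suc (Inverse.to card (β' *F γ' ⁻¹))) (trans (cong (λ m → β' *F 1F +F γ' *F m) (FinF.from-to (β' *F γ' ⁻¹)))
                      (trans (solve 3 (λ b g g⁻ → b :* :1 :+ g :* (b :* g⁻) := b :+ b :* (g :* g⁻)) refl β' γ' (γ' ⁻¹))
                        (trans (cong (λ m → β' +F β' *F m) (⁻¹-inverse γ≢0)) (solve 1 (λ b → b :+ b :* :1 := :0) refl β'))))

                typeC : IsOvalIn Xset π
                typeC = p , (λ i → (proj₁ (proj₁ (X⇒O-proj (Xp i))) , p∈π i) , Xp i) , p-injective , no-collinear , covers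

                private module _ (β γ : F) (nt : ¬ (β ≡ 0F × γ ≡ 0F)) where
                  zl : ∃ λ v → InSpan b v × proj v ≈ z
                  zl = lift z∈Π (B-alt z)
                  yl : ∃ λ v → InSpan b v × proj v ≈ vec 0F 0F β γ
                  yl = lift (vec∈Π 0F 0F β γ) (B-e 0F 0F β γ)
                  w : Fin 2 → V
                  w = proj₁ zl ∷ proj₁ yl ∷ []
                  w∈π : ∀ i → InSpan b (w i)
                  w∈π zero       = proj₁ (proj₂ zl)
                  w∈π (suc zero) = proj₁ (proj₂ yl)
                  proj-w : ∀ x → proj (lc x w) ≈ lc x (z ∷ vec 0F 0F β γ ∷ [])
                  proj-w x = ≈-trans (proj-lc x w) (lc-cong {c = x} {d = x} {w = λ i → proj (w i)} {x = z ∷ vec 0F 0F β γ ∷ []} (λ _ → refl)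
                               (λ { zero → proj₂ (proj₂ zl) ; (suc zero) → proj₂ (proj₂ yl) }))
                  coordinates : ∀ x → proj (lc x w) ≈ vec (x zero) 0F (x (suc zero) *F β) (x (suc zero) *F γ)
                  coordinates x j = begin
                    proj (lc x w) j      ≡⟨ proj-w x j ⟩
                    x zero *F z j +F (x (suc zero) *F vec 0F 0F β γ j +F 0F)      ≡⟨ cong₂ _+F_ (cong (x zero *F_) (e≈ j)) (R.+-identityʳ _) ⟩
                    x zero *F vec 1F 0F 0F 0F j +F x (suc zero) *F vec 0F 0F β γ j ≡⟨ vec-combo (x zero) (x (suc zero)) 1F 0F 0F 0F 0F 0F β γ j ⟩
                    _      ≡⟨ vec-cong (solve 2 (λ a k → a :* :1 :+ k :* :0 := a) refl (x zero) (x (suc zero)))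
                                                                                       (zero-combination (x zero) (x (suc zero)))
                                                                                       (solve 3 (λ a k b → a :* :0 :+ k :* b := k :* b) refl (x zero) (x (suc zero)) β)
                                                                                       (solve 3 (λ a k b → a :* :0 :+ k :* b := k :* b) refl (x zero) (x (suc zero)) γ) j ⟩
                    vec (x zero) 0F (x (suc zero) *F β) (x (suc zero) *F γ)       j ∎
                  L : Line
                  L = subspace w (λ x eq → frame-line-indep (proj₂ frame-z) β γ nt x (≈-trans (≈-sym (proj-w x)) (≈-trans (proj-cong eq) proj-0)))
                  L⊆π : L ⊆S π
                  L⊆π = w∈π

                  opaque
                    meets-X : MeetsInOnePoint Xset L
                    meets-X = v , (proj₁ (proj₁ (X⇒O-proj Xv)) , x , ≈-refl) , Xv , unique
                      where
                      a : F
                      a = proj₁ (direction-point β γ nt)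
                      x : Fin 2 → F
                      x = a ∷ 1F ∷ []
                      v : V
                      v = lc x w
                      Oa : O (vec a 0F β γ)
                      Oa = proj₂ (direction-point β γ nt)
                      proj-v : proj v ≈ vec a 0F β γ
                      proj-v = ≈-trans (coordinates x) (vec-cong refl refl (R.*-identityˡ β) (R.*-identityˡ γ))
                      Xv : Xset v
                      Xv = X-in-π (span-lc {w = b} {u = w} x w∈π) (O-cong proj-v Oa)
                      unique : ∀ u → u ∈S L → Xset u → SamePoint u v
                      unique u (_ , y , u≈) Xu = proj-same (span-trans {w = b} {u = w} w∈π (y , u≈)) (span-lc {w = b} {u = w} x w∈π)
                        (SamePoint-trans (O-perp-same (X⇒O Xu) Oa perp-a) (SamePoint-refl (≈-sym proj-v)))
                        where
                        perp-a : B (proj u) (vec a 0F β γ) ≡ 0F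
                        perp-a = trans (B-congˡ (≈-trans (proj-cong u≈) (coordinates y))) (trans (B-vec _ _ _ _ a 0F β γ)
                          (solve 5 (λ y₀ y₁ a b c → (y₀ :* :0 :+ :0 :* a) :+ ((y₁ :* b) :* c :+ (y₁ :* c) :* b) := :0) refl (y zero) (y (suc zero)) a β γ))

                  kernel-coordinates : ∀ {n} → IsKernel Xset π n → ∃ λ a → ∃ λ k → proj n ≈ vec a 0F (k *F β) (k *F γ)
                  kernel-coordinates (_ , through) = go (through L L⊆π meets-X)
                    where
                    go : ∀ {n} → n ∈S L → ∃ λ a → ∃ λ k → proj n ≈ vec a 0F (k *F β) (k *F γ)
                    go (_ , x , n≈) = x zero , x (suc zero) , ≈-trans (proj-cong n≈) (coordinates x)

                opaque
                  -- The lines of π over ⟨z, g⟩ and ⟨z, h⟩ meet X in one point each, so a kernel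
                  -- lies on both; their projections have only z in common.
                  kernel-is-pole : ∀ {n} → IsKernel Xset π n → SamePoint (proj n) z
                  kernel-is-pole {n} ker@((n≢0 , n∈π) , _) = multiple (proj∈Π n) (z⊥ n∈π) gn hn (λ eq → n≢0 (proj-injective n∈π eq))
                    where
                    by-g : ∃ λ a → ∃ λ k → proj n ≈ vec a 0F (k *F 1F) (k *F 0F)
                    by-g = kernel-coordinates 1F 0F (λ (p , _) → 1≢0 p) ker
                    by-h : ∃ λ a → ∃ λ k → proj n ≈ vec a 0F (k *F 0F) (k *F 1F)
                    by-h = kernel-coordinates 0F 1F (λ (_ , p) → 1≢0 p) ker
                    gn : B g (proj n) ≡ 0F
                    gn = trans (B-congʳ (proj₂ (proj₂ by-g))) (trans (B-g _ _ _ _) (R.zeroʳ _))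
                    hn : B h (proj n) ≡ 0F
                    hn = trans (B-congʳ (proj₂ (proj₂ by-h))) (trans (B-h _ _ _ _) (R.zeroʳ _))

            -- A line of π off the nucleus n that meets X in p would, by second-point, meet X a second time.
            opaque
              pole-is-kernel : ∀ {n} → InSpan b n → Pole π (proj n) → ¬ O (proj n) → IsKernel Xset π n
              pole-is-kernel {n} n∈π pole ¬On = (n≢0 , n∈π) , through
                where
                n≢0 : NonZero n
                n≢0 eq = Pole.z≢0 pole (≈-trans (proj-cong eq) proj-0)
                through : ∀ (L : Line) → L ⊆S π → MeetsInOnePoint Xset L → n ∈S L
                through L L⊆π (p , (p≢0 , p∈L) , Xp , unique) = n≢0 , n∈L second
                  where
                  l : Fin 2 → V
                  l = Subspace.basis L
                  in-π : ∀ {v} → InSpan l v → InSpan b v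
                  in-π = span-trans {w = b} {u = l} L⊆π
                  second : ∃ λ w → InSpan l w × LinIndep (p ∷ w ∷ [])
                  second with same-or-indep p≢0 (indep-basis-nonzero {w = l} (Subspace.indep L) zero)
                  ... | inj₂ ind = l zero , span-basis l zero , ind
                  ... | inj₁ same = l (suc zero) , span-basis l (suc zero) , distinct-indep p≢0 (indep-basis-nonzero {w = l} (Subspace.indep L) (suc zero))
                                      (λ same' → indep-distinct (Subspace.indep L) (SamePoint-trans (SamePoint-sym same) same'))
                  n∈L : (∃ λ w → InSpan l w × LinIndep (p ∷ w ∷ [])) → InSpan l n
                  n∈L (w , w∈L , pw) = decide (indep? (n ∷ p ∷ w ∷ []))
                    where
                    pw∈L : ∀ i → InSpan l ((p ∷ w ∷ []) i)
                    pw∈L zero       = p∈L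
                    pw∈L (suc zero) = w∈L
                    npw∈π : ∀ i → InSpan b ((n ∷ p ∷ w ∷ []) i)
                    npw∈π zero             = n∈π
                    npw∈π (suc zero)       = in-π p∈L
                    npw∈π (suc (suc zero)) = in-π w∈L
                    decide : LinIndep (n ∷ p ∷ w ∷ []) ⊎ (∃ λ c → Nontrivial c × lc c (n ∷ p ∷ w ∷ []) ≈ 0V) → InSpan l n
                    decide (inj₂ (c , nt , eq)) = span-trans {w = l} {u = p ∷ w ∷ []} pw∈L (head-in-span {w = p ∷ w ∷ []} pw c nt eq)
                    decide (inj₁ ind) = ⊥-elim (absurd (second-point (Pole.z∈Π pole) (proj∈Π w) (AtPole.z⊥ pole (in-π p∈L)) (AtPole.z⊥ pole (in-π w∈L)) proj-ind ¬On (X⇒O Xp)))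
                      where
                      proj-ind : LinIndep (triple (proj n) (proj p) (proj w))
                      proj-ind x eq = ind x (proj-injective (span-lc {w = b} {u = n ∷ p ∷ w ∷ []} x npw∈π) (≈-trans (proj-lc x (n ∷ p ∷ w ∷ [])) eq))
                      absurd : (∃ λ t → O (proj w +V (t · proj p))) → ⊥
                      absurd (t , Ou) = go (unique u (proj₁ (proj₁ (X⇒O-proj Xu)) , u∈L) Xu)
                        where
                        u : V
                        u = (1F · w) +V (t · p)
                        u∈L : InSpan l u
                        u∈L = span-+ {w = l} (span-· {w = l} 1F w∈L) (span-· {w = l} t p∈L)
                        Xu : Xset u
                        Xu = X-in-π (in-π u∈L) (O-cong (≈-trans (proj-combo 1F t w p) (λ j → cong (_+F t *F proj p j) (R.*-identityˡ _))) Ou)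
                        go : SamePoint u p → ⊥
                        go (k , _ , same) = 1≢0 (pw ((t +F k) ∷ 1F ∷ []) (λ j → trans
                          (solve 4 (λ t k p w → (t :+ k) :* p :+ (:1 :* w :+ :0) := (:1 :* w :+ t :* p) :+ k :* p) refl t k (p j) (w j)) (≡⇒+≡0 (same j))) (suc zero))

            -- A point of π in Π is orthogonal to π because π is totally singular; this holds for
            -- every plane of the quadric through v, whence both properties.
            own-pole : ∀ {v} → NonZero v → InSpan b v → res v ≈ 0V → Pole π (proj v)
            own-pole {v} v≢0 v∈π res≈0 = record
              { z∈Π = proj∈Π v ; z≢0 = λ eq → v≢0 (≈-trans (res≈0⇒proj res≈0) eq)
              ; perp = λ i → trans (B-congˡ (≈-sym (res≈0⇒proj res≈0))) (singular-B {S = π} ts v∈π (span-basis b i)) }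

            -- Two different indices of an oval: q is a variable, so the second index of
            -- `Fin (suc q)` is taken from the field element 0.
            zero≢one : ∀ {A : Set} → zero ≡ Fin.suc (Inverse.to card 0F) → A
            zero≢one ()

            -- If z were not on O, the plane would contain an oval of points of X, which has at
            -- least two points.
            typeS⇒O : ∀ {z} → Pole π z → MeetsInOnePoint Xset π → O z
            typeS⇒O pole (_ , _ , _ , unique) with O? (Pole.z∈Π pole) (Pole.z≢0 pole)
            ... | yes Oz = Oz
            ... | no ¬Oz = zero≢one (p-injective zero (suc (Inverse.to card 0F)) (SamePoint-trans (on zero) (SamePoint-sym (on (suc (Inverse.to card 0F))))))
              where
              open AtPole.OffPole pole ¬Oz
              on : ∀ i → SamePoint (p i) _
              on i = unique (p i) (proj₁ (proj₁ (X⇒O-proj (Xp i))) , p∈π i) (Xp i)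

            typeC⇒¬O : ∀ {z} → Pole π z → IsOvalIn Xset π → ¬ O z
            typeC⇒¬O pole (p , on , inj , _) Oz = go (AtPole.typeS pole Oz)
              where
              go : MeetsInOnePoint Xset π → ⊥
              go (_ , _ , _ , unique) = zero≢one (inj zero (suc (Inverse.to card 0F)) (SamePoint-trans (same zero) (SamePoint-sym (same (suc (Inverse.to card 0F))))))
                where
                same : ∀ i → SamePoint (p i) _
                same i = unique (p i) (proj₁ (on i)) (proj₂ (on i))

            type : MeetsInOnePoint Xset π ⊎ IsOvalIn Xset π
            type with pole-exists π
            ... | z , pole with O? (Pole.z∈Π pole) (Pole.z≢0 pole)
            ...   | yes Oz = inj₁ (AtPole.typeS pole Oz)
            ...   | no ¬Oz = inj₂ (AtPole.OffPole.typeC pole ¬Oz)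

          -- Properties (1) and (2), and planes of both types.

          QPlane : Plane → Set
          QPlane π = TotallySingular π

          TypeS TypeC : Plane → Set
          TypeS π = MeetsInOnePoint Xset π
          TypeC π = IsOvalIn Xset π

          A₁ A₂ : PointSet
          A₁ v = Xset v × Σ Plane (λ π → QPlane π × TypeS π × v ∈S π)
          A₂ v = Σ Plane (λ π → QPlane π × TypeC π × IsKernel Xset π v)

          -- The pole z of the type (S) plane is on O, and `proj v` is a point of O in z^⊥, so they
          -- coincide. Hence v lies in Π and is its own pole in every plane of the quadric through
          -- it.
          property1 : ∀ v → A₁ v → ∀ π → QPlane π → v ∈S π → TypeS π
          property1 v (Xv , π , ts , S , _ , v∈π) π' ts' (v≢0 , v∈π') = SingularPlane.AtPole.typeS π' ts' (SingularPlane.own-pole π' ts' v≢0 v∈π' res≈0) (proj₂ (X⇒O-proj Xv))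
            where
            open SingularPlane π ts
            pole : Pole π (proj₁ (pole-exists π))
            pole = proj₂ (pole-exists π)
            same : SamePoint (proj v) (proj₁ (pole-exists π))
            same = O-perp-same (X⇒O Xv) (typeS⇒O pole S) (trans (B-sym _ _) (AtPole.z⊥ pole v∈π))
            res≈0 : res v ≈ 0V
            res≈0 = radical-in-Π π ts v∈π (λ i → SamePoint-⊥ same (Pole.perp pole i))

          -- Here `proj v` equals z because v is a kernel, and z is not on O because the plane has
          -- type (C); these two facts carry over to every plane of the quadric through v.
          property2 : ∀ v → A₂ v → ∀ π → QPlane π → v ∈S π → TypeC π × IsKernel Xset π v
          property2 v (π , ts , C , ker@((_ , v∈π) , _)) π' ts' (v≢0 , v∈π') =
            SingularPlane.AtPole.OffPole.typeC π' ts' pole' ¬Ov , SingularPlane.pole-is-kernel π' ts' v∈π' pole' ¬Ov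
            where
            open SingularPlane π ts
            pole : Pole π (proj₁ (pole-exists π))
            pole = proj₂ (pole-exists π)
            ¬Oz : ¬ O (proj₁ (pole-exists π))
            ¬Oz = typeC⇒¬O pole C
            same : SamePoint (proj v) (proj₁ (pole-exists π))
            same = AtPole.OffPole.kernel-is-pole pole ¬Oz ker
            pole' : Pole π' (proj v)
            pole' = SingularPlane.own-pole π' ts' v≢0 v∈π' (radical-in-Π π ts v∈π (λ i → SamePoint-⊥ same (Pole.perp pole i)))
            ¬Ov : ¬ O (proj v)
            ¬Ov Ov = ¬Oz (O-same (SamePoint-sym same) Ov)

          Π-res : ∀ {v} → InΠ v → res v ≈ 0V
          Π-res v∈Π j = ≡⇒+≡0 (sym (proj-id v∈Π j))

          some-typeS : Σ Plane λ π → QPlane π × TypeS π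
          some-typeS = go O-meets-Q
            where
            go : (∃ λ v → InΠ v × O v × Qf v ≡ 0F) → Σ Plane λ π → QPlane π × TypeS π
            go (v , v∈Π , Ov , Qv) = at (plane-through (O-nonzero Ov , Qv))
              where
              at : (Σ Plane λ π → TotallySingular π × InSpan (Subspace.basis π) v) → Σ Plane λ π → QPlane π × TypeS π
              at (π , ts , v∈π) = π , ts , AtPole.typeS (own-pole (O-nonzero Ov) v∈π (Π-res v∈Π)) (O-cong (proj-id v∈Π) Ov)
                where open SingularPlane π ts

          some-typeC : ¬ (∀ v → NonZero v → (O v → InE v) × (InE v → O v)) → Σ Plane λ π → QPlane π × TypeC π
          some-typeC O≢E = go (Q-minus-O O≢E)
            where
            go : (∃ λ v → InΠ v × NonZero v × Qf v ≡ 0F × ¬ O v) → Σ Plane λ π → QPlane π × TypeC π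
            go (v , v∈Π , v≢0 , Qv , ¬Ov) = at (plane-through (v≢0 , Qv))
              where
              at : (Σ Plane λ π → TotallySingular π × InSpan (Subspace.basis π) v) → Σ Plane λ π → QPlane π × TypeC π
              at (π , ts , v∈π) = π , ts , AtPole.OffPole.typeC (own-pole v≢0 v∈π (Π-res v∈Π)) (λ Op → ¬Ov (O-cong (≈-sym (proj-id v∈Π)) Op))
                where open SingularPlane π ts

theorem4p3 : (q : ℕ) → 2 ∣ q → (K : FiniteField q) →
    let open Geometry K in
    (a : Fin 6 → Fin 6 → F) →
    let open Quadric a in
    Hyperbolic →
    (Π : Solid) → EllipticIn Π →
    let open InSolid Π in
    (O : PointSet) → IsOvoidW O →
    ¬ (∀ v → NonZero v → (O v → InE v) × (InE v → O v)) →
    GenQuadSetSC (Xset O) × Property1 (Xset O) × Property2 (Xset O)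
theorem4p3 q 2∣q K a (nondegenerate , singular-plane) Π elliptic O isOvoid O≢E =
    ( (λ v Xv → proj₁ (X⇒O-proj Xv))
    , (λ π ts → SingularPlane.type π ts)
    , some-typeS
    , some-typeC O≢E )
  , property1
  , property2
  where
  open OverField 2∣q K
  open WithForm (Geometry.Quadric.Qf K a) (Geometry.Quadric.B K a) (PolarForm.isQuadratic a)
  open InSolid Π elliptic
  open Ovoid O isOvoid
  open Klein nondegenerate singular-plane
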